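{- Let $Y$ be the affine curve (of genus 4) over $\mathbb{Q}$ defined by \[ t(t+1)u^3 + (t^3+2t^2-t-1)u^2 + (t^3-t^2-4t-1)u - t(t+1) = 0. \] Then $Y(\mathbb{Q},2) = Y(\mathbb{Q}) = \{(0,-1),(0,0),(-1,0),(-1,-1)\}$.
   Context: For a curve $X$ defined over $\mathbb{Q}$, $X(\mathbb{Q},2)$ denotes the set of points $P \in X(\overline{\mathbb{Q}})$ whose field of definition $\mathbb{Q}(P)$ satisfies $[\mathbb{Q}(P):\mathbb{Q}] \le 2$. -}

module Defs where

open import Data.Integer as ℤ using (ℤ)
open import Data.Rational using (ℚ; _+_; _*_; -_; 0ℚ; 1ℚ)
open import Data.Product using (_×_; _,_)
open import Data.Sum using (_⊎_)
open import Relation.Binary.PropositionalEquality using (_≡_)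
open import Relation.Nullary using (¬_)

-- Elements a + b·√d of the quadratic algebra ℚ[x]/(x² − d), represented
-- as pairs (a , b) of rationals.  When d ∈ ℤ is not a perfect square this
-- is the quadratic field ℚ(√d); every quadratic field arises this way,
-- and ℚ ⊂ ℚ(√d) is the subset with b = 0.
Quad : Set
Quad = ℚ × ℚ

module _ (d : ℤ) where

  dℚ : ℚ
  dℚ = Data.Rational._/_ d 1

  _⊕_ : Quad → Quad → Quad
  (a , b) ⊕ (c , e) = (a + c , b + e)

  _⊗_ : Quad → Quad → Quad
  (a , b) ⊗ (c , e) = (a * c + dℚ * (b * e) , a * e + b * c)

  ⊖_ : Quad → Quad
  ⊖ (a , b) = (- a , - b)

  infixl 6 _⊕_
  infixl 7 _⊗_

  cst : ℤ → Quad
  cst n = (Data.Rational._/_ n 1 , 0ℚ)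

  cube : Quad → Quad
  cube x = x ⊗ x ⊗ x

  sq : Quad → Quad
  sq x = x ⊗ x

  F : Quad → Quad → Quad
  F t u =
      t ⊗ (t ⊕ cst (ℤ.+ 1)) ⊗ cube u
    ⊕ (cube t ⊕ cst (ℤ.+ 2) ⊗ sq t ⊕ ⊖ t ⊕ cst (ℤ.- ℤ.+ 1)) ⊗ sq u
    ⊕ (cube t ⊕ ⊖ sq t ⊕ cst (ℤ.- ℤ.+ 4) ⊗ t ⊕ cst (ℤ.- ℤ.+ 1)) ⊗ u
    ⊕ ⊖ (t ⊗ (t ⊕ cst (ℤ.+ 1)))

  OnY : Quad → Quad → Set
  OnY t u = F t u ≡ (0ℚ , 0ℚ)

emb : ℚ → Quad
emb q = (q , 0ℚ)

InFour : Quad → Quad → Set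
InFour t u =
     (t , u) ≡ (emb 0ℚ , emb (- 1ℚ))
  ⊎ (t , u) ≡ (emb 0ℚ , emb 0ℚ)
  ⊎ (t , u) ≡ (emb (- 1ℚ) , emb 0ℚ)
  ⊎ (t , u) ≡ (emb (- 1ℚ) , emb (- 1ℚ))

-- d is not a perfect square in ℤ (so ℚ[x]/(x²−d) is a field)
NonSquare : ℤ → Set
NonSquare d = (k : ℤ) → ¬ (k ℤ.* k ≡ d)

{-# OPTIONS --safe #-}

-- Put σx = -1/(x + 1), which has order 3, and g(x) = x + σx + σ²x.  For t, u ∉ {0, -1} the equation
-- of Y is g(t) + g(u) = -2, so σ acts on Y through either coordinate.  The point (s, p) = (t + u, tu)
-- lies on the cubic s p² + (s² - s - 2) p - s² - s = 0, an elliptic curve with six rational points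
-- (three of them at infinity), by a descent through quartics n² = q(m², e²).
-- For a quadratic point the line through (s, p) and its conjugate is rational, and hence so is its
-- third intersection with the cubic.  Each of the six possibilities means that σⁱt + σⁱu or σⁱt σⁱu
-- is rational for some i.  For irrational t and u two of the points (t, u), (t, σu), (t, σ²u) give
-- relations of the same kind, and elimination refutes every such pair of relations; one pair
-- leads to x³ = x + 1, which has no rational solution.  If only u is irrational, the line is t = const
-- and its third point is again rational, which forces t ∈ {0, -1} and then u ∈ {0, -1}.
module Submission where

open import Defs
open import Algebra.Bundles using (CommutativeRing)
open import Algebra.Structures using (IsCommutativeRing)
open import Data.Bool using (Bool; true; false; T; _∧_)
open import Data.Bool.Properties using (T-∧)
open import Data.Empty using (⊥; ⊥-elim)
open import Data.Fin using (Fin; zero; suc)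
open import Data.Integer as ℤ using (ℤ)
import Data.Integer.Properties as ℤₚ
open import Data.List using (List; []; _∷_)
open import Data.Nat as ℕ using (ℕ; zero; suc)
import Data.Nat.Properties as ℕₚ
open import Data.Nat.Induction using (Acc; acc; <-wellFounded)
open import Data.Product using (∃; ∃₂; _×_; _,_; proj₁; proj₂)
open import Data.Sum using (_⊎_; inj₁; inj₂; [_,_]′)
import Data.Sum as Sum
open import Data.Unit using (⊤; tt)
open import Data.Vec using (Vec; []; _∷_; lookup; map; tabulate)
open import Data.Vec.Properties using (lookup-map)
open import Function using (_∘_; id; Equivalence)
open import Function.Bundles using (_⇔_; mk⇔)
open import Relation.Binary.PropositionalEquality
open import Relation.Nullary using (¬_; contradiction; yes; no)
open import Relation.Nullary.Decidable using (from-yes; from-no)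

-- The equation of Y is symmetric in t and u, and the cubic comes from dividing by this exchange.
-- With X = 8 (s + 1)/(s + 2) the cubic becomes W² = X (X² - 11 X + 32), which is 2-isogenous to W²
-- = X (X² + 22 X - 7). These two equations are the source of the constants 11, 22, 7 and of the
-- splittings 32 = 8 * 4 = 16 * 2 = 32 * 1 in the descent. The obstacle is that over ℚ(√d) the cubic
-- may have infinitely many points; only the line through a point and its conjugate is controlled.
-- The contradiction therefore needs several images of one point of Y, and these exist because σ may
-- act on a single coordinate. To turn σ into a permutation, t is replaced by the triple (1 : N(t +
-- 1) : N(t)) of norms, which σ rotates up to a scalar. The conditions on (t, u) become polynomial
-- equations between two triples, with the square root eliminated.

infixl 6 _:+_ _:-_
infixl 7 _:*_
infix 8 :-_ #_

-- Certified linear combinations in commutative rings.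

data Expr (n : ℕ) : Set where
  var : Fin n → Expr n
  con : ℤ → Expr n
  _:+_ _:*_ : Expr n → Expr n → Expr n
  :-_ : Expr n → Expr n

_:-_ : ∀ {n} → Expr n → Expr n → Expr n
x :- y = x :+ :- y

#_ : ∀ {n} → ℕ → Expr n
# k = con (ℤ.+ k)

-- Dense polynomials, in the first variable over the polynomials in the others.
Poly : ℕ → Set
Poly zero    = ℤ
Poly (suc n) = List (Poly n)

constant : ∀ {n} → ℤ → Poly n
constant {zero}  c = c
constant {suc n} c = constant c ∷ []

variable′ : ∀ {n} → Fin n → Poly n
variable′ zero    = constant ℤ.0ℤ ∷ constant ℤ.1ℤ ∷ []
variable′ (suc i) = variable′ i ∷ []

add : ∀ {n} → Poly n → Poly n → Poly n
addL : ∀ {n} → List (Poly n) → List (Poly n) → List (Poly n)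
add {zero}  = ℤ._+_
add {suc n} = addL
addL []       qs       = qs
addL (p ∷ ps) []       = p ∷ ps
addL (p ∷ ps) (q ∷ qs) = add p q ∷ addL ps qs

mul : ∀ {n} → Poly n → Poly n → Poly n
mulL : ∀ {n} → List (Poly n) → List (Poly n) → List (Poly n)
scale : ∀ {n} → Poly n → List (Poly n) → List (Poly n)
mul {zero}  = ℤ._*_
mul {suc n} = mulL
mulL []       qs = []
mulL (p ∷ ps) qs = addL (scale p qs) (constant ℤ.0ℤ ∷ mulL ps qs)
scale p []       = []
scale p (q ∷ qs) = mul p q ∷ scale p qs

neg : ∀ {n} → Poly n → Poly n
negL : ∀ {n} → List (Poly n) → List (Poly n)
neg {zero}  = ℤ.-_
neg {suc n} = negL
negL []       = []
negL (p ∷ ps) = neg p ∷ negL ps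

-- Coefficient lists are never trimmed, so zero has many representations; the test inspects every
-- coefficient.
isZero : ∀ {n} → Poly n → Bool
isZeroL : ∀ {n} → List (Poly n) → Bool
isZero {zero} (ℤ.+ zero) = true
isZero {zero} _ = false
isZero {suc n} = isZeroL
isZeroL []       = true
isZeroL (p ∷ ps) = isZero p ∧ isZeroL ps

normalise : ∀ {n} → Expr n → Poly n
normalise (var i)  = variable′ i
normalise (con c)  = constant c
normalise (x :+ y) = add (normalise x) (normalise y)
normalise (x :* y) = mul (normalise x) (normalise y)
normalise (:- x)   = neg (normalise x)

-- An equation l ≡ r together with the coefficient with which it enters a linear combination.
record Hypothesis (n : ℕ) : Set where
  constructor _⟨_≈_⟩
  field
    coefficient lhs rhs : Expr n
infix 4 _⟨_≈_⟩

defect : ∀ {n} → List (Hypothesis n) → Expr n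
defect []                = con ℤ.0ℤ
defect ((c ⟨ l ≈ r ⟩) ∷ hs) = c :* (l :- r) :+ defect hs

infix 4 _≈_⇐_
record Problem (n : ℕ) : Set where
  constructor _≈_⇐_
  field
    lhs rhs : Expr n
    from    : List (Hypothesis n)

module Solver
  {R : Set} {_+_ _*_ : R → R → R} { -_ : R → R} {0# 1# : R}
  (isCommutativeRing : IsCommutativeRing _≡_ _+_ _*_ -_ 0# 1#)
  (φ : ℤ → R)
  (φ-+ : ∀ i j → φ (i ℤ.+ j) ≡ (φ i + φ j))
  (φ-* : ∀ i j → φ (i ℤ.* j) ≡ (φ i * φ j))
  (φ-neg : ∀ i → φ (ℤ.- i) ≡ (- φ i))
  (φ-0 : φ ℤ.0ℤ ≡ 0#)
  (φ-1 : φ ℤ.1ℤ ≡ 1#)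
  where

  private
    ring : CommutativeRing _ _
    ring = record { isCommutativeRing = isCommutativeRing }
    open import Algebra.Properties.Ring (CommutativeRing.ring ring)
    open import Algebra.Properties.CommutativeSemigroup (CommutativeRing.+-commutativeSemigroup ring) using (interchange)
    open import Algebra.Properties.CommutativeSemigroup (CommutativeRing.*-commutativeSemigroup ring) using (x∙yz≈y∙xz)
    open IsCommutativeRing isCommutativeRing using
      (+-identityˡ; +-identityʳ; *-identityʳ; *-assoc; distribˡ; distribʳ; zeroˡ; zeroʳ; -‿inverseʳ)
    open ≡-Reasoning

  ⟦_⟧ : ∀ {n} → Expr n → Vec R n → R
  ⟦ var i ⟧  ρ = lookup ρ i
  ⟦ con c ⟧  ρ = φ c
  ⟦ x :+ y ⟧ ρ = ⟦ x ⟧ ρ + ⟦ y ⟧ ρ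
  ⟦ x :* y ⟧ ρ = ⟦ x ⟧ ρ * ⟦ y ⟧ ρ
  ⟦ :- x ⟧   ρ = - ⟦ x ⟧ ρ

  private
    eval : ∀ {n} → Poly n → Vec R n → R
    evalL : ∀ {n} → List (Poly n) → R → Vec R n → R
    eval {zero}  c []      = φ c
    eval {suc n} p (x ∷ ρ) = evalL p x ρ
    evalL []       x ρ = 0#
    evalL (p ∷ ps) x ρ = eval p ρ + (x * evalL ps x ρ)

    eval-constant : ∀ {n} c (ρ : Vec R n) → eval (constant c) ρ ≡ φ c
    eval-constant c []      = refl
    eval-constant c (x ∷ ρ) =
      trans (cong₂ _+_ (eval-constant c ρ) (zeroʳ x)) (+-identityʳ _)

    eval-zero : ∀ {n} (ρ : Vec R n) → eval (constant ℤ.0ℤ) ρ ≡ 0#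
    eval-zero ρ = trans (eval-constant ℤ.0ℤ ρ) φ-0

    eval-variable : ∀ {n} i (ρ : Vec R n) → eval (variable′ i) ρ ≡ lookup ρ i
    eval-variable zero (x ∷ ρ) = begin
      eval (constant ℤ.0ℤ) ρ + (x * (eval (constant ℤ.1ℤ) ρ + (x * 0#)))
        ≡⟨ cong₂ (λ a b → a + (x * (b + (x * 0#)))) (eval-zero ρ) (trans (eval-constant ℤ.1ℤ ρ) φ-1) ⟩
      0# + (x * (1# + (x * 0#)))  ≡⟨ +-identityˡ _ ⟩
      x * (1# + (x * 0#))         ≡⟨ cong (λ a → x * (1# + a)) (zeroʳ x) ⟩
      x * (1# + 0#)               ≡⟨ cong (x *_) (+-identityʳ 1#) ⟩
      x * 1#                      ≡⟨ *-identityʳ x ⟩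
      x                           ∎
    eval-variable (suc i) (x ∷ ρ) =
      trans (cong₂ _+_ (eval-variable i ρ) (zeroʳ x)) (+-identityʳ _)

    eval-add : ∀ {n} (p q : Poly n) ρ → eval (add p q) ρ ≡ (eval p ρ + eval q ρ)
    evalL-add : ∀ {n} (ps qs : List (Poly n)) x ρ → evalL (addL ps qs) x ρ ≡ (evalL ps x ρ + evalL qs x ρ)
    eval-add {zero}  p q []      = φ-+ p q
    eval-add {suc n} p q (x ∷ ρ) = evalL-add p q x ρ
    evalL-add []       qs       x ρ = sym (+-identityˡ _)
    evalL-add (p ∷ ps) []       x ρ = sym (+-identityʳ _)
    evalL-add (p ∷ ps) (q ∷ qs) x ρ =
      trans (cong₂ (λ a b → a + (x * b)) (eval-add p q ρ) (evalL-add ps qs x ρ))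
            (trans (cong₂ _+_ refl (distribˡ x _ _)) (interchange _ _ _ _))

    eval-mul : ∀ {n} (p q : Poly n) ρ → eval (mul p q) ρ ≡ (eval p ρ * eval q ρ)
    evalL-mul : ∀ {n} (ps qs : List (Poly n)) x ρ → evalL (mulL ps qs) x ρ ≡ (evalL ps x ρ * evalL qs x ρ)
    evalL-scale : ∀ {n} (p : Poly n) qs x ρ → evalL (scale p qs) x ρ ≡ (eval p ρ * evalL qs x ρ)
    eval-mul {zero}  p q []      = φ-* p q
    eval-mul {suc n} p q (x ∷ ρ) = evalL-mul p q x ρ
    evalL-mul []       qs x ρ = sym (zeroˡ _)
    evalL-mul (p ∷ ps) qs x ρ = begin
      evalL (addL (scale p qs) (constant ℤ.0ℤ ∷ mulL ps qs)) x ρ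
        ≡⟨ evalL-add (scale p qs) _ x ρ ⟩
      evalL (scale p qs) x ρ + (eval (constant ℤ.0ℤ) ρ + (x * evalL (mulL ps qs) x ρ))
        ≡⟨ cong₂ _+_ (evalL-scale p qs x ρ)
             (trans (cong₂ (λ a b → a + (x * b)) (eval-zero ρ) (evalL-mul ps qs x ρ)) (+-identityˡ _)) ⟩
      (eval p ρ * evalL qs x ρ) + (x * (evalL ps x ρ * evalL qs x ρ))
        ≡⟨ cong₂ _+_ refl (sym (*-assoc x _ _)) ⟩
      (eval p ρ * evalL qs x ρ) + ((x * evalL ps x ρ) * evalL qs x ρ)
        ≡⟨ sym (distribʳ _ _ _) ⟩
      evalL (p ∷ ps) x ρ * evalL qs x ρ ∎
    evalL-scale p []       x ρ = sym (zeroʳ _)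
    evalL-scale p (q ∷ qs) x ρ =
      trans (cong₂ (λ a b → a + (x * b)) (eval-mul p q ρ) (evalL-scale p qs x ρ))
            (trans (cong₂ _+_ refl (x∙yz≈y∙xz x _ _)) (sym (distribˡ _ _ _)))

    eval-neg : ∀ {n} (p : Poly n) ρ → eval (neg p) ρ ≡ (- eval p ρ)
    evalL-neg : ∀ {n} (ps : List (Poly n)) x ρ → evalL (negL ps) x ρ ≡ (- evalL ps x ρ)
    eval-neg {zero}  p []      = φ-neg p
    eval-neg {suc n} p (x ∷ ρ) = evalL-neg p x ρ
    evalL-neg []       x ρ = sym -0#≈0#
    evalL-neg (p ∷ ps) x ρ =
      trans (cong₂ (λ a b → a + (x * b)) (eval-neg p ρ) (evalL-neg ps x ρ))
            (trans (cong₂ _+_ refl (sym (-‿distribʳ-* x _))) (-‿+-comm _ _))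

    eval-isZero : ∀ {n} (p : Poly n) ρ → T (isZero p) → eval p ρ ≡ 0#
    evalL-isZero : ∀ {n} (ps : List (Poly n)) x ρ → T (isZeroL ps) → evalL ps x ρ ≡ 0#
    eval-isZero {zero}  (ℤ.+ zero) [] _ = φ-0
    eval-isZero {suc n} p (x ∷ ρ) z = evalL-isZero p x ρ z
    evalL-isZero []       x ρ z = refl
    evalL-isZero (p ∷ ps) x ρ z with isZero p in eq
    ... | true = trans (cong₂ (λ a b → a + (x * b)) (eval-isZero p ρ (subst T (sym eq) tt)) (evalL-isZero ps x ρ z))
                       (trans (+-identityˡ _) (zeroʳ x))

    eval-normalise : ∀ {n} (e : Expr n) ρ → eval (normalise e) ρ ≡ ⟦ e ⟧ ρ
    eval-normalise (var i)  ρ = eval-variable i ρ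
    eval-normalise (con c)  ρ = eval-constant c ρ
    eval-normalise (x :+ y) ρ =
      trans (eval-add (normalise x) _ ρ) (cong₂ _+_ (eval-normalise x ρ) (eval-normalise y ρ))
    eval-normalise (x :* y) ρ =
      trans (eval-mul (normalise x) _ ρ) (cong₂ _*_ (eval-normalise x ρ) (eval-normalise y ρ))
    eval-normalise (:- x)   ρ = trans (eval-neg (normalise x) ρ) (cong -_ (eval-normalise x ρ))

    difference-zero⇒≡ : ∀ {a b} → (a + (- b)) ≡ 0# → a ≡ b
    difference-zero⇒≡ {a} {b} eq = trans (inverseˡ-unique a (- b) eq) (⁻¹-involutive b)
      where open import Algebra.Properties.AbelianGroup (CommutativeRing.+-abelianGroup ring)

  Holds : ∀ {n} → List (Hypothesis n) → Vec R n → Set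
  Holds []                ρ = ⊤
  Holds ((c ⟨ l ≈ r ⟩) ∷ hs) ρ = ⟦ l ⟧ ρ ≡ ⟦ r ⟧ ρ × Holds hs ρ

  private
    defect-zero : ∀ {n} (hs : List (Hypothesis n)) ρ → Holds hs ρ → ⟦ defect hs ⟧ ρ ≡ 0#
    defect-zero []                ρ _        = φ-0
    defect-zero ((c ⟨ l ≈ r ⟩) ∷ hs) ρ (h , hs′) = begin
      (⟦ c ⟧ ρ * (⟦ l ⟧ ρ + (- ⟦ r ⟧ ρ))) + ⟦ defect hs ⟧ ρ
        ≡⟨ cong₂ (λ a b → (⟦ c ⟧ ρ * (a + (- ⟦ r ⟧ ρ))) + b) h (defect-zero hs ρ hs′) ⟩
      (⟦ c ⟧ ρ * (⟦ r ⟧ ρ + (- ⟦ r ⟧ ρ))) + 0#  ≡⟨ +-identityʳ _ ⟩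
      ⟦ c ⟧ ρ * (⟦ r ⟧ ρ + (- ⟦ r ⟧ ρ))         ≡⟨ cong (⟦ c ⟧ ρ *_) (-‿inverseʳ _) ⟩
      ⟦ c ⟧ ρ * 0#                              ≡⟨ zeroʳ _ ⟩
      0#                                        ∎

  variables : ∀ n → Vec (Expr n) n
  variables n = tabulate var

  -- The identity lhs - rhs = Σ c (l - r) is decided between polynomials over ℤ and transported by
  -- `φ`. The test reduces to `⊤` for a correct certificate, so its argument is filled in silently.
  linear-combination : ∀ {n} (ρ : Vec R n) (problem : Vec (Expr n) n → Problem n) →
    let open Problem (problem (variables n)) in
    {T (isZero (normalise (lhs :- rhs :- defect from)))} →
    Holds from ρ → ⟦ lhs ⟧ ρ ≡ ⟦ rhs ⟧ ρ
  linear-combination {n} ρ problem {ok} hyps =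
    difference-zero⇒≡ (trans
      (difference-zero⇒≡ (trans (sym (eval-normalise (x :- y :- defect hs) ρ))
                                (eval-isZero (normalise (x :- y :- defect hs)) ρ ok)))
      (defect-zero hs ρ hyps))
    where open Problem (problem (variables n)) renaming (lhs to x; rhs to y; from to hs)

open Solver ℤₚ.+-*-isCommutativeRing (λ i → i) (λ _ _ → refl) (λ _ _ → refl) (λ _ → refl) refl refl

-- Certificates for equations between natural numbers.

positive : ∀ {n} → Expr n → Bool
positive (var i)           = true
positive (con (ℤ.+ k))     = true
positive (con (ℤ.-[1+ k ])) = false
positive (x :+ y)          = positive x ∧ positive y
positive (x :* y)          = positive x ∧ positive y
positive (:- x)            = false

-- meaningful on positive expressions only
value : ∀ {n} → Expr n → Vec ℕ n → ℕ
value (var i)  ρ = lookup ρ i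
value (con c)  ρ = ℤ.∣ c ∣
value (x :+ y) ρ = value x ρ ℕ.+ value y ρ
value (x :* y) ρ = value x ρ ℕ.* value y ρ
value (:- x)   ρ = value x ρ

value-cast : ∀ {n} (e : Expr n) ρ → T (positive e) → ℤ.+ value e ρ ≡ ⟦ e ⟧ (map ℤ.+_ ρ)
value-cast (var i)       ρ _ = sym (lookup-map i ℤ.+_ ρ)
value-cast (con (ℤ.+ k)) ρ _ = refl
value-cast (x :+ y) ρ pos = let px , py = Equivalence.to T-∧ pos in
  trans (ℤₚ.pos-+ (value x ρ) (value y ρ)) (cong₂ ℤ._+_ (value-cast x ρ px) (value-cast y ρ py))
value-cast (x :* y) ρ pos = let px , py = Equivalence.to T-∧ pos in
  trans (ℤₚ.pos-* (value x ρ) (value y ρ)) (cong₂ ℤ._*_ (value-cast x ρ px) (value-cast y ρ py))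

all-positive : ∀ {n} → List (Hypothesis n) → Bool
all-positive []                 = true
all-positive ((c ⟨ l ≈ r ⟩) ∷ hs) = (positive l ∧ positive r) ∧ all-positive hs

Holdsℕ : ∀ {n} → List (Hypothesis n) → Vec ℕ n → Set
Holdsℕ []                 ρ = ⊤
Holdsℕ ((c ⟨ l ≈ r ⟩) ∷ hs) ρ = value l ρ ≡ value r ρ × Holdsℕ hs ρ

holds-cast : ∀ {n} (hs : List (Hypothesis n)) ρ → T (all-positive hs) → Holdsℕ hs ρ → Holds hs (map ℤ.+_ ρ)
holds-cast []                 ρ _   _        = tt
holds-cast ((c ⟨ l ≈ r ⟩) ∷ hs) ρ pos (h , hs′) =
  let plr , phs = Equivalence.to (T-∧ {positive l ∧ positive r}) pos ; pl , pr = Equivalence.to (T-∧ {positive l}) plr in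
  trans (sym (value-cast l ρ pl)) (trans (cong ℤ.+_ h) (value-cast r ρ pr)) , holds-cast hs ρ phs hs′

-- A certificate involves subtraction, so hypotheses stated in ℕ are cast to ℤ before they are
-- combined.
integer-combination : ∀ {n} (ρ : Vec ℕ n) (problem : Vec (Expr n) n → Problem n) →
  let open Problem (problem (variables n)) in
  {T (isZero (normalise (lhs :- rhs :- defect from)))} → {T (all-positive from)} →
  Holdsℕ from ρ → ⟦ lhs ⟧ (map ℤ.+_ ρ) ≡ ⟦ rhs ⟧ (map ℤ.+_ ρ)
integer-combination {n} ρ problem {ok} {pos} hyps =
  linear-combination (map ℤ.+_ ρ) problem {ok} (holds-cast (Problem.from (problem (variables n))) ρ pos hyps)

natural-combination : ∀ {n} (ρ : Vec ℕ n) (problem : Vec (Expr n) n → Problem n) →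
  let open Problem (problem (variables n)) in
  {T (isZero (normalise (lhs :- rhs :- defect from)))} → {T (all-positive from)} →
  {T (positive lhs)} → {T (positive rhs)} →
  Holdsℕ from ρ → value lhs ρ ≡ value rhs ρ
natural-combination {n} ρ problem {ok} {pos} {posˡ} {posʳ} hyps = ℤₚ.+-injective
  (trans (value-cast lhs ρ posˡ) (trans (integer-combination ρ problem {ok} {pos} hyps) (sym (value-cast rhs ρ posʳ))))
  where open Problem (problem (variables n))

-- The polynomials of the proof, to be read in ℤ, in ℚ and in the syntax of the solver.
-- Line holds the coefficients of G (x₀ + x₁ T) (y₀ + y₁ T) z in T.  Point belongs to
-- x = (a + b√d)/n: n³ (x³ - 3x - 1) = ν₀ + ν₁√d, n³ x (x + 1) = μ₀ + μ₁√d, and α, β are the norms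
-- of nx and n (x + 1).  In Pair, (x : y : z) = (t + u : tu : 1) for t = (a + b√d)/n, u = (c + e√d)/m.
module Polynomials {A : Set} (plus times : A → A → A) (negate : A → A) (κ : ℕ → A) where
  private
    infixl 6 _+_ _-_
    infixl 7 _*_
    _+_ _*_ _-_ : A → A → A
    _+_ = plus
    _*_ = times
    x - y = x + negate y

  -- `alternant` is the Vandermonde product (x - y)(y - z)(x - z). `heron` is the discriminant of x
  -- T² - (y - z - x) T + z; by Heron's formula it is -16 times the squared area of a triangle whose
  -- squared sides are x, y, z.
  e₁ e₂ e₃ alternant heron : A → A → A → A
  e₁ x y z = x + y + z
  e₂ x y z = x * y + y * z + z * x
  e₃ x y z = x * y * z
  alternant x y z = (y - z) * (y * z) + (z - x) * (z * x) + (x - y) * (x * y)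
  heron x y z = e₁ x y z * e₁ x y z - κ 4 * e₂ x y z

  G : A → A → A → A
  G x y z = x * y * y + (x * x - x * z - κ 2 * z * z) * y - x * x * z - x * z * z

  module Line (x₀ x₁ y₀ y₁ z : A) where
    c₀ c₁ c₂ c₃ : A
    c₀ = G x₀ y₀ z
    c₁ = κ 2 * x₀ * y₀ * y₁ + x₁ * y₀ * y₀ + x₀ * x₀ * y₁ + κ 2 * x₀ * x₁ * y₀
       - (x₀ * y₁ + x₁ * y₀) * z - κ 2 * z * z * y₁ - κ 2 * x₀ * x₁ * z - x₁ * z * z
    c₂ = x₀ * y₁ * y₁ + κ 2 * x₁ * y₀ * y₁ + κ 2 * x₀ * x₁ * y₁ + x₁ * x₁ * y₀
       - x₁ * y₁ * z - x₁ * x₁ * z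
    c₃ = x₁ * y₁ * (x₁ + y₁)

  module Point (a b n d : A) where
    ν₀ ν₁ μ₀ μ₁ : A
    ν₀ = a * a * a + κ 3 * a * b * b * d - κ 3 * n * n * a - n * n * n
    ν₁ = κ 3 * a * a * b + b * b * b * d - κ 3 * n * n * b
    μ₀ = n * (a * a + d * b * b + n * a)
    μ₁ = n * (κ 2 * a * b + n * b)
    α β : A
    α = a * a - d * b * b
    β = (a + n) * (a + n) - d * b * b

  module Pair (a b n c e m d : A) where
    x₀ x₁ y₀ y₁ z G₀ G₁ : A
    x₀ = a * m + c * n
    x₁ = b * m + e * n
    y₀ = a * c + b * e * d
    y₁ = a * e + b * c
    z  = n * m
    G₀ = Line.c₀ x₀ x₁ y₀ y₁ z + d * Line.c₂ x₀ x₁ y₀ y₁ z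
    G₁ = Line.c₁ x₀ x₁ y₀ y₁ z + d * Line.c₃ x₀ x₁ y₀ y₁ z

-- Descent on the elliptic curve, in natural numbers.

module Naturals where

  open import Data.Nat using (_+_; _*_; _∸_; _≤_; _<_; z≤n; s≤s; ≢-nonZero)
  open import Data.Nat.Properties
  open import Data.Nat.Divisibility
  open import Data.Nat.GCD using (gcd; gcd[m,n]∣m; gcd[m,n]∣n; gcd-greatest; gcd[m,n]≢0)
  open import Data.Nat.Coprimality as Coprimality using (Coprime; coprime-divisor)
  open import Data.Nat.Primality using (Prime; prime?; euclidsLemma)

  infix 9 _⁴
  _⁴ : ℕ → ℕ
  n ⁴ = n * n * (n * n)

  fourth : ∀ {n} → Expr n → Expr n
  fourth x = x :* x :* (x :* x)

  -- The form of all congruence obstructions below: a certificate combines the hypotheses into m z =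
  -- r, and the quotient z is usually left to unification.
  multiple≢ : ∀ m {r} z → ¬ m ∣ r → ℤ.+ m ℤ.* z ≢ ℤ.+ r
  multiple≢ m z m∤r eq = m∤r (divides ℤ.∣ z ∣ (trans (cong ℤ.∣_∣ (sym eq)) (trans (ℤₚ.abs-* (ℤ.+ m) z) (*-comm m ℤ.∣ z ∣))))

  data Parity (n : ℕ) : Set where
    even : ∀ k → n ≡ 2 * k → Parity n
    odd  : ∀ k → n ≡ 2 * k + 1 → Parity n

  parity : ∀ n → Parity n
  parity zero = even 0 refl
  parity (suc n) with parity n
  ... | even k refl = odd k (+-comm 1 (2 * k))
  ... | odd k refl  = even (suc k) (natural-combination (k ∷ []) (λ { (k ∷ []) → # 1 :+ (# 2 :* k :+ # 1) ≈ # 2 :* (# 1 :+ k) ⇐ [] }) tt)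

  Odd : ℕ → Set
  Odd n = ∃ λ k → n ≡ 2 * k + 1

  odd≢even : ∀ k m → 2 * k + 1 ≢ 2 * m
  odd≢even k m eq = multiple≢ 2 (ℤ.+ m ℤ.- ℤ.+ k) (from-no (2 ∣? 1)) (integer-combination (k ∷ m ∷ [])
    (λ { (k ∷ m ∷ []) → # 2 :* (m :- k) ≈ # 1 ⇐ ((:- # 1) ⟨ # 2 :* k :+ # 1 ≈ # 2 :* m ⟩) ∷ [] }) (eq , tt))

  odd⇒2∤ : ∀ {n} → Odd n → ¬ 2 ∣ n
  odd⇒2∤ (k , refl) (divides m eq) = odd≢even k m (trans eq (*-comm m 2))

  2∤⇒odd : ∀ {n} → ¬ 2 ∣ n → Odd n
  2∤⇒odd {n} 2∤n with parity n
  ... | even k refl = contradiction (m∣m*n k) 2∤n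
  ... | odd k eq    = k , eq

  odd-factorˡ : ∀ {m n} → Odd (m * n) → Odd m
  odd-factorˡ {m} {n} o = 2∤⇒odd (odd⇒2∤ o ∘ ∣m⇒∣m*n n)

  odd-factorʳ : ∀ {m n} → Odd (m * n) → Odd n
  odd-factorʳ {m} {n} o = 2∤⇒odd (odd⇒2∤ o ∘ ∣n⇒∣m*n m)

  odd-divisor : ∀ {m n} → m ∣ n → Odd n → Odd m
  odd-divisor m∣n o = 2∤⇒odd (λ 2∣m → odd⇒2∤ o (∣-trans 2∣m m∣n))

  odd-square : ∀ {n} → Odd n → ∃ λ k → n * n ≡ 8 * k + 1
  odd-square (k , refl) with parity k
  ... | even j refl = 2 * j * j + j , natural-combination (j ∷ []) (λ { (j ∷ []) → let n = # 2 :* (# 2 :* j) :+ # 1 in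
    n :* n ≈ # 8 :* (# 2 :* j :* j :+ j) :+ # 1 ⇐ [] }) tt
  ... | odd j refl = 2 * j * j + 3 * j + 1 , natural-combination (j ∷ []) (λ { (j ∷ []) → let n = # 2 :* (# 2 :* j :+ # 1) :+ # 1 in
    n :* n ≈ # 8 :* (# 2 :* j :* j :+ # 3 :* j :+ # 1) :+ # 1 ⇐ [] }) tt

  square-mod-4 : ∀ n → ∃ λ k → n * n ≡ 4 * k ⊎ n * n ≡ 4 * k + 1
  square-mod-4 n with parity n
  ... | even k refl = k * k , inj₁ (natural-combination (k ∷ []) (λ { (k ∷ []) → # 2 :* k :* (# 2 :* k) ≈ # 4 :* (k :* k) ⇐ [] }) tt)
  ... | odd k refl  = k * k + k , inj₂ (natural-combination (k ∷ []) (λ { (k ∷ []) →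
    let n = # 2 :* k :+ # 1 in n :* n ≈ # 4 :* (k :* k :+ k) :+ # 1 ⇐ [] }) tt)

  -- Coprime factors of squares and fourth powers.

  ∣-summandˡ : ∀ {d} m {n s} → m + n ≡ s → d ∣ s → d ∣ n → d ∣ m
  ∣-summandˡ {d} m {n} eq d∣s d∣n = ∣m+n∣m⇒∣n (subst (d ∣_) (trans (sym eq) (+-comm m n)) d∣s) d∣n

  coprime-*ʳ : ∀ {a b c} → Coprime a b → Coprime a c → Coprime a (b * c)
  coprime-*ʳ {a} {b} {c} ab ac (i∣a , i∣bc) = ac (i∣a , coprime-divisor (λ (j∣i , j∣b) → ab (∣-trans j∣i i∣a , j∣b)) i∣bc)

  coprime-∣ˡ : ∀ {a b c} → a ∣ b → Coprime b c → Coprime a c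
  coprime-∣ˡ a∣b bc (i∣a , i∣c) = bc (∣-trans i∣a a∣b , i∣c)

  coprime-⁴ : ∀ {a b} → Coprime a b → Coprime a (b ⁴)
  coprime-⁴ ab = coprime-*ʳ (coprime-*ʳ ab ab) (coprime-*ʳ ab ab)

  odd⇒coprime-2 : ∀ {n} → Odd n → Coprime n 2
  odd⇒coprime-2 {n} o {zero} (_ , 0∣2) = contradiction (0∣⇒≡0 0∣2) λ ()
  odd⇒coprime-2 {n} o {1} _ = refl
  odd⇒coprime-2 {n} o {2} (2∣n , _) = contradiction 2∣n (odd⇒2∤ o)
  odd⇒coprime-2 {n} o {suc (suc (suc i))} (_ , i∣2) = contradiction (∣⇒≤ i∣2) λ { (s≤s (s≤s ())) }

  ∣-coprime⇒≡1 : ∀ {c n} → Coprime c n → c ∣ n → c ≡ 1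
  ∣-coprime⇒≡1 cn c∣n = cn (∣-refl , c∣n)

  reduce : ∀ m n → m ≢ 0 → ∃ λ g → ∃₂ λ m′ n′ → g ≢ 0 × m ≡ m′ * g × n ≡ n′ * g × Coprime m′ n′
  reduce m n m≢0 with gcd[m,n]∣m m n | gcd[m,n]∣n m n
  ... | divides m′ m≡ | divides n′ n≡ = gcd m n , m′ , n′ , g≢0 , m≡ , n≡ , coprime
    where
    g≢0 : gcd m n ≢ 0
    g≢0 = gcd[m,n]≢0 m n (inj₁ m≢0)
    instance _ = ≢-nonZero g≢0
    coprime : Coprime m′ n′
    coprime {i} (i∣m′ , i∣n′) = ∣1⇒≡1 (*-cancelʳ-∣ (gcd m n) (subst (i * gcd m n ∣_) (sym (*-identityˡ _))
      (gcd-greatest (subst (i * gcd m n ∣_) (sym m≡) (*-monoˡ-∣ (gcd m n) i∣m′))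
                    (subst (i * gcd m n ∣_) (sym n≡) (*-monoˡ-∣ (gcd m n) i∣n′)))))

  -- In lowest terms m′² ∣ n′² with m′ and n′ coprime, which forces m′ = 1.
  square-∣⇒∣ : ∀ {m n} → m ≢ 0 → m * m ∣ n * n → m ∣ n
  square-∣⇒∣ {m} {n} m≢0 mm∣nn with reduce m n m≢0
  ... | g , m′ , n′ , g≢0 , refl , refl , m′n′ = subst (λ k → k * g ∣ n′ * g) (sym m′≡1) (∣n⇒∣m*n n′ (subst (_∣ g) (sym (*-identityˡ g)) ∣-refl))
    where
    instance
      _ = ≢-nonZero g≢0
      _ = m*n≢0 g g
    m′m′∣n′n′ : m′ * m′ ∣ n′ * n′
    m′m′∣n′n′ = *-cancelʳ-∣ (g * g) (subst₂ _∣_ (regroup m′) (regroup n′) mm∣nn)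
      where
      regroup : ∀ k → k * g * (k * g) ≡ k * k * (g * g)
      regroup k = [m*n]*[o*p]≡[m*o]*[n*p] k g k g
    m′≡1 : m′ ≡ 1
    m′≡1 = ∣-coprime⇒≡1 (coprime-*ʳ m′n′ m′n′) (∣-trans (m∣m*n m′) m′m′∣n′n′)

  -- The root of f is a = gcd(f, e). With f = f′ a and e = e′ a the equation becomes f′ g = e′² a:
  -- here f′ ∣ a because f′ is coprime to e′, and a ∣ f′ because a, a divisor of f, is coprime to g.
  coprime-squares : ∀ {f g} e → f ≢ 0 → Coprime f g → f * g ≡ e * e → ∃₂ λ a b → e ≡ a * b × f ≡ a * a × g ≡ b * b
  coprime-squares {f} {g} e f≢0 fg eq with reduce f e f≢0
  ... | a , f′ , e′ , a≢0 , refl , refl , f′e′ = a , e′ , *-comm e′ a , cong (_* a) f′≡a ,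
        *-cancelˡ-≡ g (e′ * e′) a (trans (cong (_* g) (sym f′≡a)) (trans cancelled (*-comm (e′ * e′) a)))
    where
    instance _ = ≢-nonZero a≢0
    cancelled : f′ * g ≡ e′ * e′ * a
    cancelled = *-cancelʳ-≡ _ _ a (natural-combination (a ∷ f′ ∷ e′ ∷ g ∷ [])
      (λ { (a ∷ f′ ∷ e′ ∷ g ∷ []) → f′ :* g :* a ≈ e′ :* e′ :* a :* a ⇐
        (# 1 ⟨ f′ :* a :* g ≈ e′ :* a :* (e′ :* a) ⟩) ∷ [] }) (eq , tt))
    f′∣a : f′ ∣ a
    f′∣a = coprime-divisor (coprime-*ʳ f′e′ f′e′) (subst (f′ ∣_) cancelled (m∣m*n g))
    a∣f′ : a ∣ f′
    a∣f′ = coprime-divisor (coprime-∣ˡ (n∣m*n f′) fg) (subst (a ∣_) (trans (sym cancelled) (*-comm f′ g)) (n∣m*n (e′ * e′)))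
    f′≡a : f′ ≡ a
    f′≡a = ∣-antisym f′∣a a∣f′

  square≢0 : ∀ {a f} → f ≢ 0 → f ≡ a * a → a ≢ 0
  square≢0 f≢0 refl refl = f≢0 refl

  coprime-roots : ∀ {a b} → Coprime (a * a) (b * b) → Coprime a b
  coprime-roots {a} {b} ab (i∣a , i∣b) = ab (∣m⇒∣m*n a i∣a , ∣m⇒∣m*n b i∣b)

  coprime-fourth-powers : ∀ {f g} e → f ≢ 0 → Coprime f g → f * g ≡ e ⁴ →
    ∃₂ λ a b → e ≡ a * b × f ≡ a ⁴ × g ≡ b ⁴ × Coprime a b
  coprime-fourth-powers e f≢0 fg eq with coprime-squares (e * e) f≢0 fg eq
  ... | A , B , ee≡AB , refl , refl with coprime-squares {A} {B} e (square≢0 {A} f≢0 refl) (coprime-roots fg) (sym ee≡AB)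
  ...   | a , b , e≡ab , refl , refl = a , b , e≡ab , refl , refl , coprime-roots (coprime-roots fg)

  Factorisation : ℕ → ℕ → ℕ → ℕ → Set
  Factorisation k e f g = ∃₂ λ a b → e ≡ a * b × Coprime a b × (f ≡ k * a ⁴ × g ≡ b ⁴ ⊎ f ≡ b ⁴ × g ≡ k * a ⁴)

  -- A common divisor c of f and g has c² ∣ k e⁴; it is coprime to e, so c² ∣ k and c = 1. Once k
  -- divides one of the coprime factors, removing it leaves coprime numbers with product e⁴.
  factorise : ∀ k e {f g} → k ≢ 0 → e ≢ 0 → f * g ≡ k * e ⁴ →
    (∀ {c} → c ∣ f → c ∣ g → Coprime c e) →
    (∀ {c} → c ∣ f → c ∣ g → c * c ∣ k → c ≡ 1) →
    (Coprime f g → k ∣ f ⊎ k ∣ g) →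
    Factorisation k e f g
  factorise k e {f} {g} k≢0 e≢0 eq common∤e common∤k one-side = [ left , right ]′ (one-side fg)
    where
    instance _ = ≢-nonZero k≢0
    ke⁴≢0 : k * e ⁴ ≢ 0
    ke⁴≢0 h with m*n≡0⇒m≡0∨n≡0 k h
    ... | inj₁ k≡0 = k≢0 k≡0
    ... | inj₂ e⁴≡0 with m*n≡0⇒m≡0∨n≡0 (e * e) e⁴≡0
    ...   | inj₁ ee≡0 = e≢0 ([ id , id ]′ (m*n≡0⇒m≡0∨n≡0 e ee≡0))
    ...   | inj₂ ee≡0 = e≢0 ([ id , id ]′ (m*n≡0⇒m≡0∨n≡0 e ee≡0))
    fg : Coprime f g
    fg {c} (c∣f , c∣g) = common∤k c∣f c∣g (coprime-divisor cc-e⁴ (subst (c * c ∣_) (trans eq (*-comm k (e ⁴))) (*-pres-∣ c∣f c∣g)))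
      where
      c-e⁴ : Coprime c (e ⁴)
      c-e⁴ = coprime-⁴ (common∤e c∣f c∣g)
      cc-e⁴ : Coprime (c * c) (e ⁴)
      cc-e⁴ = Coprimality.sym (coprime-*ʳ (Coprimality.sym c-e⁴) (Coprimality.sym c-e⁴))
    cancelled : ∀ f′ g → f′ * k * g ≡ k * e ⁴ → f′ * g ≡ e ⁴
    cancelled f′ g h = *-cancelˡ-≡ (f′ * g) (e ⁴) k (trans (trans (sym (*-assoc k f′ g)) (cong (_* g) (*-comm k f′))) h)
    left : k ∣ f → Factorisation k e f g
    left (divides f′ f≡) with coprime-fourth-powers e
      (λ f′≡0 → ke⁴≢0 (trans (sym eq) (cong (_* g) (trans f≡ (cong (_* k) f′≡0)))))
      (coprime-∣ˡ (subst (f′ ∣_) (sym f≡) (m∣m*n k)) fg)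
      (cancelled f′ g (trans (cong (_* g) (sym f≡)) eq))
    ... | a , b , e≡ , f′≡ , g≡ , ab = a , b , e≡ , ab , inj₁ (trans f≡ (trans (*-comm f′ k) (cong (k *_) f′≡)) , g≡)
    right : k ∣ g → Factorisation k e f g
    right (divides g′ g≡) with coprime-fourth-powers e
      (λ g′≡0 → ke⁴≢0 (trans (sym eq) (trans (*-comm f g) (cong (_* f) (trans g≡ (cong (_* k) g′≡0))))))
      (coprime-∣ˡ (subst (g′ ∣_) (sym g≡) (m∣m*n k)) (Coprimality.sym fg))
      (cancelled g′ f (trans (cong (_* f) (sym g≡)) (trans (*-comm g f) eq)))
    ... | a , b , e≡ , g′≡ , f≡ , ab = a , b , e≡ , ab , inj₂ (f≡ , trans g≡ (trans (*-comm g′ k) (cong (k *_) g′≡)))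

  -- Descent steps between the quartic coverings.

  square-difference : ∀ {n t k} → n * n ≡ t * t + k → ∃ λ j → n ≡ t + j × j * (j + 2 * t) ≡ k
  square-difference {n} {t} {k} eq = n ∸ t , sym n≡ , product (n ∸ t) (sym n≡)
    where
    n≡ : t + (n ∸ t) ≡ n
    n≡ = m+[n∸m]≡n {t} (≮⇒≥ {n} {t} λ n<t → <⇒≱ (*-mono-< n<t n<t) (subst (t * t ≤_) (sym eq) (m≤m+n (t * t) k)))
    product : ∀ j → n ≡ t + j → j * (j + 2 * t) ≡ k
    product j refl = natural-combination (t ∷ j ∷ k ∷ [])
      (λ { (t ∷ j ∷ k ∷ []) → j :* (j :+ # 2 :* t) ≈ k ⇐ (# 1 ⟨ (t :+ j) :* (t :+ j) ≈ t :* t :+ k ⟩) ∷ [] }) (eq , tt)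

  -- The difference j = n - t is even, since j (j + 2 t) is odd for odd j.
  square-difference-4 : ∀ {n t k} → n * n ≡ t * t + 4 * k → ∃ λ f → n ≡ t + 2 * f × f * (f + t) ≡ k
  square-difference-4 {n} {t} {k} eq with square-difference {n} {t} eq
  ... | j , n≡ , h with parity j
  ...   | even f refl = f , n≡ , *-cancelˡ-≡ _ _ 4 (natural-combination (t ∷ f ∷ k ∷ [])
    (λ { (t ∷ f ∷ k ∷ []) → # 4 :* (f :* (f :+ t)) ≈ # 4 :* k ⇐ (# 1 ⟨ # 2 :* f :* (# 2 :* f :+ # 2 :* t) ≈ # 4 :* k ⟩) ∷ [] }) (h , tt))
  ...   | odd f refl = ⊥-elim (odd≢even (2 * f * f + 2 * f + (2 * f + 1) * t) (2 * k) (natural-combination (t ∷ f ∷ k ∷ [])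
    (λ { (t ∷ f ∷ k ∷ []) → # 2 :* (# 2 :* f :* f :+ # 2 :* f :+ (# 2 :* f :+ # 1) :* t) :+ # 1 ≈ # 2 :* (# 2 :* k) ⇐
      (# 1 ⟨ (# 2 :* f :+ # 1) :* (# 2 :* f :+ # 1 :+ # 2 :* t) ≈ # 4 :* k ⟩) ∷ [] }) (h , tt)))

  -- Coverings of the elliptic curve and of an isogenous one: a solution of one of these
  -- quartics yields a solution of another, with e replaced by a factor of e.
  Quartic Quartic₄ Quartic₃₂ : ℕ → ℕ → ℕ → Set
  Quartic   m e n = n * n + 7 * e ⁴ ≡ m ⁴ + 22 * (m * m * (e * e))
  Quartic₄  m e n = n * n + 11 * (m * m * (e * e)) ≡ 4 * m ⁴ + 8 * e ⁴
  Quartic₃₂ m e n = n * n + 11 * (m * m * (e * e)) ≡ m ⁴ + 32 * e ⁴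

  Descended : ℕ → ℕ → Set
  Descended e n = ∃₂ λ a b → e ≡ a * b × Coprime a b × Quartic a b n

  square-∣⇒≡1 : ∀ {c k} → k ≢ 0 → ¬ 4 ∣ k → ¬ 9 ∣ k → k < 16 → c * c ∣ k → c ≡ 1
  square-∣⇒≡1 {0} k≢0 _ _ _ cc∣k = contradiction (0∣⇒≡0 cc∣k) k≢0
  square-∣⇒≡1 {1} _ _ _ _ _ = refl
  square-∣⇒≡1 {2} _ 4∤k _ _ cc∣k = contradiction cc∣k 4∤k
  square-∣⇒≡1 {3} _ _ 9∤k _ cc∣k = contradiction cc∣k 9∤k
  square-∣⇒≡1 {suc (suc (suc (suc c)))} k≢0 _ _ k<16 cc∣k =
    contradiction (≤-trans (*-mono-≤ (m≤m+n 4 c) (m≤m+n 4 c)) (∣⇒≤ cc∣k)) (<⇒≱ k<16)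
    where instance _ = ≢-nonZero k≢0

  prime-one-side : ∀ {k e f g} → Prime k → f * g ≡ k * e → k ∣ f ⊎ k ∣ g
  prime-one-side {k} {e} {f} {g} p eq = euclidsLemma f g p (subst (k ∣_) (sym eq) (m∣m*n e))

  7-prime : Prime 7
  7-prime = from-yes (prime? 7)

  2-prime : Prime 2
  2-prime = from-yes (prime? 2)

  -- Odd squares are 1 modulo 8, and 22 + 7 - 1 = 28 is 4 modulo 8.
  quartic-16-impossible : ∀ {m a b} → Odd a → Odd b → 22 * (a * a * (b * b)) + 7 * b ⁴ ≢ 16 * (m * m) + a ⁴
  quartic-16-impossible {m} {a} {b} oa ob eq with odd-square oa | odd-square ob
  ... | i , hi | j , hj = multiple≢ 8 _ (from-no (8 ∣? 4)) (integer-combination (m ∷ a ∷ b ∷ i ∷ j ∷ [])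
    (λ { (m ∷ a ∷ b ∷ i ∷ j ∷ []) → let A = # 8 :* i :+ # 1 ; B = # 8 :* j :+ # 1 in
      # 8 :* (# 2 :* (m :* m) :+ (# 8 :* i :* i :+ # 2 :* i) :- # 7 :* (# 8 :* j :* j :+ # 2 :* j) :- # 22 :* (# 8 :* i :* j :+ i :+ j) :- # 3) ≈ # 4 ⇐
      ((:- # 1) ⟨ # 22 :* (a :* a :* (b :* b)) :+ # 7 :* fourth b ≈ # 16 :* (m :* m) :+ fourth a ⟩) ∷
      ((# 22 :* (b :* b) :- (a :* a :+ A)) ⟨ a :* a ≈ A ⟩) ∷
      ((# 22 :* A :+ # 7 :* (b :* b :+ B)) ⟨ b :* b ≈ B ⟩) ∷ [] }) (eq , hi , hj , tt))

  -- Modulo 4 the difference of the sides is 3 if a and b have the same parity, and 2 otherwise.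
  quartic-odd-impossible : ∀ {m a b} → Odd m → 22 * (a * a * (b * b)) + 7 * b ⁴ ≢ m * m + a ⁴
  quartic-odd-impossible {m} {a} {b} om eq with odd-square om | square-mod-4 a | square-mod-4 b
  ... | h , hm | i , inj₁ hi | j , inj₁ hj = multiple≢ 4 _ (from-no (4 ∣? 1)) (integer-combination (m ∷ a ∷ b ∷ h ∷ i ∷ j ∷ [])
    (λ { (m ∷ a ∷ b ∷ h ∷ i ∷ j ∷ []) → let M = # 8 :* h :+ # 1 ; A = # 4 :* i ; B = # 4 :* j in
      # 4 :* (# 88 :* i :* j :+ # 28 :* j :* j :- # 2 :* h :- # 4 :* i :* i) ≈ # 1 ⇐
      (# 1 ⟨ # 22 :* (a :* a :* (b :* b)) :+ # 7 :* fourth b ≈ m :* m :+ fourth a ⟩) ∷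
      ((# 1) ⟨ m :* m ≈ M ⟩) ∷
      ((:- (# 22 :* (b :* b) :- (a :* a :+ A))) ⟨ a :* a ≈ A ⟩) ∷
      ((:- (# 22 :* A :+ # 7 :* (b :* b :+ B))) ⟨ b :* b ≈ B ⟩) ∷ [] }) (eq , hm , hi , hj , tt))
  ... | h , hm | i , inj₁ hi | j , inj₂ hj = multiple≢ 4 _ (from-no (4 ∣? 2)) (integer-combination (m ∷ a ∷ b ∷ h ∷ i ∷ j ∷ [])
    (λ { (m ∷ a ∷ b ∷ h ∷ i ∷ j ∷ []) → let M = # 8 :* h :+ # 1 ; A = # 4 :* i ; B = # 4 :* j :+ # 1 in
      # 4 :* (# 2 :* h :+ # 4 :* i :* i :- # 22 :* i :* B :- # 28 :* j :* j :- # 14 :* j :- # 1) ≈ # 2 ⇐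
      ((:- # 1) ⟨ # 22 :* (a :* a :* (b :* b)) :+ # 7 :* fourth b ≈ m :* m :+ fourth a ⟩) ∷
      ((:- # 1) ⟨ m :* m ≈ M ⟩) ∷
      ((# 22 :* (b :* b) :- (a :* a :+ A)) ⟨ a :* a ≈ A ⟩) ∷
      ((# 22 :* A :+ # 7 :* (b :* b :+ B)) ⟨ b :* b ≈ B ⟩) ∷ [] }) (eq , hm , hi , hj , tt))
  ... | h , hm | i , inj₂ hi | j , inj₁ hj = multiple≢ 4 _ (from-no (4 ∣? 2)) (integer-combination (m ∷ a ∷ b ∷ h ∷ i ∷ j ∷ [])
    (λ { (m ∷ a ∷ b ∷ h ∷ i ∷ j ∷ []) → let M = # 8 :* h :+ # 1 ; A = # 4 :* i :+ # 1 ; B = # 4 :* j in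
      # 4 :* (# 22 :* A :* j :+ # 28 :* j :* j :- # 2 :* h :- # 4 :* i :* i :- # 2 :* i) ≈ # 2 ⇐
      (# 1 ⟨ # 22 :* (a :* a :* (b :* b)) :+ # 7 :* fourth b ≈ m :* m :+ fourth a ⟩) ∷
      ((# 1) ⟨ m :* m ≈ M ⟩) ∷
      ((:- (# 22 :* (b :* b) :- (a :* a :+ A))) ⟨ a :* a ≈ A ⟩) ∷
      ((:- (# 22 :* A :+ # 7 :* (b :* b :+ B))) ⟨ b :* b ≈ B ⟩) ∷ [] }) (eq , hm , hi , hj , tt))
  ... | h , hm | i , inj₂ hi | j , inj₂ hj = multiple≢ 4 _ (from-no (4 ∣? 1)) (integer-combination (m ∷ a ∷ b ∷ h ∷ i ∷ j ∷ [])
    (λ { (m ∷ a ∷ b ∷ h ∷ i ∷ j ∷ []) → let M = # 8 :* h :+ # 1 ; A = # 4 :* i :+ # 1 ; B = # 4 :* j :+ # 1 in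
      # 4 :* (# 22 :* (# 4 :* i :* j :+ i :+ j) :+ # 28 :* j :* j :+ # 14 :* j :+ # 7 :- # 2 :* h :- # 4 :* i :* i :- # 2 :* i) ≈ # 1 ⇐
      (# 1 ⟨ # 22 :* (a :* a :* (b :* b)) :+ # 7 :* fourth b ≈ m :* m :+ fourth a ⟩) ∷
      ((# 1) ⟨ m :* m ≈ M ⟩) ∷
      ((:- (# 22 :* (b :* b) :- (a :* a :+ A))) ⟨ a :* a ≈ A ⟩) ∷
      ((:- (# 22 :* A :+ # 7 :* (b :* b :+ B))) ⟨ b :* b ≈ B ⟩) ∷ [] }) (eq , hm , hi , hj , tt))

  -- The signs of 8 m² - 11 e² and of m² - 22 e² are unknown, so the descent in ℕ carries an
  -- absolute value and both cases.
  distance : ∀ m n → ∃ λ t → m ≡ n + t ⊎ n ≡ m + t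
  distance m n = [ (λ n≤m → m ∸ n , inj₁ (sym (m+[n∸m]≡n n≤m))) , (λ m≤n → n ∸ m , inj₂ (sym (m+[n∸m]≡n m≤n))) ]′ (≤-total n m)

  ∣-term : ∀ {d m n t} → m ≡ n + t ⊎ n ≡ m + t → d ∣ n → d ∣ t → d ∣ m
  ∣-term (inj₁ refl) d∣n d∣t = ∣m∣n⇒∣m+n d∣n d∣t
  ∣-term {m = m} (inj₂ eq) d∣n d∣t = ∣-summandˡ m (sym eq) d∣n d∣t

  ∣-step : ∀ {c f t} → c ∣ f → c ∣ f + t → c ∣ t
  ∣-step c∣f c∣f+t = ∣m+n∣m⇒∣n c∣f+t c∣f

  -- The factors f and f + y are 7 a⁴ and b⁴ in some order, with e = a b. As y = |s² - 22 e²|, this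
  -- makes s² - 22 e² equal to b⁴ - 7 a⁴, which is `Quartic b a s`, or to its negative, which
  -- `impossible` excludes.
  split-by-7 : ∀ {s e y f} → e ≢ 0 → Coprime e (s * s) → s * s ≡ 22 * (e * e) + y ⊎ 22 * (e * e) ≡ s * s + y →
    f * (f + y) ≡ 7 * e ⁴ → (∀ a b → e ≡ a * b → 22 * (a * a * (b * b)) + 7 * b ⁴ ≢ s * s + a ⁴) → Descended e s
  split-by-7 {s} {e} {y} {f} e≢0 es signs fg impossible =
    conclude signs (factorise 7 e (λ ()) e≢0 fg common common² (λ _ → prime-one-side {7} {e ⁴} 7-prime fg))
    where
    g = f + y
    common : ∀ {c} → c ∣ f → c ∣ g → Coprime c e
    common c∣f c∣g (i∣c , i∣e) =
      es (i∣e , ∣-term signs (∣n⇒∣m*n 22 (∣m⇒∣m*n e i∣e)) (∣-trans i∣c (∣-step c∣f c∣g)))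
    common² : ∀ {c} → c ∣ f → c ∣ g → c * c ∣ 7 → c ≡ 1
    common² _ _ = square-∣⇒≡1 (λ ()) (from-no (4 ∣? 7)) (from-no (9 ∣? 7)) (m≤m+n 8 8)
    conclude : s * s ≡ 22 * (e * e) + y ⊎ 22 * (e * e) ≡ s * s + y → Factorisation 7 e f g → Descended e s
    conclude (inj₁ h) (a , b , refl , ab , inj₁ (f≡ , g≡)) = b , a , *-comm a b , Coprimality.sym ab ,
      natural-combination (s ∷ a ∷ b ∷ y ∷ f ∷ [])
      (λ { (s ∷ a ∷ b ∷ y ∷ f ∷ []) → s :* s :+ # 7 :* fourth a ≈ fourth b :+ # 22 :* (b :* b :* (a :* a)) ⇐
        (# 1 ⟨ s :* s ≈ # 22 :* (a :* b :* (a :* b)) :+ y ⟩) ∷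
        ((:- # 1) ⟨ f ≈ # 7 :* fourth a ⟩) ∷ (# 1 ⟨ f :+ y ≈ fourth b ⟩) ∷ [] }) (h , f≡ , g≡ , tt)
    conclude (inj₂ h) (a , b , refl , ab , inj₁ (f≡ , g≡)) = ⊥-elim (impossible b a (*-comm a b)
      (natural-combination (s ∷ a ∷ b ∷ y ∷ f ∷ [])
      (λ { (s ∷ a ∷ b ∷ y ∷ f ∷ []) → # 22 :* (b :* b :* (a :* a)) :+ # 7 :* fourth a ≈ s :* s :+ fourth b ⇐
        (# 1 ⟨ # 22 :* (a :* b :* (a :* b)) ≈ s :* s :+ y ⟩) ∷
        ((:- # 1) ⟨ f ≈ # 7 :* fourth a ⟩) ∷ (# 1 ⟨ f :+ y ≈ fourth b ⟩) ∷ [] }) (h , f≡ , g≡ , tt)))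
    conclude (inj₁ h) (a , b , refl , ab , inj₂ (f≡ , g≡)) = ⊥-elim (impossible b a (*-comm a b)
      (natural-combination (s ∷ a ∷ b ∷ y ∷ f ∷ [])
      (λ { (s ∷ a ∷ b ∷ y ∷ f ∷ []) → # 22 :* (b :* b :* (a :* a)) :+ # 7 :* fourth a ≈ s :* s :+ fourth b ⇐
        ((:- # 1) ⟨ s :* s ≈ # 22 :* (a :* b :* (a :* b)) :+ y ⟩) ∷
        (# 1 ⟨ f ≈ fourth b ⟩) ∷ ((:- # 1) ⟨ f :+ y ≈ # 7 :* fourth a ⟩) ∷ [] }) (h , f≡ , g≡ , tt)))
    conclude (inj₂ h) (a , b , refl , ab , inj₂ (f≡ , g≡)) = b , a , *-comm a b , Coprimality.sym ab ,
      natural-combination (s ∷ a ∷ b ∷ y ∷ f ∷ [])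
      (λ { (s ∷ a ∷ b ∷ y ∷ f ∷ []) → s :* s :+ # 7 :* fourth a ≈ fourth b :+ # 22 :* (b :* b :* (a :* a)) ⇐
        ((:- # 1) ⟨ # 22 :* (a :* b :* (a :* b)) ≈ s :* s :+ y ⟩) ∷
        (# 1 ⟨ f ≈ fourth b ⟩) ∷ ((:- # 1) ⟨ f :+ y ≈ # 7 :* fourth a ⟩) ∷ [] }) (h , f≡ , g≡ , tt)

  odd⇒≢0 : ∀ {n} → Odd n → n ≢ 0
  odd⇒≢0 o refl = odd⇒2∤ o (divides 0 refl)

  -- Completing the square gives (4 n)² = (8 m² - 11 e²)² + 7 e⁴. With x = |8 m² - 11 e²| the
  -- factors of 7 e⁴ are 4 n - x and 4 n + x, and their difference 2 x is |(4 m)² - 22 e²|.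
  descend₄ : ∀ {m e n} → Odd m → Odd e → Coprime m e → Quartic₄ m e n → Descended e (4 * m)
  descend₄ {m} {e} {n} om oe me q with distance (8 * (m * m)) (11 * (e * e))
  ... | x , signs with square-difference {4 * n} {x} (16n² signs)
    where
    16n² : 8 * (m * m) ≡ 11 * (e * e) + x ⊎ 11 * (e * e) ≡ 8 * (m * m) + x → 4 * n * (4 * n) ≡ x * x + 7 * e ⁴
    16n² (inj₁ h) = natural-combination (m ∷ e ∷ n ∷ x ∷ [])
      (λ { (m ∷ e ∷ n ∷ x ∷ []) → # 4 :* n :* (# 4 :* n) ≈ x :* x :+ # 7 :* fourth e ⇐
        (# 16 ⟨ n :* n :+ # 11 :* (m :* m :* (e :* e)) ≈ # 4 :* fourth m :+ # 8 :* fourth e ⟩) ∷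
        ((# 8 :* (m :* m) :- # 11 :* (e :* e) :+ x) ⟨ # 8 :* (m :* m) ≈ # 11 :* (e :* e) :+ x ⟩) ∷ [] }) (q , h , tt)
    16n² (inj₂ h) = natural-combination (m ∷ e ∷ n ∷ x ∷ [])
      (λ { (m ∷ e ∷ n ∷ x ∷ []) → # 4 :* n :* (# 4 :* n) ≈ x :* x :+ # 7 :* fourth e ⇐
        (# 16 ⟨ n :* n :+ # 11 :* (m :* m :* (e :* e)) ≈ # 4 :* fourth m :+ # 8 :* fourth e ⟩) ∷
        ((# 11 :* (e :* e) :- # 8 :* (m :* m) :+ x) ⟨ # 11 :* (e :* e) ≈ # 8 :* (m :* m) :+ x ⟩) ∷ [] }) (q , h , tt)
  ...   | f , _ , fg = split-by-7 {4 * m} {e} {2 * x} {f} (odd⇒≢0 oe) (coprime-*ʳ e-4m e-4m) (Sum.map double double′ signs) fg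
    λ { a b refl eq → quartic-16-impossible {m} (odd-factorˡ {a} oe) (odd-factorʳ {a} oe)
        (trans eq (cong (_+ a ⁴) ([m*n]*[o*p]≡[m*o]*[n*p] 4 m 4 m))) }
    where
    e-4m : Coprime e (4 * m)
    e-4m = coprime-*ʳ {e} {4} (coprime-*ʳ {e} {2} (odd⇒coprime-2 oe) (odd⇒coprime-2 oe)) (Coprimality.sym me)
    double : 8 * (m * m) ≡ 11 * (e * e) + x → 4 * m * (4 * m) ≡ 22 * (e * e) + 2 * x
    double h = natural-combination (m ∷ e ∷ x ∷ []) (λ { (m ∷ e ∷ x ∷ []) → # 4 :* m :* (# 4 :* m) ≈ # 22 :* (e :* e) :+ # 2 :* x ⇐
        (# 2 ⟨ # 8 :* (m :* m) ≈ # 11 :* (e :* e) :+ x ⟩) ∷ [] }) (h , tt)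
    double′ : 11 * (e * e) ≡ 8 * (m * m) + x → 22 * (e * e) ≡ 4 * m * (4 * m) + 2 * x
    double′ h = natural-combination (m ∷ e ∷ x ∷ []) (λ { (m ∷ e ∷ x ∷ []) → # 22 :* (e :* e) ≈ # 4 :* m :* (# 4 :* m) :+ # 2 :* x ⇐
        (# 2 ⟨ # 11 :* (e :* e) ≈ # 8 :* (m :* m) :+ x ⟩) ∷ [] }) (h , tt)

  -- Modulo 4 the equation reads n² + 3 = 1.
  quartic₃₂-odd-impossible : ∀ {m e n} → Odd m → Odd e → ¬ Quartic₃₂ m e n
  quartic₃₂-odd-impossible {m} {e} {n} om oe q with odd-square om | odd-square oe | square-mod-4 n
  ... | i , hi | j , hj | k , inj₁ hk = multiple≢ 4 _ (from-no (4 ∣? 2)) (integer-combination (m ∷ e ∷ n ∷ i ∷ j ∷ k ∷ [])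
    (λ { (m ∷ e ∷ n ∷ i ∷ j ∷ k ∷ []) → let A = # 8 :* i :+ # 1 ; B = # 8 :* j :+ # 1 in
      # 4 :* (:- k :- # 22 :* (# 8 :* i :* j :+ i :+ j) :+ # 16 :* i :* i :+ # 4 :* i :+ # 8 :* B :* B :- # 2) ≈ # 2 ⇐
      ((:- # 1) ⟨ n :* n :+ # 11 :* (m :* m :* (e :* e)) ≈ fourth m :+ # 32 :* fourth e ⟩) ∷
      (# 1 ⟨ n :* n ≈ # 4 :* k ⟩) ∷
      ((# 11 :* (e :* e) :- (m :* m :+ A)) ⟨ m :* m ≈ A ⟩) ∷
      ((# 11 :* A :- # 32 :* (e :* e :+ B)) ⟨ e :* e ≈ B ⟩) ∷ [] }) (q , hk , hi , hj , tt))
  ... | i , hi | j , hj | k , inj₂ hk = multiple≢ 4 _ (from-no (4 ∣? 3)) (integer-combination (m ∷ e ∷ n ∷ i ∷ j ∷ k ∷ [])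
    (λ { (m ∷ e ∷ n ∷ i ∷ j ∷ k ∷ []) → let A = # 8 :* i :+ # 1 ; B = # 8 :* j :+ # 1 in
      # 4 :* (:- k :- # 22 :* (# 8 :* i :* j :+ i :+ j) :+ # 16 :* i :* i :+ # 4 :* i :+ # 8 :* B :* B :- # 2) ≈ # 3 ⇐
      ((:- # 1) ⟨ n :* n :+ # 11 :* (m :* m :* (e :* e)) ≈ fourth m :+ # 32 :* fourth e ⟩) ∷
      (# 1 ⟨ n :* n ≈ # 4 :* k :+ # 1 ⟩) ∷
      ((# 11 :* (e :* e) :- (m :* m :+ A)) ⟨ m :* m ≈ A ⟩) ∷
      ((# 11 :* A :- # 32 :* (e :* e :+ B)) ⟨ e :* e ≈ B ⟩) ∷ [] }) (q , hk , hi , hj , tt))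

  -- For e = 2 e₁ one has n² = (m² - 22 e₁²)² + 28 e₁⁴, and with t = |m² - 22 e₁²| the factors of 7
  -- e₁⁴ are (n - t)/2 and (n + t)/2.
  descend₃₂ : ∀ {m e n} → Odd m → e ≢ 0 → Coprime m e → Quartic₃₂ m e n → ∃ λ e₁ → e ≡ 2 * e₁ × Descended e₁ m
  descend₃₂ {m} {e} {n} om e≢0 me q with parity e
  ... | odd k e≡    = ⊥-elim (quartic₃₂-odd-impossible {m} {e} {n} om (k , e≡) q)
  ... | even e₁ refl with distance (m * m) (22 * (e₁ * e₁))
  ...   | t , signs with square-difference-4 {n} {t} {7 * e₁ ⁴} (n² signs)
    where
    n² : m * m ≡ 22 * (e₁ * e₁) + t ⊎ 22 * (e₁ * e₁) ≡ m * m + t → n * n ≡ t * t + 4 * (7 * e₁ ⁴)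
    n² (inj₁ h) = natural-combination (m ∷ e₁ ∷ n ∷ t ∷ [])
      (λ { (m ∷ e₁ ∷ n ∷ t ∷ []) → let e = # 2 :* e₁ in n :* n ≈ t :* t :+ # 4 :* (# 7 :* fourth e₁) ⇐
        (# 1 ⟨ n :* n :+ # 11 :* (m :* m :* (e :* e)) ≈ fourth m :+ # 32 :* fourth e ⟩) ∷
        ((m :* m :- # 22 :* (e₁ :* e₁) :+ t) ⟨ m :* m ≈ # 22 :* (e₁ :* e₁) :+ t ⟩) ∷ [] }) (q , h , tt)
    n² (inj₂ h) = natural-combination (m ∷ e₁ ∷ n ∷ t ∷ [])
      (λ { (m ∷ e₁ ∷ n ∷ t ∷ []) → let e = # 2 :* e₁ in n :* n ≈ t :* t :+ # 4 :* (# 7 :* fourth e₁) ⇐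
        (# 1 ⟨ n :* n :+ # 11 :* (m :* m :* (e :* e)) ≈ fourth m :+ # 32 :* fourth e ⟩) ∷
        ((# 22 :* (e₁ :* e₁) :- m :* m :+ t) ⟨ # 22 :* (e₁ :* e₁) ≈ m :* m :+ t ⟩) ∷ [] }) (q , h , tt)
  ...     | f , _ , fg = e₁ , refl , split-by-7 {m} {e₁} {t} {f} (λ { refl → e≢0 refl }) (coprime-*ʳ e₁-m e₁-m) signs fg
              λ a b _ → quartic-odd-impossible {m} {a} {b} om
    where
    e₁-m : Coprime e₁ m
    e₁-m = coprime-∣ˡ (n∣m*n 2) (Coprimality.sym me)

  square-injective : ∀ {a b} → a * a ≡ b * b → a ≡ b
  square-injective {a} {b} eq = ≤-antisym (≮⇒≥ λ b<a → <-irrefl (sym eq) (*-mono-< b<a b<a))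
                                          (≮⇒≥ λ a<b → <-irrefl eq (*-mono-< a<b a<b))

  quartic-1-1 : ∀ {n} → Quartic 1 1 n → n ≡ 4
  quartic-1-1 {n} q = square-injective (natural-combination (n ∷ [])
    (λ { (n ∷ []) → n :* n ≈ # 16 ⇐ (# 1 ⟨ n :* n :+ # 7 ≈ # 23 ⟩) ∷ [] }) (q , tt))

  quartic-1-1-odd : ∀ {n} → Odd n → ¬ Quartic 1 1 n
  quartic-1-1-odd {n} o q with quartic-1-1 {n} q
  ... | refl = odd⇒2∤ o (divides 2 refl)

  quartic-1-1-4* : ∀ {m} → Quartic 1 1 (4 * m) → m ≡ 1
  quartic-1-1-4* {m} q = *-cancelˡ-≡ m 1 4 (quartic-1-1 {4 * m} q)

  quartic₄-1-1 : ∀ {n} → Quartic₄ 1 1 n → n ≡ 1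
  quartic₄-1-1 {n} q = square-injective (natural-combination (n ∷ [])
    (λ { (n ∷ []) → n :* n ≈ # 1 ⇐ (# 1 ⟨ n :* n :+ # 11 ≈ # 12 ⟩) ∷ [] }) (q , tt))

  -- Modulo 8, n² = 1 + 22 - 7 = 0.
  quartic-odd⇒4∣ : ∀ {m e n} → Odd m → Odd e → Quartic m e n → ∃ λ l → n ≡ 4 * l
  quartic-odd⇒4∣ {m} {e} {n} om oe q with odd-square om | odd-square oe | parity n
  ... | i , hi | j , hj | odd k n≡ with odd-square (k , n≡)
  ...   | p , hp = ⊥-elim (multiple≢ 8 _ (from-no (8 ∣? 1)) (integer-combination (m ∷ e ∷ n ∷ i ∷ j ∷ p ∷ [])
    (λ { (m ∷ e ∷ n ∷ i ∷ j ∷ p ∷ []) → let A = # 8 :* i :+ # 1 ; B = # 8 :* j :+ # 1 in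
      # 8 :* (# 8 :* i :* i :+ # 2 :* i :+ # 22 :* (# 8 :* i :* j :+ i :+ j) :- # 7 :* (# 8 :* j :* j :+ # 2 :* j) :+ # 2 :- p) ≈ # 1 ⇐
      ((:- # 1) ⟨ n :* n :+ # 7 :* fourth e ≈ fourth m :+ # 22 :* (m :* m :* (e :* e)) ⟩) ∷
      (# 1 ⟨ n :* n ≈ # 8 :* p :+ # 1 ⟩) ∷
      ((:- (# 22 :* (e :* e) :+ m :* m :+ A)) ⟨ m :* m ≈ A ⟩) ∷
      ((# 7 :* (e :* e :+ B) :- # 22 :* A) ⟨ e :* e ≈ B ⟩) ∷ [] }) (q , hp , hi , hj , tt)))
  quartic-odd⇒4∣ {m} {e} om oe q | i , hi | j , hj | even k refl with parity k
  ...   | even l refl = l , sym (*-assoc 2 2 l)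
  ...   | odd l k≡ with odd-square (l , k≡)
  ...     | p , hp = ⊥-elim (multiple≢ 8 _ (from-no (8 ∣? 4)) (integer-combination (m ∷ e ∷ k ∷ i ∷ j ∷ p ∷ [])
    (λ { (m ∷ e ∷ k ∷ i ∷ j ∷ p ∷ []) → let A = # 8 :* i :+ # 1 ; B = # 8 :* j :+ # 1 ; n = # 2 :* k in
      # 8 :* (# 8 :* i :* i :+ # 2 :* i :+ # 22 :* (# 8 :* i :* j :+ i :+ j) :- # 7 :* (# 8 :* j :* j :+ # 2 :* j) :+ # 2 :- # 4 :* p) ≈ # 4 ⇐
      ((:- # 1) ⟨ n :* n :+ # 7 :* fourth e ≈ fourth m :+ # 22 :* (m :* m :* (e :* e)) ⟩) ∷
      (# 4 ⟨ k :* k ≈ # 8 :* p :+ # 1 ⟩) ∷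
      ((:- (# 22 :* (e :* e) :+ m :* m :+ A)) ⟨ m :* m ≈ A ⟩) ∷
      ((# 7 :* (e :* e :+ B) :- # 22 :* A) ⟨ e :* e ≈ B ⟩) ∷ [] }) (q , hp , hi , hj , tt)))

  common-divisor-of-norm : ∀ {m e s} → Coprime m e → m * m + 11 * (e * e) ≡ s → ∀ {c} → c ∣ s → Coprime c e
  common-divisor-of-norm {m} {e} me s≡ c∣s {i} (i∣c , i∣e) = ∣-coprime⇒≡1 (coprime-*ʳ i-m i-m)
    (∣-summandˡ (m * m) s≡ (∣-trans i∣c c∣s) (∣n⇒∣m*n 11 (∣m⇒∣m*n e i∣e)))
    where
    i-m : Coprime i m
    i-m = coprime-∣ˡ i∣e (Coprimality.sym me)

  sum-of-factors : ∀ f n → f + (f + n) ≡ n + 2 * f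
  sum-of-factors f n = natural-combination (f ∷ n ∷ []) (λ { (f ∷ n ∷ []) → f :+ (f :+ n) ≈ n :+ # 2 :* f ⇐ [] }) tt

  add-factors : ∀ {f g k l} → f ≡ k × g ≡ l ⊎ f ≡ l × g ≡ k → f + g ≡ k + l
  add-factors (inj₁ (refl , refl)) = refl
  add-factors {f} {g} (inj₂ (refl , refl)) = +-comm f g

  -- The quartic is equivalent to (m² + 11 e²)² = n² + 128 e⁴. For odd m and e, m² + 11 e² = 4 s and
  -- n = 4 l, so (s - l)/2 and (s + l)/2 have product 2 e⁴; they are 2 a⁴ and b⁴ in some order, and
  -- their sum s gives the new quartic.
  from-both-odd : ∀ {m e n} → Odd m → Odd e → Coprime m e → Quartic m e n →
    ∃₂ λ a b → e ≡ a * b × Coprime b a × Quartic₄ b a m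
  from-both-odd {m} {e} {n} om oe me q with quartic-odd⇒4∣ {m} {e} {n} om oe q | odd-square om | odd-square oe
  ... | l , refl | i , hi | j , hj = from-difference (square-difference-4 {s} {l} {2 * e ⁴} s²)
    where
    s = 2 * i + 22 * j + 3
    s² : s * s ≡ l * l + 4 * (2 * e ⁴)
    s² = *-cancelˡ-≡ _ _ 16 (natural-combination (m ∷ e ∷ l ∷ i ∷ j ∷ [])
        (λ { (m ∷ e ∷ l ∷ i ∷ j ∷ []) → let s = # 2 :* i :+ # 22 :* j :+ # 3 ; S = m :* m :+ # 11 :* (e :* e) ; n = # 4 :* l in
          # 16 :* (s :* s) ≈ # 16 :* (l :* l :+ # 4 :* (# 2 :* fourth e)) ⇐
          ((:- # 1) ⟨ n :* n :+ # 7 :* fourth e ≈ fourth m :+ # 22 :* (m :* m :* (e :* e)) ⟩) ∷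
          ((:- (# 4 :* s :+ S)) ⟨ m :* m ≈ # 8 :* i :+ # 1 ⟩) ∷
          ((:- (# 11 :* (# 4 :* s :+ S))) ⟨ e :* e ≈ # 8 :* j :+ # 1 ⟩) ∷ [] }) (q , hi , hj , tt))
    4s : m * m + 11 * (e * e) ≡ 4 * s
    4s = natural-combination (m ∷ e ∷ i ∷ j ∷ [])
      (λ { (m ∷ e ∷ i ∷ j ∷ []) → m :* m :+ # 11 :* (e :* e) ≈ # 4 :* (# 2 :* i :+ # 22 :* j :+ # 3) ⇐
        (# 1 ⟨ m :* m ≈ # 8 :* i :+ # 1 ⟩) ∷ (# 11 ⟨ e :* e ≈ # 8 :* j :+ # 1 ⟩) ∷ [] }) (hi , hj , tt)
    from-difference : (∃ λ f → s ≡ l + 2 * f × f * (f + l) ≡ 2 * e ⁴) → ∃₂ λ a b → e ≡ a * b × Coprime b a × Quartic₄ b a m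
    from-difference (f , s≡ , fg) = conclude (factorise 2 e (λ ()) (odd⇒≢0 oe) fg
        (λ c∣f c∣g → common-divisor-of-norm me 4s (∣n⇒∣m*n 4 (∣s c∣f c∣g)))
        (λ _ _ → square-∣⇒≡1 (λ ()) (from-no (4 ∣? 2)) (from-no (9 ∣? 2)) (m≤m+n 3 13))
        (λ _ → prime-one-side {2} {e ⁴} 2-prime fg))
      where
      f+g≡ : f + (f + l) ≡ s
      f+g≡ = trans (sum-of-factors f l) (sym s≡)
      ∣s : ∀ {c} → c ∣ f → c ∣ f + l → c ∣ s
      ∣s {c} c∣f c∣g = subst (c ∣_) f+g≡ (∣m∣n⇒∣m+n c∣f c∣g)
      conclude : Factorisation 2 e f (f + l) → ∃₂ λ a b → e ≡ a * b × Coprime b a × Quartic₄ b a m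
      conclude (a , b , refl , ab , fg≡) = a , b , refl , Coprimality.sym ab ,
        natural-combination (m ∷ a ∷ b ∷ s ∷ [])
          (λ { (m ∷ a ∷ b ∷ s ∷ []) → m :* m :+ # 11 :* (b :* b :* (a :* a)) ≈ # 4 :* fourth b :+ # 8 :* fourth a ⇐
            (# 1 ⟨ m :* m :+ # 11 :* (a :* b :* (a :* b)) ≈ # 4 :* s ⟩) ∷
            (# 4 ⟨ s ≈ # 2 :* fourth a :+ fourth b ⟩) ∷ [] }) (4s , trans (sym f+g≡) (add-factors fg≡) , tt)

  coprime-32 : ∀ {n} → Odd n → Coprime n 32
  coprime-32 o = coprime-*ʳ {b = 2} {c = 16} (odd⇒coprime-2 o) (coprime-⁴ (odd⇒coprime-2 o))

  odd-summand : ∀ {m n} → Odd (m + n) → Odd m ⊎ Odd n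
  odd-summand {m} {n} o with parity m
  ... | odd k m≡    = inj₁ (k , m≡)
  ... | even k refl = inj₂ (2∤⇒odd λ 2∣n → odd⇒2∤ o (∣m∣n⇒∣m+n (m∣m*n k) 2∣n))

  -- The same difference of squares with s = m² + 11 e² odd: (s - n)/2 and (s + n)/2 have product 32
  -- e⁴ and odd sum s, so one of them is odd and the other takes all of 32.
  from-odd-norm : ∀ {m e n} → e ≢ 0 → Odd (m * m + 11 * (e * e)) → Coprime m e → Quartic m e n →
    ∃₂ λ a b → e ≡ a * b × Odd b × Coprime b a × Quartic₃₂ b a m
  from-odd-norm {m} {e} {n} e≢0 os me q = from-difference (square-difference-4 {s} {n} {32 * e ⁴} s²)
    where
    s = m * m + 11 * (e * e)
    s² : s * s ≡ n * n + 4 * (32 * e ⁴)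
    s² = natural-combination (m ∷ e ∷ n ∷ [])
      (λ { (m ∷ e ∷ n ∷ []) → let S = m :* m :+ # 11 :* (e :* e) in
        S :* S ≈ n :* n :+ # 4 :* (# 32 :* fourth e) ⇐
        ((:- # 1) ⟨ n :* n :+ # 7 :* fourth e ≈ fourth m :+ # 22 :* (m :* m :* (e :* e)) ⟩) ∷ [] }) (q , tt)
    from-difference : (∃ λ f → s ≡ n + 2 * f × f * (f + n) ≡ 32 * e ⁴) →
      ∃₂ λ a b → e ≡ a * b × Odd b × Coprime b a × Quartic₃₂ b a m
    from-difference (f , s≡ , fg) = conclude (factorise 32 e (λ ()) e≢0 fg
        (λ c∣f c∣g → common-divisor-of-norm me refl (∣s c∣f c∣g))
        (λ c∣f c∣g cc∣32 → m*n≡1⇒m≡1 _ _ (∣-coprime⇒≡1 (coprime-32 (odd-* (odd-divisor (∣s c∣f c∣g) os))) cc∣32))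
        one-side)
      where
      f+g≡ : f + (f + n) ≡ s
      f+g≡ = trans (sum-of-factors f n) (sym s≡)
      ∣s : ∀ {c} → c ∣ f → c ∣ f + n → c ∣ s
      ∣s {c} c∣f c∣g = subst (c ∣_) f+g≡ (∣m∣n⇒∣m+n c∣f c∣g)
      odd-* : ∀ {c} → Odd c → Odd (c * c)
      odd-* {c} o with odd-square o
      ... | k , h = 4 * k , trans h (cong (_+ 1) (*-assoc 2 4 k))
      32∣fg : 32 ∣ f * (f + n)
      32∣fg = subst (32 ∣_) (sym fg) (m∣m*n (e ⁴))
      one-side : Coprime f (f + n) → 32 ∣ f ⊎ 32 ∣ f + n
      one-side _ with odd-summand {f} {f + n} (subst Odd (sym f+g≡) os)
      ... | inj₁ of = inj₂ (coprime-divisor (Coprimality.sym (coprime-32 of)) 32∣fg)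
      ... | inj₂ og = inj₁ (coprime-divisor (Coprimality.sym (coprime-32 og)) (subst (32 ∣_) (*-comm f (f + n)) 32∣fg))
      conclude : Factorisation 32 e f (f + n) → ∃₂ λ a b → e ≡ a * b × Odd b × Coprime b a × Quartic₃₂ b a m
      conclude (a , b , refl , ab , fg≡) = a , b , refl , ob , Coprimality.sym ab ,
        natural-combination (m ∷ a ∷ b ∷ [])
          (λ { (m ∷ a ∷ b ∷ []) → m :* m :+ # 11 :* (b :* b :* (a :* a)) ≈ fourth b :+ # 32 :* fourth a ⇐
            (# 1 ⟨ m :* m :+ # 11 :* (a :* b :* (a :* b)) ≈ # 32 :* fourth a :+ fourth b ⟩) ∷ [] }) (s≡′ , tt)
        where
        s≡′ : s ≡ 32 * a ⁴ + b ⁴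
        s≡′ = trans (sym f+g≡) (add-factors fg≡)
        ob⁴ : Odd (b ⁴)
        ob⁴ = 2∤⇒odd λ 2∣b⁴ → odd⇒2∤ os (subst (2 ∣_) (sym s≡′) (∣m∣n⇒∣m+n (∣-trans (divides 16 refl) (m∣m*n (a ⁴))) 2∣b⁴))
        ob : Odd b
        ob = odd-factorˡ {b} (odd-factorˡ {b * b} ob⁴)

  factorˡ≢0 : ∀ {m n k} → k ≢ 0 → k ≡ m * n → m ≢ 0
  factorˡ≢0 k≢0 k≡ refl = k≢0 k≡

  factorʳ≢0 : ∀ {m n k} → k ≢ 0 → k ≡ m * n → n ≢ 0
  factorʳ≢0 {m} k≢0 k≡ refl = k≢0 (trans k≡ (*-zeroʳ m))

  coprime⇒¬both-even : ∀ {m e} → Coprime m e → 2 ∣ m → ¬ 2 ∣ e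
  coprime⇒¬both-even me 2∣m 2∣e = contradiction (me (2∣m , 2∣e)) λ ()

  -- With e² = 8 j + 1 the equation becomes 7 j² = j.
  quartic-1-e-4 : ∀ {e} → Odd e → Quartic 1 e 4 → e ≡ 1
  quartic-1-e-4 {e} oe q with odd-square oe
  ... | j , hj = square-injective (trans hj (cong (λ j → 8 * j + 1) (j≡0 j 7jj≡j)))
    where
    7jj≡j : 7 * j * j ≡ j
    7jj≡j = *-cancelˡ-≡ _ _ 64 (natural-combination (e ∷ j ∷ [])
      (λ { (e ∷ j ∷ []) → let B = # 8 :* j :+ # 1 in # 64 :* (# 7 :* j :* j) ≈ # 64 :* j ⇐
        (# 1 ⟨ # 16 :+ # 7 :* fourth e ≈ # 1 :+ # 22 :* (# 1 :* (e :* e)) ⟩) ∷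
        ((# 22 :- # 7 :* (e :* e :+ B)) ⟨ e :* e ≈ B ⟩) ∷ [] }) (q , hj , tt))
    j≡0 : ∀ j → 7 * j * j ≡ j → j ≡ 0
    j≡0 zero    _  = refl
    j≡0 (suc j) eq = contradiction (m*n≡1⇒m≡1 7 (suc j) (*-cancelʳ-≡ (7 * suc j) 1 (suc j) (trans eq (sym (*-identityˡ (suc j)))))) λ ()

  -- Infinite descent on e.
  quartic-trivial : ∀ {m e n} → e ≢ 0 → Coprime m e → Quartic m e n → m ≡ 1 × e ≡ 1
  quartic-trivial {m} {e} {n} = descent m e n (<-wellFounded e)
    where
    descent : ∀ m e n → Acc _<_ e → e ≢ 0 → Coprime m e → Quartic m e n → m ≡ 1 × e ≡ 1
    descent m e n (acc smaller) e≢0 me q = by-parity (parity m) (parity e)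
      where
      both-odd : Odd e → (∃₂ λ a b → e ≡ a * b × Coprime b a × Quartic₄ b a m) → m ≡ 1 × e ≡ 1
      both-odd oe (a , b , e≡ab , ba , q₄) = next (descend₄ {b} {a} {m} ob oa ba q₄)
        where
        oa : Odd a
        oa = odd-factorˡ {a} (subst Odd e≡ab oe)
        ob : Odd b
        ob = odd-factorʳ {a} (subst Odd e≡ab oe)
        finish : a ≡ 1 → b ≡ 1 → m ≡ 1 × e ≡ 1
        finish refl refl = quartic₄-1-1 {m} q₄ , e≡ab
        next : Descended a (4 * b) → m ≡ 1 × e ≡ 1
        next (a′ , b′ , a≡ , a′b′ , q′) = compare (m≤n⇒m<n∨m≡n b′≤e)
          where
          b′≢0 : b′ ≢ 0
          b′≢0 = factorʳ≢0 {a′} (odd⇒≢0 oa) a≡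
          b′≤e : b′ ≤ e
          b′≤e = ∣⇒≤ {{≢-nonZero e≢0}} (subst (b′ ∣_) (sym e≡ab) (∣m⇒∣m*n b (subst (b′ ∣_) (sym a≡) (n∣m*n a′))))
          compare : b′ < e ⊎ b′ ≡ e → m ≡ 1 × e ≡ 1
          compare (inj₁ b′<e) = apply (descent a′ b′ (4 * b) (smaller b′<e) b′≢0 a′b′ q′)
            where
            apply : a′ ≡ 1 × b′ ≡ 1 → m ≡ 1 × e ≡ 1
            apply (refl , refl) = finish a≡ (quartic-1-1-4* {b} q′)
          -- No strict descent: e = a b = a′ b′ b and b′ = e give a′ = b = 1, and 16 + 7 e⁴ = 1 + 22
          -- e² remains. The solution e = 1 reproduces itself here.
          compare (inj₂ refl) = finish (trans a≡ (trans (cong (_* b′) a′≡1) (trans (*-identityˡ b′) e≡1))) b≡1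
            where
            a′b≡1 : a′ * b ≡ 1
            a′b≡1 = *-cancelʳ-≡ _ _ b′ {{≢-nonZero b′≢0}} (natural-combination (a ∷ b ∷ a′ ∷ b′ ∷ [])
              (λ { (a ∷ b ∷ a′ ∷ b′ ∷ []) → a′ :* b :* b′ ≈ # 1 :* b′ ⇐
                ((:- # 1) ⟨ b′ ≈ a :* b ⟩) ∷ ((:- b) ⟨ a ≈ a′ :* b′ ⟩) ∷ [] }) (e≡ab , a≡ , tt))
            a′≡1 : a′ ≡ 1
            a′≡1 = m*n≡1⇒m≡1 a′ b a′b≡1
            b≡1 : b ≡ 1
            b≡1 = m*n≡1⇒n≡1 a′ b a′b≡1
            e≡1 : b′ ≡ 1
            e≡1 = quartic-1-e-4 oe (subst₂ (λ x y → Quartic x b′ (4 * y)) a′≡1 b≡1 q′)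
      norm-odd : (∃₂ λ a b → e ≡ a * b × Odd b × Coprime b a × Quartic₃₂ b a m) → m ≡ 1 × e ≡ 1
      norm-odd (a , b , e≡ab , ob , ba , q₃₂) = next (descend₃₂ {b} {a} {m} ob (factorˡ≢0 e≢0 e≡ab) ba q₃₂)
        where
        next : (∃ λ a₁ → a ≡ 2 * a₁ × Descended a₁ b) → m ≡ 1 × e ≡ 1
        -- The factor 2 in a = 2 a₁ makes the descent strict. The induction hypothesis a′ = b′ = 1
        -- would give b = 4, while b is odd.
        next (a₁ , a≡ , a′ , b′ , a₁≡ , a′b′ , q′) = ⊥-elim (clash (descent a′ b′ b (smaller b′<e) b′≢0 a′b′ q′))
          where
          a₁≢0 : a₁ ≢ 0
          a₁≢0 = factorʳ≢0 {2} (factorˡ≢0 e≢0 e≡ab) a≡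
          b′≢0 : b′ ≢ 0
          b′≢0 = factorʳ≢0 {a′} a₁≢0 a₁≡
          instance
            _ = ≢-nonZero a₁≢0
            _ = ≢-nonZero e≢0
          b′<e : b′ < e
          b′<e = ≤-trans (s≤s (∣⇒≤ (subst (b′ ∣_) (sym a₁≡) (n∣m*n a′))))
                 (≤-trans (subst (suc a₁ ≤_) (sym a≡) (m<m*n′ a₁≢0)) (∣⇒≤ (subst (a ∣_) (sym e≡ab) (m∣m*n b))))
            where
            m<m*n′ : ∀ {k} → k ≢ 0 → k < 2 * k
            m<m*n′ {zero}  k≢0 = contradiction refl k≢0
            m<m*n′ {suc k} _   = m<m+n (suc k) (s≤s z≤n)
          clash : a′ ≡ 1 × b′ ≡ 1 → ⊥
          clash (refl , refl) = quartic-1-1-odd ob q′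
      by-parity : Parity m → Parity e → m ≡ 1 × e ≡ 1
      by-parity (even k m≡) (even l e≡) = ⊥-elim (coprime⇒¬both-even me (subst (2 ∣_) (sym m≡) (m∣m*n k)) (subst (2 ∣_) (sym e≡) (m∣m*n l)))
      by-parity (odd k m≡) (odd l e≡) = both-odd (l , e≡) (from-both-odd {m} {e} {n} (k , m≡) (l , e≡) me q)
      by-parity (odd k m≡) (even l e≡) = norm-odd (from-odd-norm {m} {e} {n} e≢0
        (2 * k * k + 2 * k + 22 * l * l , natural-combination (m ∷ e ∷ k ∷ l ∷ [])
          (λ { (m ∷ e ∷ k ∷ l ∷ []) → let M = # 2 :* k :+ # 1 ; E = # 2 :* l in
            m :* m :+ # 11 :* (e :* e) ≈ # 2 :* (# 2 :* k :* k :+ # 2 :* k :+ # 22 :* l :* l) :+ # 1 ⇐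
            ((m :+ M) ⟨ m ≈ M ⟩) ∷ ((# 11 :* (e :+ E)) ⟨ e ≈ E ⟩) ∷ [] }) (m≡ , e≡ , tt)) me q)
      by-parity (even k m≡) (odd l e≡) = norm-odd (from-odd-norm {m} {e} {n} e≢0
        (2 * k * k + 22 * l * l + 22 * l + 5 , natural-combination (m ∷ e ∷ k ∷ l ∷ [])
          (λ { (m ∷ e ∷ k ∷ l ∷ []) → let M = # 2 :* k ; E = # 2 :* l :+ # 1 in
            m :* m :+ # 11 :* (e :* e) ≈ # 2 :* (# 2 :* k :* k :+ # 22 :* l :* l :+ # 22 :* l :+ # 5) :+ # 1 ⇐
            ((m :+ M) ⟨ m ≈ M ⟩) ∷ ((# 11 :* (e :+ E)) ⟨ e ≈ E ⟩) ∷ [] }) (m≡ , e≡ , tt)) me q)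

  quartic₄-trivial : ∀ {m e n} → Odd m → Odd e → Coprime m e → Quartic₄ m e n → m ≡ 1 × e ≡ 1
  quartic₄-trivial {m} {e} {n} om oe me q = conclude (descend₄ {m} {e} {n} om oe me q)
    where
    conclude : Descended e (4 * m) → m ≡ 1 × e ≡ 1
    conclude (a , b , e≡ab , ab , q′) = finish (quartic-trivial {a} {b} {4 * m} (factorʳ≢0 {a} (odd⇒≢0 oe) e≡ab) ab q′)
      where
      finish : a ≡ 1 × b ≡ 1 → m ≡ 1 × e ≡ 1
      finish (refl , refl) = quartic-1-1-4* {m} q′ , e≡ab

  quartic₃₂-impossible : ∀ {m e n} → Odd m → e ≢ 0 → Coprime m e → ¬ Quartic₃₂ m e n
  quartic₃₂-impossible {m} {e} {n} om e≢0 me q = conclude (descend₃₂ {m} {e} {n} om e≢0 me q)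
    where
    conclude : ¬ (∃ λ e₁ → e ≡ 2 * e₁ × Descended e₁ m)
    conclude (e₁ , e≡ , a , b , e₁≡ab , ab , q′) =
      finish (quartic-trivial {a} {b} {m} (factorʳ≢0 {a} (factorʳ≢0 {2} e≢0 e≡) e₁≡ab) ab q′)
      where
      finish : ¬ (a ≡ 1 × b ≡ 1)
      finish (refl , refl) = quartic-1-1-odd om q′

  -- From the elliptic curve to its quartic coverings.

  QuarticForm : ℕ → ℕ → ℕ → ℕ → Set
  QuarticForm k l x y = ∃₂ λ α β → x ≡ α * α × y ≡ β * β × Coprime β α ×
    ∃ λ γ → γ * γ + 11 * (α * α * (β * β)) ≡ k * α ⁴ + l * β ⁴

  -- The three factors of n² are pairwise coprime, hence squares: a common divisor of x and q
  -- divides l y², and one of y and q divides k x².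
  quadratic-form⇒quartic : ∀ k l {x y q n} → x ≢ 0 → y ≢ 0 → Coprime x y → Coprime x l → Coprime y k →
    x * y * q ≡ n * n → q + 11 * (x * y) ≡ k * (x * x) + l * (y * y) → QuarticForm k l x y
  quadratic-form⇒quartic k l {x} {y} {q} {n} x≢0 y≢0 xy xl yk xyq form =
    from-x (coprime-squares {x} {y * q} n x≢0 (coprime-*ʳ xy xq) (trans (sym (*-assoc x y q)) xyq))
    where
    xq : Coprime x q
    xq {i} (i∣x , i∣q) = ∣-coprime⇒≡1 (coprime-*ʳ (coprime-∣ˡ i∣x xl) (coprime-*ʳ (coprime-∣ˡ i∣x xy) (coprime-∣ˡ i∣x xy)))
      (∣m+n∣m⇒∣n (subst (i ∣_) form (∣m∣n⇒∣m+n i∣q (∣n⇒∣m*n 11 (∣m⇒∣m*n y i∣x)))) (∣n⇒∣m*n k (∣m⇒∣m*n x i∣x)))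
    yq : Coprime y q
    yq {i} (i∣y , i∣q) = ∣-coprime⇒≡1 (coprime-*ʳ (coprime-∣ˡ i∣y yk) (coprime-*ʳ i-x i-x))
      (∣-summandˡ (k * (x * x)) refl (subst (i ∣_) form (∣m∣n⇒∣m+n i∣q (∣n⇒∣m*n 11 (∣n⇒∣m*n x i∣y)))) (∣n⇒∣m*n l (∣m⇒∣m*n y i∣y)))
      where
      i-x : Coprime i x
      i-x = coprime-∣ˡ i∣y (Coprimality.sym xy)
    from-x : (∃₂ λ α n′ → n ≡ α * n′ × x ≡ α * α × y * q ≡ n′ * n′) → QuarticForm k l x y
    from-x (α , n′ , _ , x≡ , yq≡) = from-y (coprime-squares {y} {q} n′ y≢0 yq yq≡)
      where
      from-y : (∃₂ λ β γ → n′ ≡ β * γ × y ≡ β * β × q ≡ γ * γ) → QuarticForm k l x y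
      from-y (β , γ , _ , y≡ , q≡) = α , β , x≡ , y≡ ,
        coprime-roots (Coprimality.sym (subst₂ Coprime x≡ y≡ xy)) , γ ,
        subst₂ (λ u v → u + 11 * v ≡ k * α ⁴ + l * β ⁴) q≡ (cong₂ _*_ x≡ y≡)
          (trans form (cong₂ (λ u v → k * (u * u) + l * (v * v)) x≡ y≡))

  2∣square⇒2∣ : ∀ n → 2 ∣ n * n → ∃ λ k → n ≡ 2 * k
  2∣square⇒2∣ n 2∣nn with euclidsLemma n n 2-prime 2∣nn
  ... | inj₁ (divides k n≡) = k , trans n≡ (*-comm k 2)
  ... | inj₂ (divides k n≡) = k , trans n≡ (*-comm k 2)

  -- n² = x y (k x² - 11 x y + l y²)
  Sextic : ℕ → ℕ → ℕ → ℕ → ℕ → ℕ → Set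
  Sextic k l a b q n = a * b * q ≡ n * n × q + 11 * (a * b) ≡ k * (a * a) + l * (b * b)

  -- Modulo 4 the equation reads γ² + 3 = 2.
  quartic₂-impossible : ∀ {α β γ} → Odd α → Odd β → γ * γ + 11 * (α * α * (β * β)) ≢ 16 * α ⁴ + 2 * β ⁴
  quartic₂-impossible {α} {β} {γ} oα oβ eq = by-squares (odd-square oα) (odd-square oβ) (square-mod-4 γ)
    where
    by-squares : (∃ λ i → α * α ≡ 8 * i + 1) → (∃ λ j → β * β ≡ 8 * j + 1) → (∃ λ k → γ * γ ≡ 4 * k ⊎ γ * γ ≡ 4 * k + 1) → ⊥
    by-squares (i , hi) (j , hj) (k , inj₁ hk) = multiple≢ 4 _ (from-no (4 ∣? 1)) (integer-combination (α ∷ β ∷ γ ∷ i ∷ j ∷ k ∷ [])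
      (λ { (α ∷ β ∷ γ ∷ i ∷ j ∷ k ∷ []) → let A = # 8 :* i :+ # 1 ; B = # 8 :* j :+ # 1 in
        # 4 :* (# 4 :* A :* A :+ # 32 :* j :* j :+ # 8 :* j :- k :- # 22 :* (# 8 :* i :* j :+ i :+ j) :- # 2) ≈ # 1 ⇐
        ((:- # 1) ⟨ γ :* γ :+ # 11 :* (α :* α :* (β :* β)) ≈ # 16 :* fourth α :+ # 2 :* fourth β ⟩) ∷
        (# 1 ⟨ γ :* γ ≈ # 4 :* k ⟩) ∷
        ((# 11 :* (β :* β) :- # 16 :* (α :* α :+ A)) ⟨ α :* α ≈ A ⟩) ∷
        ((# 11 :* A :- # 2 :* (β :* β :+ B)) ⟨ β :* β ≈ B ⟩) ∷ [] }) (eq , hk , hi , hj , tt))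
    by-squares (i , hi) (j , hj) (k , inj₂ hk) = multiple≢ 4 _ (from-no (4 ∣? 2)) (integer-combination (α ∷ β ∷ γ ∷ i ∷ j ∷ k ∷ [])
      (λ { (α ∷ β ∷ γ ∷ i ∷ j ∷ k ∷ []) → let A = # 8 :* i :+ # 1 ; B = # 8 :* j :+ # 1 in
        # 4 :* (# 4 :* A :* A :+ # 32 :* j :* j :+ # 8 :* j :- k :- # 22 :* (# 8 :* i :* j :+ i :+ j) :- # 2) ≈ # 2 ⇐
        ((:- # 1) ⟨ γ :* γ :+ # 11 :* (α :* α :* (β :* β)) ≈ # 16 :* fourth α :+ # 2 :* fourth β ⟩) ∷
        (# 1 ⟨ γ :* γ ≈ # 4 :* k :+ # 1 ⟩) ∷
        ((# 11 :* (β :* β) :- # 16 :* (α :* α :+ A)) ⟨ α :* α ≈ A ⟩) ∷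
        ((# 11 :* A :- # 2 :* (β :* β :+ B)) ⟨ β :* β ≈ B ⟩) ∷ [] }) (eq , hk , hi , hj , tt))

  -- Both q and n are even too; dividing the two equations by 4 and by 2 moves a factor 2 from the
  -- second coefficient to the first.
  halve-x : ∀ k l {x y q n} → Sextic k (2 * l) (2 * x) y q n → ∃₂ λ q′ n′ → Sextic (2 * k) l x y q′ n′
  halve-x k l {x} {y} {q} {n} (xyq , form) = halve-q (parity q)
    where
    halve-q : Parity q → ∃₂ λ q′ n′ → Sextic (2 * k) l x y q′ n′
    halve-q (odd j refl) = ⊥-elim (odd⇒2∤ (j , refl) (∣-summandˡ q form
      (∣m∣n⇒∣m+n (∣n⇒∣m*n k (∣m⇒∣m*n (2 * x) (m∣m*n x))) (∣m⇒∣m*n (y * y) (m∣m*n l)))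
      (∣n⇒∣m*n 11 (∣m⇒∣m*n y (m∣m*n x)))))
    halve-q (even q′ refl) = halve-n (2∣square⇒2∣ n (subst (2 ∣_) xyq (∣m⇒∣m*n (2 * q′) (∣m⇒∣m*n y (m∣m*n x)))))
      where
      halve-n : (∃ λ n′ → n ≡ 2 * n′) → ∃₂ λ q′ n′ → Sextic (2 * k) l x y q′ n′
      halve-n (n′ , refl) = q′ , n′ ,
        *-cancelˡ-≡ _ _ 4 (natural-combination (x ∷ y ∷ q′ ∷ n′ ∷ [])
          (λ { (x ∷ y ∷ q ∷ n ∷ []) → # 4 :* (x :* y :* q) ≈ # 4 :* (n :* n) ⇐
            (# 1 ⟨ # 2 :* x :* y :* (# 2 :* q) ≈ # 2 :* n :* (# 2 :* n) ⟩) ∷ [] }) (xyq , tt)) ,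
        *-cancelˡ-≡ _ _ 2 (natural-combination (k ∷ l ∷ x ∷ y ∷ q′ ∷ [])
          (λ { (k ∷ l ∷ x ∷ y ∷ q ∷ []) → # 2 :* (q :+ # 11 :* (x :* y)) ≈ # 2 :* (# 2 :* k :* (x :* x) :+ l :* (y :* y)) ⇐
            (# 1 ⟨ # 2 :* q :+ # 11 :* (# 2 :* x :* y) ≈ k :* (# 2 :* x :* (# 2 :* x)) :+ # 2 :* l :* (y :* y) ⟩) ∷ [] }) (form , tt))

  coprime-1 : ∀ {n} → Coprime n 1
  coprime-1 (_ , i∣1) = ∣1⇒≡1 i∣1

  odd-root : ∀ {n α} → n ≡ α * α → Odd n → Odd α
  odd-root {α = α} n≡ o = odd-factorˡ {α} (subst Odd n≡ o)

  -- The power of 2 in x selects a covering: (8, 4) for x odd, (16, 2) for x twice an odd number,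
  -- (32, 1) when 4 ∣ x. Only the first has an admissible solution.
  sextic-odd : ∀ {x y q n} → x ≢ 0 → Odd y → Coprime x y → Sextic 8 4 x y q n → x ≡ 1 × y ≡ 1
  sextic-odd {x} {y} {q} {n} x≢0 oy xy h@(xyq , form) = by-parity (parity x)
    where
    y-2 : Coprime y 2
    y-2 = odd⇒coprime-2 oy
    y-16 : Coprime y 16
    y-16 = coprime-⁴ y-2
    by-parity : Parity x → x ≡ 1 × y ≡ 1
    by-parity (odd k x≡) = conclude (quadratic-form⇒quartic 8 4 {n = n} x≢0 (odd⇒≢0 oy) xy
        (coprime-*ʳ {b = 2} x-2 x-2) (coprime-*ʳ {b = 4} (coprime-*ʳ {b = 2} y-2 y-2) y-2) xyq form)
      where
      ox : Odd x
      ox = k , x≡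
      x-2 : Coprime x 2
      x-2 = odd⇒coprime-2 ox
      conclude : QuarticForm 8 4 x y → x ≡ 1 × y ≡ 1
      conclude (α , β , x≡ , y≡ , βα , γ , eq) = trivial (quartic₄-trivial {β} {α} {γ} (odd-root y≡ oy) (odd-root x≡ ox) βα
          (trans (cong (λ t → γ * γ + 11 * t) (*-comm (β * β) (α * α))) (trans eq (+-comm (8 * α ⁴) _))))
        where
        trivial : β ≡ 1 × α ≡ 1 → x ≡ 1 × y ≡ 1
        trivial (refl , refl) = x≡ , y≡
    by-parity (even x₁ refl) = once (halve-x 8 2 {x₁} {y} {q} {n} h)
      where
      x₁≢0 : x₁ ≢ 0
      x₁≢0 refl = x≢0 refl
      x₁y : Coprime x₁ y
      x₁y = coprime-∣ˡ (n∣m*n 2) xy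
      once : (∃₂ λ q₁ n₁ → Sextic 16 2 x₁ y q₁ n₁) → 2 * x₁ ≡ 1 × y ≡ 1
      once (q₁ , n₁ , h₁@(xyq₁ , form₁)) = by-parity₁ (parity x₁)
        where
        by-parity₁ : Parity x₁ → 2 * x₁ ≡ 1 × y ≡ 1
        by-parity₁ (odd k x≡) = ⊥-elim (impossible (quadratic-form⇒quartic 16 2 {n = n₁} x₁≢0 (odd⇒≢0 oy) x₁y
            (odd⇒coprime-2 ox₁) y-16 xyq₁ form₁))
          where
          ox₁ : Odd x₁
          ox₁ = k , x≡
          impossible : ¬ QuarticForm 16 2 x₁ y
          impossible (α , β , x≡ , y≡ , _ , γ , eq) = quartic₂-impossible {α} {β} {γ} (odd-root x≡ ox₁) (odd-root y≡ oy) eq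
        by-parity₁ (even x₂ refl) = ⊥-elim (twice (halve-x 16 1 {x₂} {y} {q₁} {n₁} h₁))
          where
          x₂≢0 : x₂ ≢ 0
          x₂≢0 refl = x₁≢0 refl
          twice : ¬ (∃₂ λ q₂ n₂ → Sextic 32 1 x₂ y q₂ n₂)
          twice (q₂ , n₂ , xyq₂ , form₂) = impossible (quadratic-form⇒quartic 32 1 {n = n₂} x₂≢0 (odd⇒≢0 oy)
              (coprime-∣ˡ (n∣m*n 2) x₁y) coprime-1 (coprime-*ʳ {b = 2} {c = 16} y-2 y-16) xyq₂ form₂)
            where
            impossible : ¬ QuarticForm 32 1 x₂ y
            impossible (α , β , x≡ , y≡ , βα , γ , eq) = quartic₃₂-impossible {β} {α} {γ} (odd-root y≡ oy)
              (square≢0 x₂≢0 x≡) βα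
              (natural-combination (α ∷ β ∷ γ ∷ [])
                (λ { (α ∷ β ∷ γ ∷ []) → γ :* γ :+ # 11 :* (β :* β :* (α :* α)) ≈ fourth β :+ # 32 :* fourth α ⇐
                  (# 1 ⟨ γ :* γ :+ # 11 :* (α :* α :* (β :* β)) ≈ # 32 :* fourth α :+ # 1 :* fourth β ⟩) ∷ [] }) (eq , tt))

  -- For even y the substitution (x, y) ↦ (y/2, x) preserves the coefficients (8, 4), and the new
  -- second argument x is odd.
  sextic-coprime : ∀ {x y q n} → x ≢ 0 → y ≢ 0 → Coprime x y → Sextic 8 4 x y q n → x ≡ y ⊎ y ≡ 2 * x
  sextic-coprime {x} {y} {q} {n} x≢0 y≢0 xy h@(xyq , form) = by-parity (parity y)
    where
    by-parity : Parity y → x ≡ y ⊎ y ≡ 2 * x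
    by-parity (odd k y≡) = inj₁ (trans (proj₁ both) (sym (proj₂ both)))
      where
      both : x ≡ 1 × y ≡ 1
      both = sextic-odd {x} {y} {q} {n} x≢0 (k , y≡) xy h
    by-parity (even y₁ refl) = inj₂ (cong (2 *_) (from-half (halve-x 4 4 {y₁} {x} {q} {n}
        (trans (cong (_* q) (*-comm (2 * y₁) x)) xyq ,
         trans (cong (λ t → q + 11 * t) (*-comm (2 * y₁) x)) (trans form (+-comm (8 * (x * x)) _))))))
      where
      ox : Odd x
      ox = 2∤⇒odd λ 2∣x → contradiction (xy (2∣x , m∣m*n y₁)) λ ()
      from-half : (∃₂ λ q₁ n₁ → Sextic 8 4 y₁ x q₁ n₁) → y₁ ≡ x
      from-half (q₁ , n₁ , h₁) = trans (proj₁ both) (sym (proj₂ both))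
        where
        both : y₁ ≡ 1 × x ≡ 1
        both = sextic-odd {y₁} {x} {q₁} {n₁} (λ { refl → y≢0 refl }) ox (coprime-∣ˡ (n∣m*n 2) (Coprimality.sym xy)) h₁

  sextic-trivial : ∀ {x y q n} → x ≢ 0 → y ≢ 0 → Sextic 8 4 x y q n → x ≡ y ⊎ y ≡ 2 * x
  sextic-trivial {x} {y} {q} {n} x≢0 y≢0 (xyq , form) = from-coprime (reduce x y x≢0)
    where
    from-coprime : (∃ λ g → ∃₂ λ x′ y′ → g ≢ 0 × x ≡ x′ * g × y ≡ y′ * g × Coprime x′ y′) → x ≡ y ⊎ y ≡ 2 * x
    from-coprime (g , x′ , y′ , g≢0 , refl , refl , x′y′) = divide-q gg∣q
      where
      instance
        _ = ≢-nonZero g≢0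
        gg≢0 = m*n≢0 g g
        _ = m*n≢0 (g * g) (g * g)
      scaled : ∀ z w → z * g * (w * g) ≡ z * w * (g * g)
      scaled z w = [m*n]*[o*p]≡[m*o]*[n*p] z g w g
      gg∣ : ∀ z w → g * g ∣ z * g * (w * g)
      gg∣ z w = subst (g * g ∣_) (sym (scaled z w)) (n∣m*n (z * w))
      gg∣q : g * g ∣ q
      gg∣q = ∣-summandˡ q form (∣m∣n⇒∣m+n (∣n⇒∣m*n 8 (gg∣ x′ x′)) (∣n⇒∣m*n 4 (gg∣ y′ y′))) (∣n⇒∣m*n 11 (gg∣ x′ y′))
      divide-q : g * g ∣ q → x′ * g ≡ y′ * g ⊎ y′ * g ≡ 2 * (x′ * g)
      divide-q (divides q′ refl) = divide-n (square-∣⇒∣ {g * g} {n} (m*n≢0′ g≢0) (divides (x′ * y′ * q′) gggg))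
        where
        m*n≢0′ : ∀ {g} → g ≢ 0 → g * g ≢ 0
        m*n≢0′ g≢0 eq = g≢0 ([ id , id ]′ (m*n≡0⇒m≡0∨n≡0 _ eq))
        gggg : n * n ≡ x′ * y′ * q′ * (g * g * (g * g))
        gggg = natural-combination (x′ ∷ y′ ∷ q′ ∷ n ∷ g ∷ [])
          (λ { (x ∷ y ∷ q ∷ n ∷ g ∷ []) → n :* n ≈ x :* y :* q :* (g :* g :* (g :* g)) ⇐
            ((:- # 1) ⟨ x :* g :* (y :* g) :* (q :* (g :* g)) ≈ n :* n ⟩) ∷ [] }) (xyq , tt)
        divide-n : g * g ∣ n → x′ * g ≡ y′ * g ⊎ y′ * g ≡ 2 * (x′ * g)
        divide-n (divides n′ refl) = Sum.map (cong (_* g)) (λ h → trans (cong (_* g) h) (*-assoc 2 x′ g))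
          (sextic-coprime {x′} {y′} {q′} {n′} (λ { refl → x≢0 refl }) (λ { refl → y≢0 refl }) x′y′
            ( *-cancelʳ-≡ _ _ (g * g * (g * g)) (trans (sym gggg) (scaled-n n′))
            , *-cancelʳ-≡ _ _ (g * g) (natural-combination (x′ ∷ y′ ∷ q′ ∷ g ∷ [])
                (λ { (x ∷ y ∷ q ∷ g ∷ []) →
                  (q :+ # 11 :* (x :* y)) :* (g :* g) ≈ (# 8 :* (x :* x) :+ # 4 :* (y :* y)) :* (g :* g) ⇐
                  (# 1 ⟨ q :* (g :* g) :+ # 11 :* (x :* g :* (y :* g)) ≈
                         # 8 :* (x :* g :* (x :* g)) :+ # 4 :* (y :* g :* (y :* g)) ⟩) ∷ [] }) (form , tt))))
          where
          scaled-n : ∀ z → z * (g * g) * (z * (g * g)) ≡ z * z * (g * g * (g * g))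
          scaled-n z = [m*n]*[o*p]≡[m*o]*[n*p] z (g * g) z (g * g)

-- Quadratic points with integral coordinates.

module Integers where

  open Naturals using (sextic-trivial)
  open import Data.Integer
  open import Data.Integer.DivMod using (_/ℕ_; _%ℕ_; a≡a%ℕn+[a/ℕn]*n; n%ℕd<d)
  open Polynomials _+_ _*_ -_ +_
  private module E {n} = Polynomials (_:+_ {n}) _:*_ :-_ #_


  *-zero : ∀ {i j} → i * j ≡ 0ℤ → i ≡ 0ℤ ⊎ j ≡ 0ℤ
  *-zero {i} = ℤₚ.i*j≡0⇒i≡0∨j≡0 i

  *-cancel-zero : ∀ {i j} → i ≢ 0ℤ → i * j ≡ 0ℤ → j ≡ 0ℤ
  *-cancel-zero i≢0 eq with *-zero eq
  ... | inj₁ i≡0 = contradiction i≡0 i≢0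
  ... | inj₂ j≡0 = j≡0

  *-nonzero : ∀ {i j} → i ≢ 0ℤ → j ≢ 0ℤ → i * j ≢ 0ℤ
  *-nonzero i≢0 j≢0 eq = j≢0 (*-cancel-zero i≢0 eq)

  G-on-line : ∀ x₀ x₁ y₀ y₁ z α β → let open Line x₀ x₁ y₀ y₁ z in
    G (x₀ * α + x₁ * β) (y₀ * α + y₁ * β) (z * α) ≡
    c₃ * β * β * β + c₂ * β * β * α + c₁ * β * α * α + c₀ * α * α * α
  G-on-line x₀ x₁ y₀ y₁ z α β = linear-combination (x₀ ∷ x₁ ∷ y₀ ∷ y₁ ∷ z ∷ α ∷ β ∷ [])
    (λ { (x₀ ∷ x₁ ∷ y₀ ∷ y₁ ∷ z ∷ α ∷ β ∷ []) → let open E.Line x₀ x₁ y₀ y₁ z in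
      E.G (x₀ :* α :+ x₁ :* β) (y₀ :* α :+ y₁ :* β) (z :* α) ≈
      c₃ :* β :* β :* β :+ c₂ :* β :* β :* α :+ c₁ :* β :* α :* α :+ c₀ :* α :* α :* α ⇐ [] }) tt

  -- In g(t) + g(u) = -2 put g = ν/μ for each point: the components of ν μ′ + ν′ μ + 2 μ μ′ are
  -- those of G at (t + u : t u : 1), denominators cleared.
  G≡ννμμ : ∀ a b n c e m d →
    let open Pair a b n c e m d
        module T = Point a b n d
        module U = Point c e m d
    in
    G₀ ≡ T.ν₀ * U.μ₀ + d * T.ν₁ * U.μ₁ + U.ν₀ * T.μ₀ + d * U.ν₁ * T.μ₁ + + 2 * (T.μ₀ * U.μ₀ + d * T.μ₁ * U.μ₁) ×
    G₁ ≡ T.ν₀ * U.μ₁ + T.ν₁ * U.μ₀ + U.ν₀ * T.μ₁ + U.ν₁ * T.μ₀ + + 2 * (T.μ₀ * U.μ₁ + T.μ₁ * U.μ₀)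
  G≡ννμμ a b n c e m d =
    linear-combination (a ∷ b ∷ n ∷ c ∷ e ∷ m ∷ d ∷ [])
    (λ { (a ∷ b ∷ n ∷ c ∷ e ∷ m ∷ d ∷ []) →
      let open E.Pair a b n c e m d
          module T = E.Point a b n d
          module U = E.Point c e m d
      in
      G₀ ≈ T.ν₀ :* U.μ₀ :+ d :* T.ν₁ :* U.μ₁ :+ U.ν₀ :* T.μ₀ :+ d :* U.ν₁ :* T.μ₁ :+ # 2 :* (T.μ₀ :* U.μ₀ :+ d :* T.μ₁ :* U.μ₁) ⇐ [] }) tt ,
    linear-combination (a ∷ b ∷ n ∷ c ∷ e ∷ m ∷ d ∷ [])
    (λ { (a ∷ b ∷ n ∷ c ∷ e ∷ m ∷ d ∷ []) →
      let open E.Pair a b n c e m d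
          module T = E.Point a b n d
          module U = E.Point c e m d
      in
      G₁ ≈ T.ν₀ :* U.μ₁ :+ T.ν₁ :* U.μ₀ :+ U.ν₀ :* T.μ₁ :+ U.ν₁ :* T.μ₀ :+ # 2 :* (T.μ₀ :* U.μ₁ :+ T.μ₁ :* U.μ₀) ⇐ [] }) tt

  -- With g(x) = x + σx + σ²x one has x³ - 3x - 1 = x (x + 1) g(x); here the
  -- coordinates of 2 g(t) are expressed by the triple (n², N(t + 1), N(t)) of norms.
  ν≡μ*g : ∀ a b n d → let open Point a b n d ; E = e₃ (n * n) β α ; K = e₂ (n * n) β α ; A = alternant (n * n) β α in
    + 2 * E * ν₀ ≡ μ₀ * (A - + 3 * E) + d * μ₁ * (+ 2 * n * b * K) ×
    + 2 * E * ν₁ ≡ μ₀ * (+ 2 * n * b * K) + μ₁ * (A - + 3 * E)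
  ν≡μ*g a b n d =
    linear-combination (a ∷ b ∷ n ∷ d ∷ [])
    (λ { (a ∷ b ∷ n ∷ d ∷ []) → let open E.Point a b n d ; E = E.e₃ (n :* n) β α ; K = E.e₂ (n :* n) β α ; A = E.alternant (n :* n) β α in
      # 2 :* E :* ν₀ ≈ μ₀ :* (A :- # 3 :* E) :+ d :* μ₁ :* (# 2 :* n :* b :* K) ⇐ [] }) tt ,
    linear-combination (a ∷ b ∷ n ∷ d ∷ [])
    (λ { (a ∷ b ∷ n ∷ d ∷ []) → let open E.Point a b n d ; E = E.e₃ (n :* n) β α ; K = E.e₂ (n :* n) β α ; A = E.alternant (n :* n) β α in
      # 2 :* E :* ν₁ ≈ μ₀ :* (# 2 :* n :* b :* K) :+ μ₁ :* (A :- # 3 :* E) ⇐ [] }) tt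

  -- Here the triple is given and the number is rebuilt from it: t = (p + √heron)/(2u) has N(t) =
  -- w/u and N(t + 1) = v/u.
  ν≡μ*g′ : ∀ p u v w → let n = + 2 * u in p ≡ v - w - u → let open Point p 1ℤ n (heron u v w) in
    + 2 * e₃ u v w * ν₀ ≡ μ₀ * (alternant u v w - + 3 * e₃ u v w) + heron u v w * μ₁ * e₂ u v w ×
    + 2 * e₃ u v w * ν₁ ≡ μ₀ * e₂ u v w + μ₁ * (alternant u v w - + 3 * e₃ u v w)
  ν≡μ*g′ p u v w refl =
    linear-combination (u ∷ v ∷ w ∷ [])
    (λ { (u ∷ v ∷ w ∷ []) → let open E.Point (v :- w :- u) (con 1ℤ) (# 2 :* u) (E.heron u v w) in
      # 2 :* E.e₃ u v w :* ν₀ ≈ μ₀ :* (E.alternant u v w :- # 3 :* E.e₃ u v w) :+ E.heron u v w :* μ₁ :* E.e₂ u v w ⇐ [] }) tt ,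
    linear-combination (u ∷ v ∷ w ∷ [])
    (λ { (u ∷ v ∷ w ∷ []) → let open E.Point (v :- w :- u) (con 1ℤ) (# 2 :* u) (E.heron u v w) in
      # 2 :* E.e₃ u v w :* ν₁ ≈ μ₀ :* E.e₂ u v w :+ μ₁ :* (E.alternant u v w :- # 3 :* E.e₃ u v w) ⇐ [] }) tt

  ν≡μ*ḡ : ∀ q u v w → let n = + 2 * u in q ≡ v - w - u → let open Point q -1ℤ n (heron u v w) in
    + 2 * e₃ u v w * ν₀ ≡ μ₀ * (alternant u v w - + 3 * e₃ u v w) + heron u v w * μ₁ * - e₂ u v w ×
    + 2 * e₃ u v w * ν₁ ≡ μ₀ * - e₂ u v w + μ₁ * (alternant u v w - + 3 * e₃ u v w)
  ν≡μ*ḡ q u v w refl =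
    linear-combination (u ∷ v ∷ w ∷ [])
    (λ { (u ∷ v ∷ w ∷ []) → let open E.Point (v :- w :- u) (con -1ℤ) (# 2 :* u) (E.heron u v w) in
      # 2 :* E.e₃ u v w :* ν₀ ≈ μ₀ :* (E.alternant u v w :- # 3 :* E.e₃ u v w) :+ E.heron u v w :* μ₁ :* (:- E.e₂ u v w) ⇐ [] }) tt ,
    linear-combination (u ∷ v ∷ w ∷ [])
    (λ { (u ∷ v ∷ w ∷ []) → let open E.Point (v :- w :- u) (con -1ℤ) (# 2 :* u) (E.heron u v w) in
      # 2 :* E.e₃ u v w :* ν₁ ≈ μ₀ :* (:- E.e₂ u v w) :+ μ₁ :* (E.alternant u v w :- # 3 :* E.e₃ u v w) ⇐ [] }) tt

  -- That is, 2 E E′ G = μ μ′ (κ₀ + κ₁√d).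
  factorisation : ∀ ν₀ ν₁ μ₀ μ₁ E A K ν₀′ ν₁′ μ₀′ μ₁′ E′ A′ K′ d →
    + 2 * E * ν₀ ≡ μ₀ * (A - + 3 * E) + d * μ₁ * K →
    + 2 * E * ν₁ ≡ μ₀ * K + μ₁ * (A - + 3 * E) →
    + 2 * E′ * ν₀′ ≡ μ₀′ * (A′ - + 3 * E′) + d * μ₁′ * K′ →
    + 2 * E′ * ν₁′ ≡ μ₀′ * K′ + μ₁′ * (A′ - + 3 * E′) →
    let κ₀ = A * E′ + A′ * E - + 2 * E * E′
        κ₁ = K * E′ + K′ * E
        λ₀ = μ₀′ * κ₀ + d * (μ₁′ * κ₁)
        λ₁ = μ₀′ * κ₁ + μ₁′ * κ₀ in
    + 2 * (E * E′) * (ν₀ * μ₀′ + d * ν₁ * μ₁′ + ν₀′ * μ₀ + d * ν₁′ * μ₁ + + 2 * (μ₀ * μ₀′ + d * μ₁ * μ₁′))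
      ≡ μ₀ * λ₀ + d * (μ₁ * λ₁) ×
    + 2 * (E * E′) * (ν₀ * μ₁′ + ν₁ * μ₀′ + ν₀′ * μ₁ + ν₁′ * μ₀ + + 2 * (μ₀ * μ₁′ + μ₁ * μ₀′))
      ≡ μ₀ * λ₁ + μ₁ * λ₀
  factorisation ν₀ ν₁ μ₀ μ₁ E A K ν₀′ ν₁′ μ₀′ μ₁′ E′ A′ K′ d h₀ h₁ h₀′ h₁′ =
    linear-combination (ν₀ ∷ ν₁ ∷ μ₀ ∷ μ₁ ∷ E ∷ A ∷ K ∷ ν₀′ ∷ ν₁′ ∷ μ₀′ ∷ μ₁′ ∷ E′ ∷ A′ ∷ K′ ∷ d ∷ [])
    (λ { (ν₀ ∷ ν₁ ∷ μ₀ ∷ μ₁ ∷ E ∷ A ∷ K ∷ ν₀′ ∷ ν₁′ ∷ μ₀′ ∷ μ₁′ ∷ E′ ∷ A′ ∷ K′ ∷ d ∷ []) →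
      let κ₀ = A :* E′ :+ A′ :* E :- # 2 :* E :* E′
          κ₁ = K :* E′ :+ K′ :* E
          λ₀ = μ₀′ :* κ₀ :+ d :* (μ₁′ :* κ₁)
          λ₁ = μ₀′ :* κ₁ :+ μ₁′ :* κ₀ in
      # 2 :* (E :* E′) :* (ν₀ :* μ₀′ :+ d :* ν₁ :* μ₁′ :+ ν₀′ :* μ₀ :+ d :* ν₁′ :* μ₁ :+ # 2 :* (μ₀ :* μ₀′ :+ d :* μ₁ :* μ₁′))
        ≈ μ₀ :* λ₀ :+ d :* (μ₁ :* λ₁) ⇐
        ((E′ :* μ₀′) ⟨ # 2 :* E :* ν₀ ≈ μ₀ :* (A :- # 3 :* E) :+ d :* μ₁ :* K ⟩) ∷
        ((E′ :* d :* μ₁′) ⟨ # 2 :* E :* ν₁ ≈ μ₀ :* K :+ μ₁ :* (A :- # 3 :* E) ⟩) ∷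
        ((E :* μ₀) ⟨ # 2 :* E′ :* ν₀′ ≈ μ₀′ :* (A′ :- # 3 :* E′) :+ d :* μ₁′ :* K′ ⟩) ∷
        ((E :* d :* μ₁) ⟨ # 2 :* E′ :* ν₁′ ≈ μ₀′ :* K′ :+ μ₁′ :* (A′ :- # 3 :* E′) ⟩) ∷ [] }) (h₀ , h₁ , h₀′ , h₁′ , tt) ,
    linear-combination (ν₀ ∷ ν₁ ∷ μ₀ ∷ μ₁ ∷ E ∷ A ∷ K ∷ ν₀′ ∷ ν₁′ ∷ μ₀′ ∷ μ₁′ ∷ E′ ∷ A′ ∷ K′ ∷ d ∷ [])
    (λ { (ν₀ ∷ ν₁ ∷ μ₀ ∷ μ₁ ∷ E ∷ A ∷ K ∷ ν₀′ ∷ ν₁′ ∷ μ₀′ ∷ μ₁′ ∷ E′ ∷ A′ ∷ K′ ∷ d ∷ []) →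
      let κ₀ = A :* E′ :+ A′ :* E :- # 2 :* E :* E′
          κ₁ = K :* E′ :+ K′ :* E
          λ₀ = μ₀′ :* κ₀ :+ d :* (μ₁′ :* κ₁)
          λ₁ = μ₀′ :* κ₁ :+ μ₁′ :* κ₀ in
      # 2 :* (E :* E′) :* (ν₀ :* μ₁′ :+ ν₁ :* μ₀′ :+ ν₀′ :* μ₁ :+ ν₁′ :* μ₀ :+ # 2 :* (μ₀ :* μ₁′ :+ μ₁ :* μ₀′))
        ≈ μ₀ :* λ₁ :+ μ₁ :* λ₀ ⇐
        ((E′ :* μ₁′) ⟨ # 2 :* E :* ν₀ ≈ μ₀ :* (A :- # 3 :* E) :+ d :* μ₁ :* K ⟩) ∷
        ((E′ :* μ₀′) ⟨ # 2 :* E :* ν₁ ≈ μ₀ :* K :+ μ₁ :* (A :- # 3 :* E) ⟩) ∷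
        ((E :* μ₁) ⟨ # 2 :* E′ :* ν₀′ ≈ μ₀′ :* (A′ :- # 3 :* E′) :+ d :* μ₁′ :* K′ ⟩) ∷
        ((E :* μ₀) ⟨ # 2 :* E′ :* ν₁′ ≈ μ₀′ :* K′ :+ μ₁′ :* (A′ :- # 3 :* E′) ⟩) ∷ [] }) (h₀ , h₁ , h₀′ , h₁′ , tt)

  -- Orbits under σ as triples of norms.

  record Triple : Set where
    constructor ⟨_,_,_⟩
    field
      u₀ u₁ u₂ : ℤ

  rotate : Triple → Triple
  rotate ⟨ x , y , z ⟩ = ⟨ y , z , x ⟩

  -- For t = (p + w)/u₀ irrational with w² = D ∈ ℚ, and u = (q - w)/v₀, the conjugates σⁱt
  -- and σʲu have irrational parts w/uᵢ and -w/vⱼ.  The triples are homogeneous, and determine t and u.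
  record Configuration (U V : Triple) : Set where
    open Triple U
    open Triple V renaming (u₀ to v₀; u₁ to v₁; u₂ to v₂)
    field
      e₃U≢0       : e₃ u₀ u₁ u₂ ≢ 0ℤ
      e₃V≢0       : e₃ v₀ v₁ v₂ ≢ 0ℤ
      irrational  : e₂ u₀ u₁ u₂ * e₃ v₀ v₁ v₂ ≡ e₂ v₀ v₁ v₂ * e₃ u₀ u₁ u₂
      rational    : alternant u₀ u₁ u₂ * e₃ v₀ v₁ v₂ + alternant v₀ v₁ v₂ * e₃ u₀ u₁ u₂ ≡
                    + 2 * (e₃ u₀ u₁ u₂ * e₃ v₀ v₁ v₂)
      heron-equal : heron u₀ u₁ u₂ ≡ heron v₀ v₁ v₂

  swap : ∀ {U V} → Configuration U V → Configuration V U
  swap {⟨ u₀ , u₁ , u₂ ⟩} {⟨ v₀ , v₁ , v₂ ⟩} C = record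
    { e₃U≢0 = e₃V≢0
    ; e₃V≢0 = e₃U≢0
    ; irrational = sym irrational
    ; rational = trans (ℤₚ.+-comm (alternant v₀ v₁ v₂ * e₃ u₀ u₁ u₂) _)
                       (trans rational (cong (+ 2 *_) (ℤₚ.*-comm (e₃ u₀ u₁ u₂) _)))
    ; heron-equal = sym heron-equal
    }
    where open Configuration C

  -- This is σ acting on u alone: every condition is cyclic in each triple separately.
  rotateʳ : ∀ {U V} → Configuration U V → Configuration U (rotate V)
  rotateʳ {⟨ u₀ , u₁ , u₂ ⟩} {⟨ v₀ , v₁ , v₂ ⟩} C = record
    { e₃U≢0 = e₃U≢0
    ; e₃V≢0 = e₃V≢0 ∘ trans e₃-rotate
    ; irrational = subst₂ (λ k e → e₂ u₀ u₁ u₂ * e ≡ k * e₃ u₀ u₁ u₂) e₂-rotate e₃-rotate irrational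
    ; rational = subst₂ (λ a e → alternant u₀ u₁ u₂ * e + a * e₃ u₀ u₁ u₂ ≡ + 2 * (e₃ u₀ u₁ u₂ * e))
                   alternant-rotate e₃-rotate rational
    ; heron-equal = trans heron-equal heron-rotate
    }
    where
    open Configuration C
    e₂-rotate : e₂ v₀ v₁ v₂ ≡ e₂ v₁ v₂ v₀
    e₂-rotate = linear-combination (v₀ ∷ v₁ ∷ v₂ ∷ [])
      (λ { (v₀ ∷ v₁ ∷ v₂ ∷ []) → E.e₂ v₀ v₁ v₂ ≈ E.e₂ v₁ v₂ v₀ ⇐ [] }) tt
    e₃-rotate : e₃ v₀ v₁ v₂ ≡ e₃ v₁ v₂ v₀
    e₃-rotate = linear-combination (v₀ ∷ v₁ ∷ v₂ ∷ [])
      (λ { (v₀ ∷ v₁ ∷ v₂ ∷ []) → E.e₃ v₀ v₁ v₂ ≈ E.e₃ v₁ v₂ v₀ ⇐ [] }) tt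
    alternant-rotate : alternant v₀ v₁ v₂ ≡ alternant v₁ v₂ v₀
    alternant-rotate = linear-combination (v₀ ∷ v₁ ∷ v₂ ∷ [])
      (λ { (v₀ ∷ v₁ ∷ v₂ ∷ []) → E.alternant v₀ v₁ v₂ ≈ E.alternant v₁ v₂ v₀ ⇐ [] }) tt
    heron-rotate : heron v₀ v₁ v₂ ≡ heron v₁ v₂ v₀
    heron-rotate = linear-combination (v₀ ∷ v₁ ∷ v₂ ∷ [])
      (λ { (v₀ ∷ v₁ ∷ v₂ ∷ []) → E.heron v₀ v₁ v₂ ≈ E.heron v₁ v₂ v₀ ⇐ [] }) tt

  rotateˡ : ∀ {U V} → Configuration U V → Configuration (rotate U) V
  rotateˡ = swap ∘ rotateʳ ∘ swap

  zero-product : ∀ μ₀ μ₁ μ₀′ μ₁′ κ₀ κ₁ d → κ₀ ≡ 0ℤ → κ₁ ≡ 0ℤ →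
    let λ₀ = μ₀′ * κ₀ + d * (μ₁′ * κ₁)
        λ₁ = μ₀′ * κ₁ + μ₁′ * κ₀ in
    μ₀ * λ₀ + d * (μ₁ * λ₁) ≡ 0ℤ × μ₀ * λ₁ + μ₁ * λ₀ ≡ 0ℤ
  zero-product μ₀ μ₁ μ₀′ μ₁′ κ₀ κ₁ d refl refl =
    linear-combination (μ₀ ∷ μ₁ ∷ μ₀′ ∷ μ₁′ ∷ d ∷ [])
      (λ { (μ₀ ∷ μ₁ ∷ μ₀′ ∷ μ₁′ ∷ d ∷ []) →
        μ₀ :* (μ₀′ :* # 0 :+ d :* (μ₁′ :* # 0)) :+ d :* (μ₁ :* (μ₀′ :* # 0 :+ μ₁′ :* # 0)) ≈ # 0 ⇐ [] }) tt ,
    linear-combination (μ₀ ∷ μ₁ ∷ μ₀′ ∷ μ₁′ ∷ d ∷ [])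
      (λ { (μ₀ ∷ μ₁ ∷ μ₀′ ∷ μ₁′ ∷ d ∷ []) →
        μ₀ :* (μ₀′ :* # 0 :+ μ₁′ :* # 0) :+ μ₁ :* (μ₀′ :* # 0 :+ d :* (μ₁′ :* # 0)) ≈ # 0 ⇐ [] }) tt

  rational-zero : ∀ A E′ A′ E → A * E′ + A′ * E ≡ + 2 * (E * E′) → A * E′ + A′ * E - + 2 * E * E′ ≡ 0ℤ
  rational-zero A E′ A′ E h = linear-combination (A ∷ E′ ∷ A′ ∷ E ∷ [])
    (λ { (A ∷ E′ ∷ A′ ∷ E ∷ []) → A :* E′ :+ A′ :* E :- # 2 :* E :* E′ ≈ # 0 ⇐
      (# 1 ⟨ A :* E′ :+ A′ :* E ≈ # 2 :* (E :* E′) ⟩) ∷ [] }) (h , tt)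

  irrational-zero : ∀ K E′ K′ E → K * E′ ≡ K′ * E → K * E′ + - K′ * E ≡ 0ℤ
  irrational-zero K E′ K′ E h = linear-combination (K ∷ E′ ∷ K′ ∷ E ∷ [])
    (λ { (K ∷ E′ ∷ K′ ∷ E ∷ []) → K :* E′ :+ :- K′ :* E ≈ # 0 ⇐ (# 1 ⟨ K :* E′ ≈ K′ :* E ⟩) ∷ [] }) (h , tt)

  -- `rational` and `irrational` are the two components of g(t) + g(u) = -2. Applied to rotated
  -- configurations, this puts all pairs (σⁱt, σʲu) on the curve.
  configuration⇒point : ∀ {u₀ u₁ u₂ v₀ v₁ v₂} → Configuration ⟨ u₀ , u₁ , u₂ ⟩ ⟨ v₀ , v₁ , v₂ ⟩ →
    let open Pair (u₁ - u₂ - u₀) 1ℤ (+ 2 * u₀) (v₁ - v₂ - v₀) -1ℤ (+ 2 * v₀) (heron u₀ u₁ u₂) in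
    G₀ ≡ 0ℤ × G₁ ≡ 0ℤ
  configuration⇒point {u₀} {u₁} {u₂} {v₀} {v₁} {v₂} C =
    *-cancel-zero {+ 2 * (e₃ u₀ u₁ u₂ * e₃ v₀ v₁ v₂)} E≢0 (trans (cong (+ 2 * (e₃ u₀ u₁ u₂ * e₃ v₀ v₁ v₂) *_) (proj₁ G≡)) (trans (proj₁ factors) (proj₁ vanishing))) ,
    *-cancel-zero {+ 2 * (e₃ u₀ u₁ u₂ * e₃ v₀ v₁ v₂)} E≢0 (trans (cong (+ 2 * (e₃ u₀ u₁ u₂ * e₃ v₀ v₁ v₂) *_) (proj₂ G≡)) (trans (proj₂ factors) (proj₂ vanishing)))
    where
    open Configuration C
    d p q : ℤ
    d = heron u₀ u₁ u₂
    p = u₁ - u₂ - u₀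
    q = v₁ - v₂ - v₀
    module T = Point p 1ℤ (+ 2 * u₀) d
    module U = Point q -1ℤ (+ 2 * v₀) d
    E≢0 : + 2 * (e₃ u₀ u₁ u₂ * e₃ v₀ v₁ v₂) ≢ 0ℤ
    E≢0 = *-nonzero {+ 2} (λ ()) (*-nonzero {e₃ u₀ u₁ u₂} e₃U≢0 e₃V≢0)
    G≡ = G≡ννμμ p 1ℤ (+ 2 * u₀) q -1ℤ (+ 2 * v₀) d
    gT = ν≡μ*g′ p u₀ u₁ u₂ refl
    gU : + 2 * e₃ v₀ v₁ v₂ * U.ν₀ ≡ U.μ₀ * (alternant v₀ v₁ v₂ - + 3 * e₃ v₀ v₁ v₂) + d * U.μ₁ * - e₂ v₀ v₁ v₂ ×
         + 2 * e₃ v₀ v₁ v₂ * U.ν₁ ≡ U.μ₀ * - e₂ v₀ v₁ v₂ + U.μ₁ * (alternant v₀ v₁ v₂ - + 3 * e₃ v₀ v₁ v₂)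
    gU = subst (λ d → let open Point q -1ℤ (+ 2 * v₀) d in
           + 2 * e₃ v₀ v₁ v₂ * ν₀ ≡ μ₀ * (alternant v₀ v₁ v₂ - + 3 * e₃ v₀ v₁ v₂) + d * μ₁ * - e₂ v₀ v₁ v₂ ×
           + 2 * e₃ v₀ v₁ v₂ * ν₁ ≡ μ₀ * - e₂ v₀ v₁ v₂ + μ₁ * (alternant v₀ v₁ v₂ - + 3 * e₃ v₀ v₁ v₂))
         (sym heron-equal) (ν≡μ*ḡ q v₀ v₁ v₂ refl)
    factors = factorisation T.ν₀ T.ν₁ T.μ₀ T.μ₁ (e₃ u₀ u₁ u₂) (alternant u₀ u₁ u₂) (e₂ u₀ u₁ u₂)
                            U.ν₀ U.ν₁ U.μ₀ U.μ₁ (e₃ v₀ v₁ v₂) (alternant v₀ v₁ v₂) (- e₂ v₀ v₁ v₂) d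
                            (proj₁ gT) (proj₂ gT) (proj₁ gU) (proj₂ gU)
    vanishing = zero-product T.μ₀ T.μ₁ U.μ₀ U.μ₁ _ _ d
      (rational-zero (alternant u₀ u₁ u₂) (e₃ v₀ v₁ v₂) (alternant v₀ v₁ v₂) (e₃ u₀ u₁ u₂) rational)
      (irrational-zero (e₂ u₀ u₁ u₂) (e₃ v₀ v₁ v₂) (e₂ v₀ v₁ v₂) (e₃ u₀ u₁ u₂) irrational)

  -- Rational points of the cubic, and lines through conjugate points.

  square≡+ : ∀ i → i * i ≡ + (∣ i ∣ ℕ.* ∣ i ∣)
  square≡+ (+ n)    = sym (ℤₚ.pos-* n n)
  square≡+ -[1+ n ] = refl

  multiple-nonnegative : ∀ k {i m} → + ℕ.suc k * i ≡ + m → ∃ λ q → i ≡ + q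
  multiple-nonnegative k {+ q} _ = q , refl

  pos-combination : ∀ k m l n → + (k ℕ.* m ℕ.+ l ℕ.* n) ≡ + k * + m + + l * + n
  pos-combination k m l n = trans (ℤₚ.pos-+ (k ℕ.* m) (l ℕ.* n)) (cong₂ _+_ (ℤₚ.pos-* k m) (ℤₚ.pos-* l n))

  -- Solving G for y, the discriminant is a b (8 a² - 11 a b + 4 b²) with a = x + z, b = x + 2z.
  elliptic : ∀ x y z → z ≢ 0ℤ → G x y z ≡ 0ℤ →
    (x ≡ 0ℤ × y ≡ 0ℤ) ⊎ (x + z ≡ 0ℤ × y ≡ 0ℤ) ⊎ (x + + 2 * z ≡ 0ℤ × y ≡ z)
  elliptic x y z z≢0 h = by-cases (a ≟ 0ℤ) (b ≟ 0ℤ)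
    where
    a b q n : ℤ
    a = x + z
    b = x + + 2 * z
    q = + 8 * (a * a) - + 11 * (a * b) + + 4 * (b * b)
    n = + 2 * x * y + x * x - x * z - + 2 * z * z
    ρ : Vec ℤ 3
    ρ = x ∷ y ∷ z ∷ []
    Goal : Set
    Goal = (x ≡ 0ℤ × y ≡ 0ℤ) ⊎ (a ≡ 0ℤ × y ≡ 0ℤ) ⊎ (b ≡ 0ℤ × y ≡ z)
    square-zero : ∀ {i} → i * i ≡ 0ℤ → i ≡ 0ℤ
    square-zero {i} eq = [ id , id ]′ (*-zero {i} eq)
    at-a : a ≡ 0ℤ → y ≡ 0ℤ
    at-a a≡0 = square-zero (*-cancel-zero z≢0 (linear-combination ρ
      (λ { (x ∷ y ∷ z ∷ []) → z :* (y :* y) ≈ # 0 ⇐ ((:- # 1) ⟨ E.G x y z ≈ # 0 ⟩) ∷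
        ((y :* y :+ (x :- # 2 :* z) :* y :- x :* z) ⟨ x :+ z ≈ # 0 ⟩) ∷ [] }) (h , a≡0 , tt)))
    at-b : b ≡ 0ℤ → y ≡ z
    at-b b≡0 = ℤₚ.i-j≡0⇒i≡j y z (square-zero (*-cancel-zero (*-nonzero {+ 2} (λ ()) z≢0) (linear-combination ρ
      (λ { (x ∷ y ∷ z ∷ []) → # 2 :* z :* ((y :- z) :* (y :- z)) ≈ # 0 ⇐ ((:- # 1) ⟨ E.G x y z ≈ # 0 ⟩) ∷
        ((y :* y :+ (x :- # 3 :* z) :* y :- z :* (x :- z)) ⟨ x :+ # 2 :* z ≈ # 0 ⟩) ∷ [] }) (h , b≡0 , tt))))
    discriminant : a * b * q ≡ n * n
    discriminant = linear-combination ρ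
      (λ { (x ∷ y ∷ z ∷ []) → let a = x :+ z ; b = x :+ # 2 :* z in
        a :* b :* (# 8 :* (a :* a) :- # 11 :* (a :* b) :+ # 4 :* (b :* b)) ≈
        (# 2 :* x :* y :+ x :* x :- x :* z :- # 2 :* z :* z) :* (# 2 :* x :* y :+ x :* x :- x :* z :- # 2 :* z :* z) ⇐
        ((:- (# 4 :* x)) ⟨ E.G x y z ≈ # 0 ⟩) ∷ [] }) (h , tt)
    by-cases : _ → _ → Goal
    by-cases (yes a≡0) _         = inj₂ (inj₁ (a≡0 , at-a a≡0))
    by-cases (no _)    (yes b≡0) = inj₂ (inj₂ (b≡0 , at-b b≡0))
    by-cases (no a≢0)  (no b≢0)  = from-q (multiple-nonnegative 31 32q)
      where
      a′ b′ n′ c′ : ℕ.ℕ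
      a′ = ∣ a ∣
      b′ = ∣ b ∣
      n′ = ∣ n ∣
      c′ = ∣ + 16 * a - + 11 * b ∣
      a′≢0 : a′ ≢ 0
      a′≢0 = a≢0 ∘ ℤₚ.∣i∣≡0⇒i≡0
      b′≢0 : b′ ≢ 0
      b′≢0 = b≢0 ∘ ℤₚ.∣i∣≡0⇒i≡0
      -- The form q is positive definite. As a b q is a square, a and b have the same sign, and the
      -- statement about natural numbers applies to their absolute values.
      32q : + 32 * q ≡ + (1 ℕ.* (c′ ℕ.* c′) ℕ.+ 7 ℕ.* (b′ ℕ.* b′))
      32q = trans (complete-square a b) (sym (trans (pos-combination 1 (c′ ℕ.* c′) 7 (b′ ℕ.* b′))
              (cong₂ (λ i j → 1ℤ * i + + 7 * j) (sym (square≡+ (+ 16 * a - + 11 * b))) (sym (square≡+ b)))))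
        where
        complete-square : ∀ a b → + 32 * (+ 8 * (a * a) - + 11 * (a * b) + + 4 * (b * b)) ≡
          1ℤ * ((+ 16 * a - + 11 * b) * (+ 16 * a - + 11 * b)) + + 7 * (b * b)
        complete-square a b = linear-combination (a ∷ b ∷ [])
          (λ { (a ∷ b ∷ []) → # 32 :* (# 8 :* (a :* a) :- # 11 :* (a :* b) :+ # 4 :* (b :* b)) ≈
            con 1ℤ :* ((# 16 :* a :- # 11 :* b) :* (# 16 :* a :- # 11 :* b)) :+ # 7 :* (b :* b) ⇐ [] }) tt
      from-q : (∃ λ q′ → q ≡ + q′) → Goal
      from-q (q′ , q≡) = from-product (a * b) refl
        where
        q′≢0 : q′ ≢ 0
        q′≢0 refl = *-nonzero {+ 7} (λ ()) (*-nonzero {b} b≢0 b≢0) (trans (cong (+ 7 *_) (square≡+ b))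
          (trans (sym (ℤₚ.pos-* 7 (b′ ℕ.* b′))) (cong +_ (ℕₚ.m+n≡0⇒n≡0 (1 ℕ.* (c′ ℕ.* c′))
            (ℤₚ.+-injective (trans (sym 32q) (cong (+ 32 *_) q≡)))))))
        from-product : ∀ p → p ≡ a * b → Goal
        from-product -[1+ p ] p≡ = ⊥-elim (sign-clash q′ q′≢0 (trans (cong₂ _*_ p≡ (sym q≡)) (trans discriminant (square≡+ n))))
          where
          sign-clash : ∀ q′ → q′ ≢ 0 → -[1+ p ] * + q′ ≢ + (n′ ℕ.* n′)
          sign-clash ℕ.zero    q′≢0 _ = q′≢0 refl
          sign-clash (ℕ.suc _) _    ()
        from-product (+ p) p≡ = conclude (sextic-trivial {a′} {b′} {q′} {n′} a′≢0 b′≢0 (product , form))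
          where
          p≡a′b′ : p ≡ a′ ℕ.* b′
          p≡a′b′ = trans (cong ∣_∣ p≡) (ℤₚ.abs-* a b)
          ab≡ : a * b ≡ + (a′ ℕ.* b′)
          ab≡ = trans (sym p≡) (cong +_ p≡a′b′)
          product : a′ ℕ.* b′ ℕ.* q′ ≡ n′ ℕ.* n′
          product = ℤₚ.+-injective (trans (ℤₚ.pos-* (a′ ℕ.* b′) q′)
            (trans (cong₂ _*_ (sym ab≡) (sym q≡)) (trans discriminant (square≡+ n))))
          form : q′ ℕ.+ 11 ℕ.* (a′ ℕ.* b′) ≡ 8 ℕ.* (a′ ℕ.* a′) ℕ.+ 4 ℕ.* (b′ ℕ.* b′)
          form = ℤₚ.+-injective (trans (ℤₚ.pos-+ q′ (11 ℕ.* (a′ ℕ.* b′))) (trans (cong₂ _+_ (sym q≡)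
                  (trans (ℤₚ.pos-* 11 (a′ ℕ.* b′)) (cong (+ 11 *_) (sym ab≡))))
                (trans (cancel (+ 8 * (a * a)) (+ 11 * (a * b)) (+ 4 * (b * b))) (sym (trans (pos-combination 8 (a′ ℕ.* a′) 4 (b′ ℕ.* b′))
                  (cong₂ (λ i j → + 8 * i + + 4 * j) (sym (square≡+ a)) (sym (square≡+ b))))))))
            where
            cancel : ∀ i j k → i - j + k + j ≡ i + k
            cancel i j k = linear-combination (i ∷ j ∷ k ∷ []) (λ { (i ∷ j ∷ k ∷ []) → i :- j :+ k :+ j ≈ i :+ k ⇐ [] }) tt
          conclude : a′ ≡ b′ ⊎ b′ ≡ 2 ℕ.* a′ → Goal
          conclude (inj₁ a′≡b′) = ⊥-elim (z≢0 (linear-combination ρ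
            (λ { (x ∷ y ∷ z ∷ []) → z ≈ # 0 ⇐ ((:- # 1) ⟨ x :+ z ≈ x :+ # 2 :* z ⟩) ∷ [] }) (a≡b , tt)))
            where
            a≡b : a ≡ b
            a≡b = ℤₚ.i-j≡0⇒i≡j a b (*-cancel-zero a≢0 (factor a b
              (trans (square≡+ a) (trans (cong (λ t → + (a′ ℕ.* t)) a′≡b′) (sym ab≡)))))
              where
              factor : ∀ a b → a * a ≡ a * b → a * (a - b) ≡ 0ℤ
              factor a b h = linear-combination (a ∷ b ∷ [])
                (λ { (a ∷ b ∷ []) → a :* (a :- b) ≈ # 0 ⇐ (# 1 ⟨ a :* a ≈ a :* b ⟩) ∷ [] }) (h , tt)
          conclude (inj₂ b′≡2a′) = inj₁ (x≡0 , y≡0)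
            where
            b-2a : b - + 2 * a ≡ 0ℤ
            b-2a = *-cancel-zero a≢0 (factor-2 a b (trans ab′ (cong (+ 2 *_) (sym (square≡+ a)))))
              where
              factor-2 : ∀ a b → a * b ≡ + 2 * (a * a) → a * (b - + 2 * a) ≡ 0ℤ
              factor-2 a b h = linear-combination (a ∷ b ∷ [])
                (λ { (a ∷ b ∷ []) → a :* (b :- # 2 :* a) ≈ # 0 ⇐ (# 1 ⟨ a :* b ≈ # 2 :* (a :* a) ⟩) ∷ [] }) (h , tt)
              ab′ : a * b ≡ + 2 * + (a′ ℕ.* a′)
              ab′ = trans ab≡ (trans (cong +_ (trans (cong (a′ ℕ.*_) b′≡2a′) (ℕ-swap a′))) (ℤₚ.pos-* 2 (a′ ℕ.* a′)))
                where
                ℕ-swap : ∀ m → m ℕ.* (2 ℕ.* m) ≡ 2 ℕ.* (m ℕ.* m)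
                ℕ-swap m = trans (sym (ℕₚ.*-assoc m 2 m)) (trans (cong (ℕ._* m) (ℕₚ.*-comm m 2)) (ℕₚ.*-assoc 2 m m))
            x≡0 : x ≡ 0ℤ
            x≡0 = linear-combination ρ (λ { (x ∷ y ∷ z ∷ []) → x ≈ # 0 ⇐
              ((:- # 1) ⟨ (x :+ # 2 :* z) :- # 2 :* (x :+ z) ≈ # 0 ⟩) ∷ [] }) (b-2a , tt)
            y≡0 : y ≡ 0ℤ
            y≡0 = *-cancel-zero (*-nonzero {+ 2} (λ ()) (*-nonzero {z} z≢0 z≢0)) (linear-combination ρ
              (λ { (x ∷ y ∷ z ∷ []) → # 2 :* (z :* z) :* y ≈ # 0 ⇐ ((:- # 1) ⟨ E.G x y z ≈ # 0 ⟩) ∷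
                ((y :* y :+ (x :- z) :* y :- x :* z :- z :* z) ⟨ x ≈ # 0 ⟩) ∷ [] }) (h , x≡0 , tt))

  -- The possible lines through a point of the elliptic curve and its conjugate: the third
  -- point of the curve on such a line is one of three points at infinity or three finite ones.
  data RationalLine (x₀ x₁ y₀ y₁ z : ℤ) : Set where
    infinity-x  : y₁ ≡ 0ℤ → RationalLine x₀ x₁ y₀ y₁ z
    infinity-y  : x₁ ≡ 0ℤ → RationalLine x₀ x₁ y₀ y₁ z
    infinity-xy : x₁ + y₁ ≡ 0ℤ → RationalLine x₀ x₁ y₀ y₁ z
    finite₀     : x₀ * y₁ ≡ x₁ * y₀ → RationalLine x₀ x₁ y₀ y₁ z
    finite₁     : (x₀ + z) * y₁ ≡ x₁ * y₀ → RationalLine x₀ x₁ y₀ y₁ z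
    finite₂     : (x₀ + + 2 * z) * y₁ ≡ x₁ * (y₀ - z) → RationalLine x₀ x₁ y₀ y₁ z

  -- The hypotheses say that T = √d, and with it T = -√d, gives a point of the cubic. As c₃ = G x₁
  -- y₁ 0, the third point is the one at infinity on the line exactly when c₃ = 0.
  rational-line : ∀ x₀ x₁ y₀ y₁ z d → z ≢ 0ℤ → let open Line x₀ x₁ y₀ y₁ z in
    c₀ + d * c₂ ≡ 0ℤ → c₁ + d * c₃ ≡ 0ℤ → RationalLine x₀ x₁ y₀ y₁ z
  rational-line x₀ x₁ y₀ y₁ z d z≢0 h₀ h₁ with c₃ ≟ 0ℤ
    where open Line x₀ x₁ y₀ y₁ z
  ... | yes c₃≡0 = at-infinity (*-zero {x₁ * y₁} c₃≡0)
    where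
    at-infinity : x₁ * y₁ ≡ 0ℤ ⊎ x₁ + y₁ ≡ 0ℤ → RationalLine x₀ x₁ y₀ y₁ z
    at-infinity (inj₁ eq) = [ infinity-y , infinity-x ]′ (*-zero {x₁} eq)
    at-infinity (inj₂ eq) = infinity-xy eq
  ... | no c₃≢0 = finite (elliptic _ _ _ (*-nonzero {z} z≢0 c₃≢0) third-point)
    where
    open Line x₀ x₁ y₀ y₁ z
    -- As polynomials in T, Σ cᵢ Tⁱ = (T² - d) (c₃ T + c₂).
    third-point : G (x₀ * c₃ + x₁ * - c₂) (y₀ * c₃ + y₁ * - c₂) (z * c₃) ≡ 0ℤ
    third-point = trans (G-on-line x₀ x₁ y₀ y₁ z c₃ (- c₂)) (root c₀ c₁ c₂ c₃ h₀ h₁)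
      where
      root : ∀ c₀ c₁ c₂ c₃ → c₀ + d * c₂ ≡ 0ℤ → c₁ + d * c₃ ≡ 0ℤ →
        c₃ * - c₂ * - c₂ * - c₂ + c₂ * - c₂ * - c₂ * c₃ + c₁ * - c₂ * c₃ * c₃ + c₀ * c₃ * c₃ * c₃ ≡ 0ℤ
      root c₀ c₁ c₂ c₃ h₀ h₁ = linear-combination (c₀ ∷ c₁ ∷ c₂ ∷ c₃ ∷ d ∷ [])
        (λ { (c₀ ∷ c₁ ∷ c₂ ∷ c₃ ∷ d ∷ []) →
          c₃ :* :- c₂ :* :- c₂ :* :- c₂ :+ c₂ :* :- c₂ :* :- c₂ :* c₃ :+ c₁ :* :- c₂ :* c₃ :* c₃ :+ c₀ :* c₃ :* c₃ :* c₃ ≈ # 0 ⇐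
          ((c₃ :* c₃ :* c₃) ⟨ c₀ :+ d :* c₂ ≈ # 0 ⟩) ∷ ((:- (c₂ :* c₃ :* c₃)) ⟨ c₁ :+ d :* c₃ ≈ # 0 ⟩) ∷ [] }) (h₀ , h₁ , tt)
    cancel : ∀ {i} → c₃ * i ≡ 0ℤ → i ≡ 0ℤ
    cancel = *-cancel-zero c₃≢0
    finite : let x = x₀ * c₃ + x₁ * - c₂ ; y = y₀ * c₃ + y₁ * - c₂ in
      (x ≡ 0ℤ × y ≡ 0ℤ) ⊎ (x + z * c₃ ≡ 0ℤ × y ≡ 0ℤ) ⊎ (x + + 2 * (z * c₃) ≡ 0ℤ × y ≡ z * c₃) →
      RationalLine x₀ x₁ y₀ y₁ z
    finite (inj₁ (hx , hy)) = finite₀ (ℤₚ.i-j≡0⇒i≡j _ _ (cancel (eliminate c₂ c₃ hx hy)))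
      where
      eliminate : ∀ c₂ c₃ → x₀ * c₃ + x₁ * - c₂ ≡ 0ℤ → y₀ * c₃ + y₁ * - c₂ ≡ 0ℤ →
        c₃ * (x₀ * y₁ - x₁ * y₀) ≡ 0ℤ
      eliminate c₂ c₃ hx hy = linear-combination (c₂ ∷ c₃ ∷ x₀ ∷ x₁ ∷ y₀ ∷ y₁ ∷ [])
        (λ { (c₂ ∷ c₃ ∷ x₀ ∷ x₁ ∷ y₀ ∷ y₁ ∷ []) → c₃ :* (x₀ :* y₁ :- x₁ :* y₀) ≈ # 0 ⇐
          (y₁ ⟨ x₀ :* c₃ :+ x₁ :* :- c₂ ≈ # 0 ⟩) ∷ ((:- x₁) ⟨ y₀ :* c₃ :+ y₁ :* :- c₂ ≈ # 0 ⟩) ∷ [] }) (hx , hy , tt)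
    finite (inj₂ (inj₁ (hx , hy))) = finite₁ (ℤₚ.i-j≡0⇒i≡j _ _ (cancel (eliminate c₂ c₃ hx hy)))
      where
      eliminate : ∀ c₂ c₃ → x₀ * c₃ + x₁ * - c₂ + z * c₃ ≡ 0ℤ → y₀ * c₃ + y₁ * - c₂ ≡ 0ℤ →
        c₃ * ((x₀ + z) * y₁ - x₁ * y₀) ≡ 0ℤ
      eliminate c₂ c₃ hx hy = linear-combination (c₂ ∷ c₃ ∷ x₀ ∷ x₁ ∷ y₀ ∷ y₁ ∷ z ∷ [])
        (λ { (c₂ ∷ c₃ ∷ x₀ ∷ x₁ ∷ y₀ ∷ y₁ ∷ z ∷ []) → c₃ :* ((x₀ :+ z) :* y₁ :- x₁ :* y₀) ≈ # 0 ⇐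
          (y₁ ⟨ x₀ :* c₃ :+ x₁ :* :- c₂ :+ z :* c₃ ≈ # 0 ⟩) ∷ ((:- x₁) ⟨ y₀ :* c₃ :+ y₁ :* :- c₂ ≈ # 0 ⟩) ∷ [] }) (hx , hy , tt)
    finite (inj₂ (inj₂ (hx , hy))) = finite₂ (ℤₚ.i-j≡0⇒i≡j _ _ (cancel (eliminate c₂ c₃ hx hy)))
      where
      eliminate : ∀ c₂ c₃ → x₀ * c₃ + x₁ * - c₂ + + 2 * (z * c₃) ≡ 0ℤ → y₀ * c₃ + y₁ * - c₂ ≡ z * c₃ →
        c₃ * ((x₀ + + 2 * z) * y₁ - x₁ * (y₀ - z)) ≡ 0ℤ
      eliminate c₂ c₃ hx hy = linear-combination (c₂ ∷ c₃ ∷ x₀ ∷ x₁ ∷ y₀ ∷ y₁ ∷ z ∷ [])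
        (λ { (c₂ ∷ c₃ ∷ x₀ ∷ x₁ ∷ y₀ ∷ y₁ ∷ z ∷ []) → c₃ :* ((x₀ :+ # 2 :* z) :* y₁ :- x₁ :* (y₀ :- z)) ≈ # 0 ⇐
          (y₁ ⟨ x₀ :* c₃ :+ x₁ :* :- c₂ :+ # 2 :* (z :* c₃) ≈ # 0 ⟩) ∷ ((:- x₁) ⟨ y₀ :* c₃ :+ y₁ :* :- c₂ ≈ z :* c₃ ⟩) ∷ [] }) (hx , hy , tt)

  data Meet (U V : Triple) : Set where
    meet₀ : Triple.u₀ U ≡ Triple.u₀ V → Meet U V
    meet₁ : Triple.u₁ U ≡ Triple.u₁ V → Meet U V
    meet₂ : Triple.u₂ U ≡ Triple.u₂ V → Meet U V

  -- For t = (p + w)/u₀ and u = (q - w)/v₀ the irrational part of t u is a multiple of q - p, and 2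
  -- p = u₁ - u₂ - u₀.
  excess : Triple → Triple
  excess ⟨ u₀ , u₁ , u₂ ⟩ = ⟨ u₀ - u₁ - u₂ , u₁ - u₂ - u₀ , u₂ - u₀ - u₁ ⟩

  difference-zero : ∀ {c i j} → c ≢ 0ℤ → c * (i - j) ≡ 0ℤ → i ≡ j
  difference-zero {i = i} {j} c≢0 eq = ℤₚ.i-j≡0⇒i≡j i j (*-cancel-zero c≢0 eq)

  -- A common entry of the triples says that σⁱt + σⁱu is rational,
  -- a common entry of the excesses that σⁱt σⁱu is.
  meet : ∀ {U V} → Configuration U V → Meet U V ⊎ Meet (excess U) (excess V)
  meet {⟨ u₀ , u₁ , u₂ ⟩} {⟨ v₀ , v₁ , v₂ ⟩} C =
    from-line (rational-line _ _ _ _ _ (heron u₀ u₁ u₂)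
      (*-nonzero {+ 2 * u₀} (*-nonzero {+ 2} (λ ()) u₀≢0) (*-nonzero {+ 2} (λ ()) v₀≢0))
      (proj₁ (configuration⇒point C)) (proj₂ (configuration⇒point C)))
    where
    open Configuration C
    u₀≢0 : u₀ ≢ 0ℤ
    u₀≢0 refl = e₃U≢0 refl
    v₀≢0 : v₀ ≢ 0ℤ
    v₀≢0 refl = e₃V≢0 refl
    8u₀v₀≢0 : + 8 * (u₀ * v₀) ≢ 0ℤ
    8u₀v₀≢0 = *-nonzero {+ 8} (λ ()) (*-nonzero {u₀} u₀≢0 v₀≢0)
    4u₀v₀≢0 : + 4 * (u₀ * v₀) ≢ 0ℤ
    4u₀v₀≢0 = *-nonzero {+ 4} (λ ()) (*-nonzero {u₀} u₀≢0 v₀≢0)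
    module P = Pair (u₁ - u₂ - u₀) 1ℤ (+ 2 * u₀) (v₁ - v₂ - v₀) -1ℤ (+ 2 * v₀) (heron u₀ u₁ u₂)
    ρ = u₀ ∷ u₁ ∷ u₂ ∷ v₀ ∷ v₁ ∷ v₂ ∷ []
    from-line : RationalLine P.x₀ P.x₁ P.y₀ P.y₁ P.z →
      Meet ⟨ u₀ , u₁ , u₂ ⟩ ⟨ v₀ , v₁ , v₂ ⟩ ⊎ Meet (excess ⟨ u₀ , u₁ , u₂ ⟩) (excess ⟨ v₀ , v₁ , v₂ ⟩)
    from-line (infinity-x h) = inj₂ (meet₁ (linear-combination ρ
      (λ { (u₀ ∷ u₁ ∷ u₂ ∷ v₀ ∷ v₁ ∷ v₂ ∷ []) →
        let open E.Pair (u₁ :- u₂ :- u₀) (con 1ℤ) (# 2 :* u₀) (v₁ :- v₂ :- v₀) (con -1ℤ) (# 2 :* v₀) (E.heron u₀ u₁ u₂) in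
        u₁ :- u₂ :- u₀ ≈ v₁ :- v₂ :- v₀ ⇐ ((:- # 1) ⟨ y₁ ≈ # 0 ⟩) ∷ [] }) (h , tt)))
    from-line (infinity-y h) = inj₁ (meet₀ (difference-zero {+ 2} (λ ()) (linear-combination ρ
      (λ { (u₀ ∷ u₁ ∷ u₂ ∷ v₀ ∷ v₁ ∷ v₂ ∷ []) →
        let open E.Pair (u₁ :- u₂ :- u₀) (con 1ℤ) (# 2 :* u₀) (v₁ :- v₂ :- v₀) (con -1ℤ) (# 2 :* v₀) (E.heron u₀ u₁ u₂) in
        # 2 :* (u₀ :- v₀) ≈ # 0 ⇐ ((:- # 1) ⟨ x₁ ≈ # 0 ⟩) ∷ [] }) (h , tt))))
    from-line (infinity-xy h) = inj₂ (meet₂ (linear-combination ρ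
      (λ { (u₀ ∷ u₁ ∷ u₂ ∷ v₀ ∷ v₁ ∷ v₂ ∷ []) →
        let open E.Pair (u₁ :- u₂ :- u₀) (con 1ℤ) (# 2 :* u₀) (v₁ :- v₂ :- v₀) (con -1ℤ) (# 2 :* v₀) (E.heron u₀ u₁ u₂) in
        u₂ :- u₀ :- u₁ ≈ v₂ :- v₀ :- v₁ ⇐ (# 1 ⟨ x₁ :+ y₁ ≈ # 0 ⟩) ∷ [] }) (h , tt)))
    -- In the three finite cases p/s, p/(s + 1) or (p - 1)/(s + 2) is rational; these correspond to
    -- σ²t + σ²u, σ²t σ²u and σt + σu.
    from-line (finite₀ h) = inj₁ (meet₂ (difference-zero 8u₀v₀≢0 (linear-combination ρ
      (λ { (u₀ ∷ u₁ ∷ u₂ ∷ v₀ ∷ v₁ ∷ v₂ ∷ []) →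
        let open E.Pair (u₁ :- u₂ :- u₀) (con 1ℤ) (# 2 :* u₀) (v₁ :- v₂ :- v₀) (con -1ℤ) (# 2 :* v₀) (E.heron u₀ u₁ u₂) in
        # 8 :* (u₀ :* v₀) :* (u₂ :- v₂) ≈ # 0 ⇐
        ((:- # 1) ⟨ x₀ :* y₁ ≈ x₁ :* y₀ ⟩) ∷ ((:- (# 2 :* u₀)) ⟨ E.heron u₀ u₁ u₂ ≈ E.heron v₀ v₁ v₂ ⟩) ∷ [] }) (h , heron-equal , tt))))
    from-line (finite₁ h) = inj₂ (meet₀ (difference-zero 4u₀v₀≢0 (linear-combination ρ
      (λ { (u₀ ∷ u₁ ∷ u₂ ∷ v₀ ∷ v₁ ∷ v₂ ∷ []) →
        let open E.Pair (u₁ :- u₂ :- u₀) (con 1ℤ) (# 2 :* u₀) (v₁ :- v₂ :- v₀) (con -1ℤ) (# 2 :* v₀) (E.heron u₀ u₁ u₂) in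
        # 4 :* (u₀ :* v₀) :* ((u₀ :- u₁ :- u₂) :- (v₀ :- v₁ :- v₂)) ≈ # 0 ⇐
        (# 1 ⟨ (x₀ :+ z) :* y₁ ≈ x₁ :* y₀ ⟩) ∷ ((# 2 :* u₀) ⟨ E.heron u₀ u₁ u₂ ≈ E.heron v₀ v₁ v₂ ⟩) ∷ [] }) (h , heron-equal , tt))))
    from-line (finite₂ h) = inj₁ (meet₁ (difference-zero 8u₀v₀≢0 (linear-combination ρ
      (λ { (u₀ ∷ u₁ ∷ u₂ ∷ v₀ ∷ v₁ ∷ v₂ ∷ []) →
        let open E.Pair (u₁ :- u₂ :- u₀) (con 1ℤ) (# 2 :* u₀) (v₁ :- v₂ :- v₀) (con -1ℤ) (# 2 :* v₀) (E.heron u₀ u₁ u₂) in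
        # 8 :* (u₀ :* v₀) :* (u₁ :- v₁) ≈ # 0 ⇐
        ((:- # 1) ⟨ (x₀ :+ # 2 :* z) :* y₁ ≈ x₁ :* (y₀ :- z) ⟩) ∷ ((:- (# 2 :* u₀)) ⟨ E.heron u₀ u₁ u₂ ≈ E.heron v₀ v₁ v₂ ⟩) ∷ [] }) (h , heron-equal , tt))))

  -- Refutation of pairs of relations.

  parity : ∀ i → ∃ λ k → i ≡ + 2 * k ⊎ i ≡ + 2 * k + 1ℤ
  parity i = i /ℕ 2 , by-remainder (i %ℕ 2) (n%ℕd<d i 2) (a≡a%ℕn+[a/ℕn]*n i 2)
    where
    by-remainder : ∀ r {k} → r ℕ.< 2 → i ≡ + r + k * + 2 → i ≡ + 2 * k ⊎ i ≡ + 2 * k + 1ℤ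
    by-remainder 0 {k} _ eq = inj₁ (trans eq (trans (ℤₚ.+-identityˡ (k * + 2)) (ℤₚ.*-comm k (+ 2))))
    by-remainder 1 {k} _ eq = inj₂ (trans eq (trans (ℤₚ.+-comm 1ℤ (k * + 2)) (cong (_+ 1ℤ) (ℤₚ.*-comm k (+ 2)))))
    by-remainder (ℕ.suc (ℕ.suc _)) (ℕ.s≤s (ℕ.s≤s ()))

  2*k≢1 : ∀ k → + 2 * k ≢ 1ℤ
  2*k≢1 k eq with ∣ k ∣ | trans (sym (ℤₚ.abs-* (+ 2) k)) (cong ∣_∣ eq)
  ... | ℕ.suc m | eq′ = contradiction (trans (sym (ℕₚ.+-suc m (m ℕ.+ 0))) (ℕₚ.suc-injective eq′)) λ ()

  -- The cubic x³ - x - 1 is irreducible modulo 2.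
  cubic-irreducible : ∀ e u → e * e * e ≡ u * u * (e + u) → u ≡ 0ℤ
  cubic-irreducible e u = descend e u (<-wellFounded ∣ u ∣)
    where
    descend : ∀ e u → Acc ℕ._<_ ∣ u ∣ → e * e * e ≡ u * u * (e + u) → u ≡ 0ℤ
    descend e u (acc smaller) eq with parity e | parity u
    ... | k , inj₂ refl | j , inj₂ refl = ⊥-elim (2*k≢1
      ((1ℤ + + 4 * j * j + + 4 * j) * (k + j + 1ℤ) - + 4 * k * k * k - + 6 * k * k - + 3 * k)
      (linear-combination (k ∷ j ∷ [])
        (λ { (k ∷ j ∷ []) → let e = # 2 :* k :+ # 1 ; u = # 2 :* j :+ # 1 in
          # 2 :* ((# 1 :+ # 4 :* j :* j :+ # 4 :* j) :* (k :+ j :+ # 1) :- # 4 :* k :* k :* k :- # 6 :* k :* k :- # 3 :* k) ≈ # 1 ⇐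
          ((:- # 1) ⟨ e :* e :* e ≈ u :* u :* (e :+ u) ⟩) ∷ [] }) (eq , tt)))
    ... | k , inj₂ refl | j , inj₁ refl = ⊥-elim (2*k≢1
      (+ 2 * j * j * (+ 2 * k + 1ℤ + + 2 * j) - + 4 * k * k * k - + 6 * k * k - + 3 * k)
      (linear-combination (k ∷ j ∷ [])
        (λ { (k ∷ j ∷ []) → let e = # 2 :* k :+ # 1 ; u = # 2 :* j in
          # 2 :* (# 2 :* j :* j :* (# 2 :* k :+ # 1 :+ # 2 :* j) :- # 4 :* k :* k :* k :- # 6 :* k :* k :- # 3 :* k) ≈ # 1 ⇐
          ((:- # 1) ⟨ e :* e :* e ≈ u :* u :* (e :+ u) ⟩) ∷ [] }) (eq , tt)))
    ... | k , inj₁ refl | j , inj₂ refl = ⊥-elim (2*k≢1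
      (+ 4 * k * k * k - k - j - (+ 2 * j * j + + 2 * j) * (+ 2 * k + + 2 * j + 1ℤ))
      (linear-combination (k ∷ j ∷ [])
        (λ { (k ∷ j ∷ []) → let e = # 2 :* k ; u = # 2 :* j :+ # 1 in
          # 2 :* (# 4 :* k :* k :* k :- k :- j :- (# 2 :* j :* j :+ # 2 :* j) :* (# 2 :* k :+ # 2 :* j :+ # 1)) ≈ # 1 ⇐
          (# 1 ⟨ e :* e :* e ≈ u :* u :* (e :+ u) ⟩) ∷ [] }) (eq , tt)))
    ... | k , inj₁ refl | j , inj₁ refl = halve (j ≟ 0ℤ)
      where
      halve : _ → _
      halve (yes refl) = refl
      halve (no j≢0) = cong (+ 2 *_) (descend k j (smaller (∣j∣<∣2j∣ j j≢0)) (difference-zero {+ 8} (λ ())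
        (linear-combination (k ∷ j ∷ [])
        (λ { (k ∷ j ∷ []) → let e = # 2 :* k ; u = # 2 :* j in
          # 8 :* (k :* k :* k :- j :* j :* (k :+ j)) ≈ # 0 ⇐
          (# 1 ⟨ e :* e :* e ≈ u :* u :* (e :+ u) ⟩) ∷ [] }) (eq , tt))))
        where
        ∣j∣<∣2j∣ : ∀ j → j ≢ 0ℤ → ∣ j ∣ ℕ.< ∣ + 2 * j ∣
        ∣j∣<∣2j∣ (+ ℕ.zero)  j≢0 = contradiction refl j≢0
        ∣j∣<∣2j∣ +[1+ n ] _ = ℕₚ.m<m+n (ℕ.suc n) ℕ.z<s
        ∣j∣<∣2j∣ -[1+ n ] _ = ℕₚ.m<m+n (ℕ.suc n) ℕ.z<s

  -- An exchange of two entries only changes the sign of `alternant`, so g(t) + g(u) would be -3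
  -- instead of -2.
  mirror⇒⊥ : ∀ {u₀ u₁ u₂} → ¬ Configuration ⟨ u₀ , u₁ , u₂ ⟩ ⟨ u₀ , u₂ , u₁ ⟩
  mirror⇒⊥ {u₀} {u₁} {u₂} C = *-nonzero {+ 2} (λ ()) (*-nonzero {e₃ u₀ u₁ u₂} e₃U≢0 e₃V≢0)
    (linear-combination (u₀ ∷ u₁ ∷ u₂ ∷ [])
      (λ { (u₀ ∷ u₁ ∷ u₂ ∷ []) → # 2 :* (E.e₃ u₀ u₁ u₂ :* E.e₃ u₀ u₂ u₁) ≈ # 0 ⇐
        ((:- # 1) ⟨ E.alternant u₀ u₁ u₂ :* E.e₃ u₀ u₂ u₁ :+ E.alternant u₀ u₂ u₁ :* E.e₃ u₀ u₁ u₂ ≈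
                 # 2 :* (E.e₃ u₀ u₁ u₂ :* E.e₃ u₀ u₂ u₁) ⟩) ∷ [] }) (rational , tt))
    where open Configuration C

  -- `irrational` equates the sums of the reciprocals of the entries, so two common entries force
  -- the third and the triples are mirror images.
  generic-sums⇒⊥ : ∀ {u₀ u₁ u₂ v₁} → ¬ Configuration ⟨ u₀ , u₁ , u₂ ⟩ ⟨ u₀ , v₁ , u₁ ⟩
  generic-sums⇒⊥ {u₀} {u₁} {u₂} {v₁} C = mirror⇒⊥ (subst (λ v → Configuration _ ⟨ u₀ , v , u₁ ⟩) (sym u₂≡v₁) C)
    where
    open Configuration C
    u₀u₁≢0 : u₀ * u₁ ≢ 0ℤ
    u₀u₁≢0 eq = e₃U≢0 (cong (_* u₂) eq)
    u₂≡v₁ : u₂ ≡ v₁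
    u₂≡v₁ = difference-zero (*-nonzero {u₀ * u₁} u₀u₁≢0 u₀u₁≢0) (linear-combination (u₀ ∷ u₁ ∷ u₂ ∷ v₁ ∷ [])
      (λ { (u₀ ∷ u₁ ∷ u₂ ∷ v₁ ∷ []) → (u₀ :* u₁) :* (u₀ :* u₁) :* (u₂ :- v₁) ≈ # 0 ⇐
        ((:- # 1) ⟨ E.e₂ u₀ u₁ u₂ :* E.e₃ u₀ v₁ u₁ ≈ E.e₂ u₀ v₁ u₁ :* E.e₃ u₀ u₁ u₂ ⟩) ∷ [] }) (irrational , tt))

  -- `heron` is minus the second elementary symmetric function of the excesses. Two of them agree
  -- and have the sum -2 u₂ ≠ 0, so the third agrees as well, and the triples are mirror images.
  generic-products⇒⊥ : ∀ {u₀ u₁ u₂ v₀ v₁ v₂} → Configuration ⟨ u₀ , u₁ , u₂ ⟩ ⟨ v₀ , v₁ , v₂ ⟩ →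
    u₀ - u₁ - u₂ ≡ v₀ - v₁ - v₂ → u₁ - u₂ - u₀ ≢ v₂ - v₀ - v₁
  generic-products⇒⊥ {u₀} {u₁} {u₂} {v₀} {v₁} {v₂} C h₀ h₁ =
    mirror⇒⊥ (subst₂ (λ v w → Configuration ⟨ u₀ , u₁ , u₂ ⟩ ⟨ v , proj₁ w , proj₂ w ⟩)
      (sym u₀≡v₀) (sym (cong₂ _,_ u₂≡v₁ u₁≡v₂)) C)
    where
    open Configuration C
    ρ = u₀ ∷ u₁ ∷ u₂ ∷ v₀ ∷ v₁ ∷ v₂ ∷ []
    u₂≢0 : u₂ ≢ 0ℤ
    u₂≢0 refl = e₃U≢0 (ℤₚ.*-zeroʳ (u₀ * u₁))
    h₂ : u₂ - u₀ - u₁ ≡ v₁ - v₂ - v₀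
    h₂ = difference-zero (*-nonzero {+ 2} (λ ()) u₂≢0) (linear-combination ρ
      (λ { (u₀ ∷ u₁ ∷ u₂ ∷ v₀ ∷ v₁ ∷ v₂ ∷ []) →
        let x₀ = u₀ :- u₁ :- u₂ ; x₁ = u₁ :- u₂ :- u₀ ; x₂ = u₂ :- u₀ :- u₁
            y₀ = v₀ :- v₁ :- v₂ ; y₁ = v₁ :- v₂ :- v₀ ; y₂ = v₂ :- v₀ :- v₁ in
        # 2 :* u₂ :* (x₂ :- y₁) ≈ # 0 ⇐
        (# 1 ⟨ E.heron u₀ u₁ u₂ ≈ E.heron v₀ v₁ v₂ ⟩) ∷
        ((x₁ :+ y₁) ⟨ x₀ ≈ y₀ ⟩) ∷ ((y₀ :+ y₁) ⟨ x₁ ≈ y₂ ⟩) ∷ [] }) (heron-equal , h₀ , h₁ , tt))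
    half-sum : ∀ {x y x′ y′ u v} → + 2 * u ≡ - (x + y) → + 2 * v ≡ - (x′ + y′) → x ≡ x′ → y ≡ y′ → u ≡ v
    half-sum hu hv refl refl = ℤₚ.*-cancelˡ-≡ (+ 2) _ _ (trans hu (sym hv))
    doubled : ∀ u v w → + 2 * u ≡ - ((v - w - u) + (w - u - v))
    doubled u v w = linear-combination (u ∷ v ∷ w ∷ [])
      (λ { (u ∷ v ∷ w ∷ []) → # 2 :* u ≈ :- ((v :- w :- u) :+ (w :- u :- v)) ⇐ [] }) tt
    doubled′ : ∀ u v w → + 2 * u ≡ - ((w - u - v) + (v - w - u))
    doubled′ u v w = trans (doubled u v w) (cong -_ (ℤₚ.+-comm (v - w - u) _))
    u₀≡v₀ : u₀ ≡ v₀
    u₀≡v₀ = half-sum (doubled u₀ u₁ u₂) (doubled′ v₀ v₁ v₂) h₁ h₂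
    u₁≡v₂ : u₁ ≡ v₂
    u₁≡v₂ = half-sum (doubled u₁ u₂ u₀) (doubled′ v₂ v₀ v₁) h₂ h₀
    u₂≡v₁ : u₂ ≡ v₁
    u₂≡v₁ = half-sum (doubled u₂ u₀ u₁) (doubled′ v₁ v₂ v₀) h₀ h₁

  -- As `alternant` vanishes on (a, a, x), `rational` becomes (y - z)(y - a)(z - a) = 2 a y z. The
  -- other conditions leave two cases: y + z = x + a, where (y - a)(z - a) = 0, or (y + z)(x + a) =
  -- K. In the second also (x - a)(y - z) = K, and eliminating y and z gives (x + a) K = 0, although
  -- neither factor can vanish.
  column-sums⇒⊥ : ∀ {a x y z} → ¬ Configuration ⟨ a , a , x ⟩ ⟨ a , y , z ⟩
  column-sums⇒⊥ {a} {x} {y} {z} C = by-factor (*-zero {P - (x + a)} factored)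
    where
    open Configuration C
    ρ = a ∷ x ∷ y ∷ z ∷ []
    P K Q r : ℤ
    P = y + z
    K = a * a + + 4 * a * x - x * x
    Q = (y - a) * (z - a)
    r = y - z
    aa≢0 : a * a ≢ 0ℤ
    aa≢0 eq = e₃U≢0 (cong (_* x) eq)
    a≢0 : a ≢ 0ℤ
    a≢0 refl = e₃U≢0 refl
    x≢0 : x ≢ 0ℤ
    x≢0 refl = e₃U≢0 (ℤₚ.*-zeroʳ (a * a))
    H₁ : (a + x) * (y * z) ≡ a * x * (y + z)
    H₁ = difference-zero aa≢0 (linear-combination ρ
      (λ { (a ∷ x ∷ y ∷ z ∷ []) → a :* a :* ((a :+ x) :* (y :* z) :- a :* x :* (y :+ z)) ≈ # 0 ⇐
        (# 1 ⟨ E.e₂ a a x :* E.e₃ a y z ≈ E.e₂ a y z :* E.e₃ a a x ⟩) ∷ [] }) (irrational , tt))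
    H₂ : r * Q ≡ + 2 * (a * y * z)
    H₂ = difference-zero e₃U≢0 (linear-combination ρ
      (λ { (a ∷ x ∷ y ∷ z ∷ []) → a :* a :* x :* ((y :- z) :* ((y :- a) :* (z :- a)) :- # 2 :* (a :* y :* z)) ≈ # 0 ⇐
        (# 1 ⟨ E.alternant a a x :* E.e₃ a y z :+ E.alternant a y z :* E.e₃ a a x ≈ # 2 :* (E.e₃ a a x :* E.e₃ a y z) ⟩) ∷ [] })
      (rational , tt))
    Q≢0 : Q ≢ 0ℤ
    Q≢0 eq = *-nonzero {+ 2} (λ ()) e₃V≢0 (trans (sym H₂) (trans (cong (r *_) eq) (ℤₚ.*-zeroʳ r)))
    factored : (P - (x + a)) * (P * (x + a) - K) ≡ 0ℤ
    factored = linear-combination ρ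
      (λ { (a ∷ x ∷ y ∷ z ∷ []) → let P = y :+ z ; K = a :* a :+ # 4 :* a :* x :- x :* x in
        (P :- (x :+ a)) :* (P :* (x :+ a) :- K) ≈ # 0 ⇐
        ((:- (a :+ x)) ⟨ E.heron a a x ≈ E.heron a y z ⟩) ∷
        (# 4 ⟨ (a :+ x) :* (y :* z) ≈ a :* x :* (y :+ z) ⟩) ∷ [] }) (heron-equal , H₁ , tt)
    by-factor : ¬ (P - (x + a) ≡ 0ℤ ⊎ P * (x + a) - K ≡ 0ℤ)
    by-factor (inj₁ h) = Q≢0 (*-cancel-zero {+ 4} (λ ()) (linear-combination ρ
      (λ { (a ∷ x ∷ y ∷ z ∷ []) → let P = y :+ z in
        # 4 :* ((y :- a) :* (z :- a)) ≈ # 0 ⇐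
        (# 1 ⟨ E.heron a a x ≈ E.heron a y z ⟩) ∷ ((P :- # 5 :* a :+ x) ⟨ P :- (x :+ a) ≈ # 0 ⟩) ∷ [] }) (heron-equal , h , tt)))
    by-factor (inj₂ h) = by-last (*-zero {x + a} product-zero)
      where
      s₁ : (a + x) * (a + x) * (y * z) ≡ a * x * K
      s₁ = linear-combination ρ
        (λ { (a ∷ x ∷ y ∷ z ∷ []) → let P = y :+ z ; K = a :* a :+ # 4 :* a :* x :- x :* x in
          (a :+ x) :* (a :+ x) :* (y :* z) ≈ a :* x :* K ⇐
          ((a :+ x) ⟨ (a :+ x) :* (y :* z) ≈ a :* x :* P ⟩) ∷ ((a :* x) ⟨ P :* (x :+ a) :- K ≈ # 0 ⟩) ∷ [] }) (H₁ , h , tt)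
      s₂ : (x - a) * r ≡ K
      s₂ = difference-zero (*-nonzero {+ 2} (λ ()) e₃U≢0) (linear-combination ρ
        (λ { (a ∷ x ∷ y ∷ z ∷ []) → let P = y :+ z ; K = a :* a :+ # 4 :* a :* x :- x :* x ; r = y :- z in
          # 2 :* E.e₃ a a x :* ((x :- a) :* r :- K) ≈ # 0 ⇐
          (((a :+ x) :* (a :+ x)) ⟨ r :* ((y :- a) :* (z :- a)) ≈ # 2 :* (a :* y :* z) ⟩) ∷
          ((:- (r :- # 2 :* a)) ⟨ (a :+ x) :* (a :+ x) :* (y :* z) ≈ a :* x :* K ⟩) ∷
          ((r :* a :* (a :+ x)) ⟨ P :* (x :+ a) :- K ≈ # 0 ⟩) ∷ [] }) (H₂ , s₁ , h , tt))
      -- from r² = P² - 4yz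
      product-zero : (x + a) * K ≡ 0ℤ
      product-zero = *-cancel-zero (*-nonzero {+ 8} (λ ()) e₃U≢0) (linear-combination ρ
        (λ { (a ∷ x ∷ y ∷ z ∷ []) → let P = y :+ z ; K = a :* a :+ # 4 :* a :* x :- x :* x ; r = y :- z in
          # 8 :* E.e₃ a a x :* ((x :+ a) :* K) ≈ # 0 ⇐
          ((:- ((x :+ a) :* (x :+ a) :* ((x :- a) :* r :+ K))) ⟨ (x :- a) :* r ≈ K ⟩) ∷
          (((x :- a) :* (x :- a) :* (P :* (x :+ a) :+ K)) ⟨ P :* (x :+ a) :- K ≈ # 0 ⟩) ∷
          ((:- (# 4 :* (x :- a) :* (x :- a))) ⟨ (a :+ x) :* (a :+ x) :* (y :* z) ≈ a :* x :* K ⟩) ∷ [] }) (s₂ , h , s₁ , tt))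
      x+a≢0 : x + a ≢ 0ℤ
      x+a≢0 eq = *-nonzero {+ 4} (λ ()) aa≢0 (linear-combination ρ
        (λ { (a ∷ x ∷ y ∷ z ∷ []) → let P = y :+ z ; K = a :* a :+ # 4 :* a :* x :- x :* x in
          # 4 :* (a :* a) ≈ # 0 ⇐
          (# 1 ⟨ P :* (x :+ a) :- K ≈ # 0 ⟩) ∷ ((# 5 :* a :- x :- P) ⟨ x :+ a ≈ # 0 ⟩) ∷ [] }) (h , eq , tt))
      by-last : ¬ (x + a ≡ 0ℤ ⊎ K ≡ 0ℤ)
      by-last (inj₁ eq) = x+a≢0 eq
      by-last (inj₂ eq) = *-nonzero {a + x} (x+a≢0 ∘ trans (ℤₚ.+-comm x a)) (*-nonzero (x+a≢0 ∘ trans (ℤₚ.+-comm x a)) yz≢0)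
        (trans (sym (ℤₚ.*-assoc (a + x) (a + x) (y * z))) (trans s₁ (trans (cong (a * x *_) eq) (ℤₚ.*-zeroʳ (a * x)))))
        where
        yz≢0 : y * z ≢ 0ℤ
        yz≢0 eq = e₃V≢0 (trans (ℤₚ.*-assoc a y z) (trans (cong (a *_) eq) (ℤₚ.*-zeroʳ a)))

  -- `heron-equal` gives v₁ v₂ = u w, and then `irrational` leaves v₁ + v₂ = u + w or v₁ + v₂ = 2 w.
  -- In the first case v₁, v₂ are u, w in some order and v₀ = u is repeated, so `alternant` vanishes
  -- on both triples. In the second, eliminating v₁ - v₂ gives e³ = u² (e + u) for e = w - u, the
  -- equation x³ = x + 1 with x = e/u.
  column-products⇒⊥ : ∀ {u w v₀ v₁ v₂} → Configuration ⟨ u , u , w ⟩ ⟨ v₀ , v₁ , v₂ ⟩ → v₀ ≢ v₁ + v₂ - w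
  column-products⇒⊥ {u} {w} {_} {v₁} {v₂} C refl = by-factor (*-zero {v₁ + v₂ - + 2 * w} factored)
    where
    open Configuration C
    v₀ = v₁ + v₂ - w
    ρ = u ∷ w ∷ v₁ ∷ v₂ ∷ []
    u≢0 : u ≢ 0ℤ
    u≢0 refl = e₃U≢0 refl
    w≢0 : w ≢ 0ℤ
    w≢0 refl = e₃U≢0 (ℤₚ.*-zeroʳ (u * u))
    product : v₁ * v₂ ≡ u * w
    product = difference-zero {+ 4} (λ ()) (linear-combination ρ
      (λ { (u ∷ w ∷ v₁ ∷ v₂ ∷ []) → # 4 :* (v₁ :* v₂ :- u :* w) ≈ # 0 ⇐
        (# 1 ⟨ E.heron u u w ≈ E.heron (v₁ :+ v₂ :- w) v₁ v₂ ⟩) ∷ [] }) (heron-equal , tt))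
    alternant-V : alternant v₀ v₁ v₂ ≡ + 2 * e₃ v₀ v₁ v₂
    alternant-V = difference-zero e₃U≢0 (linear-combination ρ
      (λ { (u ∷ w ∷ v₁ ∷ v₂ ∷ []) → let v₀ = v₁ :+ v₂ :- w in
        E.e₃ u u w :* (E.alternant v₀ v₁ v₂ :- # 2 :* E.e₃ v₀ v₁ v₂) ≈ # 0 ⇐
        (# 1 ⟨ E.alternant u u w :* E.e₃ v₀ v₁ v₂ :+ E.alternant v₀ v₁ v₂ :* E.e₃ u u w ≈
               # 2 :* (E.e₃ u u w :* E.e₃ v₀ v₁ v₂) ⟩) ∷ [] }) (rational , tt))
    factored : (v₁ + v₂ - + 2 * w) * (v₁ + v₂ - u - w) ≡ 0ℤ
    factored = *-cancel-zero e₃U≢0 (linear-combination ρ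
      (λ { (u ∷ w ∷ v₁ ∷ v₂ ∷ []) → let v₀ = v₁ :+ v₂ :- w in
        E.e₃ u u w :* ((v₁ :+ v₂ :- # 2 :* w) :* (v₁ :+ v₂ :- u :- w)) ≈ # 0 ⇐
        ((:- # 1) ⟨ E.e₂ u u w :* E.e₃ v₀ v₁ v₂ ≈ E.e₂ v₀ v₁ v₂ :* E.e₃ u u w ⟩) ∷
        ((E.e₂ u u w :* v₀ :- E.e₃ u u w) ⟨ v₁ :* v₂ ≈ u :* w ⟩) ∷ [] }) (irrational , product , tt))
    by-factor : ¬ (v₁ + v₂ - + 2 * w ≡ 0ℤ ⊎ v₁ + v₂ - u - w ≡ 0ℤ)
    by-factor (inj₂ h) = *-nonzero {+ 2} (λ ()) e₃V≢0 (trans (sym alternant-V) (linear-combination ρ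
      (λ { (u ∷ w ∷ v₁ ∷ v₂ ∷ []) → let v₀ = v₁ :+ v₂ :- w in
        E.alternant v₀ v₁ v₂ ≈ # 0 ⇐
        ((:- (w :* (v₁ :- v₂))) ⟨ v₁ :+ v₂ :- u :- w ≈ # 0 ⟩) ∷
        ((v₁ :- v₂) ⟨ v₁ :* v₂ ≈ u :* w ⟩) ∷ [] }) (h , product , tt)))
    by-factor (inj₁ h) = u≢0 (cubic-irreducible (w - u) u (difference-zero (*-nonzero {+ 4} (λ ()) w≢0) (linear-combination ρ
      (λ { (u ∷ w ∷ v₁ ∷ v₂ ∷ []) → let e = w :- u ; δ = v₁ :- v₂ ; s = v₁ :+ v₂ in
        # 4 :* w :* (e :* e :* e :- u :* u :* (e :+ u)) ≈ # 0 ⇐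
        (((u :- w) :* δ :+ # 2 :* u :* w) ⟨ (u :- w) :* δ ≈ # 2 :* u :* w ⟩) ∷
        ((:- (e :* e :* (s :+ # 2 :* w))) ⟨ s :- # 2 :* w ≈ # 0 ⟩) ∷
        ((# 4 :* e :* e) ⟨ v₁ :* v₂ ≈ u :* w ⟩) ∷ [] }) (root , h , product , tt))))
      where
      root : (u - w) * (v₁ - v₂) ≡ + 2 * u * w
      root = difference-zero w≢0 (linear-combination ρ
        (λ { (u ∷ w ∷ v₁ ∷ v₂ ∷ []) → let v₀ = v₁ :+ v₂ :- w ; δ = v₁ :- v₂ in
          w :* ((u :- w) :* δ :- # 2 :* u :* w) ≈ # 0 ⇐
          (# 1 ⟨ E.alternant v₀ v₁ v₂ ≈ # 2 :* E.e₃ v₀ v₁ v₂ ⟩) ∷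
          ((w :* δ :+ # 2 :* v₁ :* v₂) ⟨ v₁ :+ v₂ :- # 2 :* w ≈ # 0 ⟩) ∷
          ((# 2 :* w :- δ) ⟨ v₁ :* v₂ ≈ u :* w ⟩) ∷ [] }) (alternant-V , h , product , tt))

  advance : ∀ {U V} → Meet U V → Meet (rotate U) (rotate V)
  advance (meet₀ h) = meet₂ h
  advance (meet₁ h) = meet₀ h
  advance (meet₂ h) = meet₁ h

  -- The two equations share the entry u₀, share no entry, or share the entry v₀; the first and the
  -- last case differ by `swap`.
  first-sum⇒⊥ : ∀ {u₀ u₁ u₂ v₀ v₁ v₂} → Configuration ⟨ u₀ , u₁ , u₂ ⟩ ⟨ v₀ , v₁ , v₂ ⟩ →
    u₀ ≡ v₀ → ¬ Meet ⟨ u₀ , u₁ , u₂ ⟩ ⟨ v₁ , v₂ , v₀ ⟩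
  first-sum⇒⊥ C refl (meet₀ refl) = column-sums⇒⊥ (swap C)
  first-sum⇒⊥ C refl (meet₁ refl) = generic-sums⇒⊥ C
  first-sum⇒⊥ C refl (meet₂ refl) = column-sums⇒⊥ (rotateˡ (rotateˡ C))

  two-sums⇒⊥ : ∀ {U V} → Configuration U V → Meet U V → ¬ Meet U (rotate V)
  two-sums⇒⊥ C (meet₀ h) m = first-sum⇒⊥ C h m
  two-sums⇒⊥ C (meet₁ h) m = first-sum⇒⊥ (rotateˡ (rotateʳ C)) h (advance m)
  two-sums⇒⊥ C (meet₂ h) m = first-sum⇒⊥ (rotateˡ (rotateʳ (rotateˡ (rotateʳ C)))) h (advance (advance m))

  column-products⇒⊥′ : ∀ {u₀ u₁ u₂ v₀ v₁ v₂} → Configuration ⟨ u₀ , u₁ , u₂ ⟩ ⟨ v₀ , v₁ , v₂ ⟩ →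
    u₀ - u₁ - u₂ ≡ v₀ - v₁ - v₂ → u₁ - u₂ - u₀ ≢ v₀ - v₁ - v₂
  column-products⇒⊥′ {u₀} {u₁} {u₂} {v₀} {v₁} {v₂} C h k =
    column-products⇒⊥ (subst (λ u → Configuration ⟨ u₀ , u , u₂ ⟩ ⟨ v₀ , v₁ , v₂ ⟩) (sym u₀≡u₁) C)
      (difference-zero {+ 2} (λ ()) (linear-combination ρ
        (λ { (u₀ ∷ u₁ ∷ u₂ ∷ v₀ ∷ v₁ ∷ v₂ ∷ []) → # 2 :* (v₀ :- (v₁ :+ v₂ :- u₂)) ≈ # 0 ⇐
          ((:- # 1) ⟨ u₀ :- u₁ :- u₂ ≈ v₀ :- v₁ :- v₂ ⟩) ∷
          ((:- # 1) ⟨ u₁ :- u₂ :- u₀ ≈ v₀ :- v₁ :- v₂ ⟩) ∷ [] }) (h , k , tt)))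
    where
    ρ = u₀ ∷ u₁ ∷ u₂ ∷ v₀ ∷ v₁ ∷ v₂ ∷ []
    u₀≡u₁ : u₀ ≡ u₁
    u₀≡u₁ = difference-zero {+ 2} (λ ()) (linear-combination ρ
        (λ { (u₀ ∷ u₁ ∷ u₂ ∷ v₀ ∷ v₁ ∷ v₂ ∷ []) → # 2 :* (u₀ :- u₁) ≈ # 0 ⇐
          (# 1 ⟨ u₀ :- u₁ :- u₂ ≈ v₀ :- v₁ :- v₂ ⟩) ∷
          ((:- # 1) ⟨ u₁ :- u₂ :- u₀ ≈ v₀ :- v₁ :- v₂ ⟩) ∷ [] }) (h , k , tt))

  first-product⇒⊥ : ∀ {u₀ u₁ u₂ v₀ v₁ v₂} → Configuration ⟨ u₀ , u₁ , u₂ ⟩ ⟨ v₀ , v₁ , v₂ ⟩ →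
    u₀ - u₁ - u₂ ≡ v₀ - v₁ - v₂ → ¬ Meet (excess ⟨ u₀ , u₁ , u₂ ⟩) (excess ⟨ v₁ , v₂ , v₀ ⟩)
  first-product⇒⊥ C h (meet₀ k) = column-products⇒⊥′ (swap C) (sym h) (sym k)
  first-product⇒⊥ C h (meet₁ k) = generic-products⇒⊥ C h k
  first-product⇒⊥ C h (meet₂ k) = column-products⇒⊥′ (rotateˡ (rotateˡ C)) k h

  two-products⇒⊥ : ∀ {U V} → Configuration U V → Meet (excess U) (excess V) → ¬ Meet (excess U) (excess (rotate V))
  two-products⇒⊥ {U} {V} C (meet₀ h) m = first-product⇒⊥ C h m
  two-products⇒⊥ {U} {V} C (meet₁ h) m =
    first-product⇒⊥ (rotateˡ (rotateʳ C)) h (advance {excess U} {excess (rotate V)} m)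
  two-products⇒⊥ {U} {V} C (meet₂ h) m = first-product⇒⊥ (rotateˡ (rotateʳ (rotateˡ (rotateʳ C)))) h
    (advance {excess (rotate U)} {excess (rotate (rotate V))} (advance {excess U} {excess (rotate V)} m))

  -- Of the pairs (t, u), (t, σu), (t, σ²u), two have the same type.
  ¬configuration : ∀ {U V} → ¬ Configuration U V
  ¬configuration {U} {V} C = clash (meet C) (meet (rotateʳ C)) (meet (rotateʳ (rotateʳ C)))
    where
    MeetWith : Triple → Set
    MeetWith V = Meet U V ⊎ Meet (excess U) (excess V)
    clash : MeetWith V → MeetWith (rotate V) → ¬ MeetWith (rotate (rotate V))
    clash (inj₁ a) (inj₁ b) _        = two-sums⇒⊥ C a b
    -- The third rotation of V is V itself by η for records, so `a` has the required type.
    clash (inj₁ a) (inj₂ _) (inj₁ c) = two-sums⇒⊥ (rotateʳ (rotateʳ C)) c a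
    clash (inj₁ _) (inj₂ b) (inj₂ c) = two-products⇒⊥ (rotateʳ C) b c
    clash (inj₂ a) (inj₂ b) _        = two-products⇒⊥ C a b
    clash (inj₂ a) (inj₁ _) (inj₂ c) = two-products⇒⊥ (rotateʳ (rotateʳ C)) c a
    clash (inj₂ _) (inj₁ b) (inj₁ c) = two-sums⇒⊥ (rotateʳ C) b c

  -- From points with irrational coordinates to configurations.

  cancel-factor : ∀ μ₀ μ₁ κ₀ κ₁ d → μ₀ * μ₀ - d * μ₁ * μ₁ ≢ 0ℤ →
    μ₀ * κ₀ + d * (μ₁ * κ₁) ≡ 0ℤ → μ₀ * κ₁ + μ₁ * κ₀ ≡ 0ℤ → κ₀ ≡ 0ℤ × κ₁ ≡ 0ℤ
  cancel-factor μ₀ μ₁ κ₀ κ₁ d norm≢0 h₀ h₁ =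
    *-cancel-zero norm≢0 (linear-combination ρ
      (λ { (μ₀ ∷ μ₁ ∷ κ₀ ∷ κ₁ ∷ d ∷ []) → (μ₀ :* μ₀ :- d :* μ₁ :* μ₁) :* κ₀ ≈ # 0 ⇐
        (μ₀ ⟨ μ₀ :* κ₀ :+ d :* (μ₁ :* κ₁) ≈ # 0 ⟩) ∷
        ((:- (d :* μ₁)) ⟨ μ₀ :* κ₁ :+ μ₁ :* κ₀ ≈ # 0 ⟩) ∷ [] }) (h₀ , h₁ , tt)) ,
    *-cancel-zero norm≢0 (linear-combination ρ
      (λ { (μ₀ ∷ μ₁ ∷ κ₀ ∷ κ₁ ∷ d ∷ []) → (μ₀ :* μ₀ :- d :* μ₁ :* μ₁) :* κ₁ ≈ # 0 ⇐
        ((:- μ₁) ⟨ μ₀ :* κ₀ :+ d :* (μ₁ :* κ₁) ≈ # 0 ⟩) ∷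
        (μ₀ ⟨ μ₀ :* κ₁ :+ μ₁ :* κ₀ ≈ # 0 ⟩) ∷ [] }) (h₀ , h₁ , tt))
    where ρ = μ₀ ∷ μ₁ ∷ κ₀ ∷ κ₁ ∷ d ∷ []

  norm-μ : ∀ a b n d → let open Point a b n d in μ₀ * μ₀ - d * μ₁ * μ₁ ≡ n * n * (α * β)
  norm-μ a b n d = linear-combination (a ∷ b ∷ n ∷ d ∷ [])
    (λ { (a ∷ b ∷ n ∷ d ∷ []) → let open E.Point a b n d in μ₀ :* μ₀ :- d :* μ₁ :* μ₁ ≈ n :* n :* (α :* β) ⇐ [] }) tt

  module _ {d : ℤ} (anisotropic : ∀ x y → x * x ≡ d * (y * y) → y ≡ 0ℤ) where

    norm≢0 : ∀ x {y} → y ≢ 0ℤ → x * x - d * y * y ≢ 0ℤ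
    norm≢0 x {y} y≢0 eq = y≢0 (anisotropic x y
      (trans (ℤₚ.i-j≡0⇒i≡j (x * x) (d * y * y) eq) (ℤₚ.*-assoc d y y)))

    -- The irrational parts of t, σt, σ²t are n b √d over n², β, α. The scalars e and -b bring those
    -- of t and of u to the common numerator w = n b e √d with opposite signs; both values of
    -- `heron` are 4 w².
    both-irrational⇒configuration : ∀ {a b n c e} → n ≢ 0ℤ → b ≢ 0ℤ → e ≢ 0ℤ →
      let open Pair a b n c e n d
          open Point a b n d
          open Point c e n d renaming (α to γ; β to δ) using ()
      in
      G₀ ≡ 0ℤ → G₁ ≡ 0ℤ →
      Configuration ⟨ e * (n * n) , e * β , e * α ⟩ ⟨ - b * (n * n) , - b * δ , - b * γ ⟩
    both-irrational⇒configuration {a} {b} {n} {c} {e} n≢0 b≢0 e≢0 hG₀ hG₁ = record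
      { e₃U≢0 = *-nonzero {e * (n * n) * (e * T.β)} (*-nonzero {e * (n * n)} (*-nonzero {e} e≢0 nn≢0) (*-nonzero {e} e≢0 β≢0))
                          (*-nonzero {e} e≢0 α≢0)
      ; e₃V≢0 = *-nonzero { - b * (n * n) * (- b * U.β)} (*-nonzero { - b * (n * n)} (*-nonzero { - b} -b≢0 nn≢0) (*-nonzero { - b} -b≢0 δ≢0))
                          (*-nonzero { - b} -b≢0 γ≢0)
      ; irrational = scaled-irrational (n * n) T.β T.α (n * n) U.β U.α b e κ₁≡0
      ; rational = scaled-rational (n * n) T.β T.α (n * n) U.β U.α b e κ₀≡0
      ; heron-equal = linear-combination (a ∷ b ∷ n ∷ c ∷ e ∷ d ∷ [])
          (λ { (a ∷ b ∷ n ∷ c ∷ e ∷ d ∷ []) →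
            let open E.Point a b n d
                open E.Point c e n d renaming (α to γ; β to δ) using ()
            in
            E.heron (e :* (n :* n)) (e :* β) (e :* α) ≈ E.heron (:- b :* (n :* n)) (:- b :* δ) (:- b :* γ) ⇐ [] }) tt
      }
      where
      module T = Point a b n d
      module U = Point c e n d
      nn≢0 : n * n ≢ 0ℤ
      nn≢0 = *-nonzero n≢0 n≢0
      -b≢0 : - b ≢ 0ℤ
      -b≢0 = b≢0 ∘ ℤₚ.neg-injective
      α≢0 : T.α ≢ 0ℤ
      α≢0 = norm≢0 a b≢0
      β≢0 : T.β ≢ 0ℤ
      β≢0 = norm≢0 (a + n) b≢0
      γ≢0 : U.α ≢ 0ℤ
      γ≢0 = norm≢0 c e≢0
      δ≢0 : U.β ≢ 0ℤ
      δ≢0 = norm≢0 (c + n) e≢0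
      norm-μ≢0 : T.μ₀ * T.μ₀ - d * T.μ₁ * T.μ₁ ≢ 0ℤ
      norm-μ≢0 eq = *-nonzero {n * n} nn≢0 (*-nonzero {T.α} α≢0 β≢0) (trans (sym (norm-μ a b n d)) eq)
      norm-μ′≢0 : U.μ₀ * U.μ₀ - d * U.μ₁ * U.μ₁ ≢ 0ℤ
      norm-μ′≢0 eq = *-nonzero {n * n} nn≢0 (*-nonzero {U.α} γ≢0 δ≢0) (trans (sym (norm-μ c e n d)) eq)
      E E′ A A′ K K′ κ₀ κ₁ λ₀ λ₁ : ℤ
      E = e₃ (n * n) T.β T.α
      E′ = e₃ (n * n) U.β U.α
      A = alternant (n * n) T.β T.α
      A′ = alternant (n * n) U.β U.α
      K = e₂ (n * n) T.β T.α
      K′ = e₂ (n * n) U.β U.α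
      κ₀ = A * E′ + A′ * E - + 2 * E * E′
      κ₁ = + 2 * n * b * K * E′ + + 2 * n * e * K′ * E
      λ₀ = U.μ₀ * κ₀ + d * (U.μ₁ * κ₁)
      λ₁ = U.μ₀ * κ₁ + U.μ₁ * κ₀
      G≡ = G≡ννμμ a b n c e n d
      gT = ν≡μ*g a b n d
      gU = ν≡μ*g c e n d
      factors = factorisation T.ν₀ T.ν₁ T.μ₀ T.μ₁ E A (+ 2 * n * b * K) U.ν₀ U.ν₁ U.μ₀ U.μ₁ E′ A′ (+ 2 * n * e * K′) d
                              (proj₁ gT) (proj₂ gT) (proj₁ gU) (proj₂ gU)
      λ≡0 : λ₀ ≡ 0ℤ × λ₁ ≡ 0ℤ
      λ≡0 = cancel-factor T.μ₀ T.μ₁ λ₀ λ₁ d norm-μ≢0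
        (trans (sym (proj₁ factors)) (trans (cong (+ 2 * (E * E′) *_) (trans (sym (proj₁ G≡)) hG₀)) (ℤₚ.*-zeroʳ (+ 2 * (E * E′)))))
        (trans (sym (proj₂ factors)) (trans (cong (+ 2 * (E * E′) *_) (trans (sym (proj₂ G≡)) hG₁)) (ℤₚ.*-zeroʳ (+ 2 * (E * E′)))))
      κ≡0 : κ₀ ≡ 0ℤ × κ₁ ≡ 0ℤ
      κ≡0 = cancel-factor U.μ₀ U.μ₁ κ₀ κ₁ d norm-μ′≢0 (proj₁ λ≡0) (proj₂ λ≡0)
      κ₀≡0 : κ₀ ≡ 0ℤ
      κ₀≡0 = proj₁ κ≡0
      κ₁≡0 : b * K * E′ + e * K′ * E ≡ 0ℤ
      κ₁≡0 = *-cancel-zero (*-nonzero {+ 2} (λ ()) n≢0) (trans (regroup K E′ K′ E) (proj₂ κ≡0))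
        where
        regroup : ∀ K E′ K′ E → + 2 * n * (b * K * E′ + e * K′ * E) ≡ + 2 * n * b * K * E′ + + 2 * n * e * K′ * E
        regroup K E′ K′ E = linear-combination (n ∷ b ∷ e ∷ K ∷ E′ ∷ K′ ∷ E ∷ [])
          (λ { (n ∷ b ∷ e ∷ K ∷ E′ ∷ K′ ∷ E ∷ []) →
            # 2 :* n :* (b :* K :* E′ :+ e :* K′ :* E) ≈ # 2 :* n :* b :* K :* E′ :+ # 2 :* n :* e :* K′ :* E ⇐ [] }) tt
      scaled-irrational : ∀ x y z x′ y′ z′ b e → b * e₂ x y z * e₃ x′ y′ z′ + e * e₂ x′ y′ z′ * e₃ x y z ≡ 0ℤ →
        e₂ (e * x) (e * y) (e * z) * e₃ (- b * x′) (- b * y′) (- b * z′) ≡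
        e₂ (- b * x′) (- b * y′) (- b * z′) * e₃ (e * x) (e * y) (e * z)
      scaled-irrational x y z x′ y′ z′ b e h = linear-combination (x ∷ y ∷ z ∷ x′ ∷ y′ ∷ z′ ∷ b ∷ e ∷ [])
        (λ { (x ∷ y ∷ z ∷ x′ ∷ y′ ∷ z′ ∷ b ∷ e ∷ []) →
          E.e₂ (e :* x) (e :* y) (e :* z) :* E.e₃ (:- b :* x′) (:- b :* y′) (:- b :* z′) ≈
          E.e₂ (:- b :* x′) (:- b :* y′) (:- b :* z′) :* E.e₃ (e :* x) (e :* y) (e :* z) ⇐
          ((:- (b :* b :* e :* e)) ⟨ b :* E.e₂ x y z :* E.e₃ x′ y′ z′ :+ e :* E.e₂ x′ y′ z′ :* E.e₃ x y z ≈ # 0 ⟩) ∷ [] }) (h , tt)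
      scaled-rational : ∀ x y z x′ y′ z′ b e →
        alternant x y z * e₃ x′ y′ z′ + alternant x′ y′ z′ * e₃ x y z - + 2 * e₃ x y z * e₃ x′ y′ z′ ≡ 0ℤ →
        alternant (e * x) (e * y) (e * z) * e₃ (- b * x′) (- b * y′) (- b * z′) +
        alternant (- b * x′) (- b * y′) (- b * z′) * e₃ (e * x) (e * y) (e * z) ≡
        + 2 * (e₃ (e * x) (e * y) (e * z) * e₃ (- b * x′) (- b * y′) (- b * z′))
      scaled-rational x y z x′ y′ z′ b e h = linear-combination (x ∷ y ∷ z ∷ x′ ∷ y′ ∷ z′ ∷ b ∷ e ∷ [])
        (λ { (x ∷ y ∷ z ∷ x′ ∷ y′ ∷ z′ ∷ b ∷ e ∷ []) →
          E.alternant (e :* x) (e :* y) (e :* z) :* E.e₃ (:- b :* x′) (:- b :* y′) (:- b :* z′) :+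
          E.alternant (:- b :* x′) (:- b :* y′) (:- b :* z′) :* E.e₃ (e :* x) (e :* y) (e :* z) ≈
          # 2 :* (E.e₃ (e :* x) (e :* y) (e :* z) :* E.e₃ (:- b :* x′) (:- b :* y′) (:- b :* z′)) ⇐
          ((:- (b :* b :* b :* e :* e :* e)) ⟨ E.alternant x y z :* E.e₃ x′ y′ z′ :+ E.alternant x′ y′ z′ :* E.e₃ x y z
            :- # 2 :* E.e₃ x y z :* E.e₃ x′ y′ z′ ≈ # 0 ⟩) ∷ [] }) (h , tt)

  -- Points with a rational coordinate.

  RationalSolution : ℤ → ℤ → ℤ → Set
  RationalSolution a c n = (a ≡ 0ℤ ⊎ a + n ≡ 0ℤ) × (c ≡ 0ℤ ⊎ c + n ≡ 0ℤ)

  G-swap : ∀ a b c e n d →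
    Pair.G₀ a b n c e n d ≡ Pair.G₀ c e n a b n d × Pair.G₁ a b n c e n d ≡ Pair.G₁ c e n a b n d
  G-swap a b c e n d =
    linear-combination ρ (λ { (a ∷ b ∷ c ∷ e ∷ n ∷ d ∷ []) → E.Pair.G₀ a b n c e n d ≈ E.Pair.G₀ c e n a b n d ⇐ [] }) tt ,
    linear-combination ρ (λ { (a ∷ b ∷ c ∷ e ∷ n ∷ d ∷ []) → E.Pair.G₁ a b n c e n d ≈ E.Pair.G₁ c e n a b n d ⇐ [] }) tt
    where ρ = a ∷ b ∷ c ∷ e ∷ n ∷ d ∷ []

  both-rational : ∀ {a c n d} → n ≢ 0ℤ → Pair.G₀ a 0ℤ n c 0ℤ n d ≡ 0ℤ → RationalSolution a c n
  both-rational {a} {c} {n} {d} n≢0 h = solve (elliptic (a * n + c * n) (a * c) (n * n) (*-nonzero {n} n≢0 n≢0)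
    (linear-combination (a ∷ c ∷ n ∷ d ∷ [])
      (λ { (a ∷ c ∷ n ∷ d ∷ []) → E.G (a :* n :+ c :* n) (a :* c) (n :* n) ≈ # 0 ⇐
        (# 1 ⟨ E.Pair.G₀ a (# 0) n c (# 0) n d ≈ # 0 ⟩) ∷ [] }) (h , tt)))
    where
    ρ = a ∷ c ∷ n ∷ []
    solve : (a * n + c * n ≡ 0ℤ × a * c ≡ 0ℤ) ⊎ (a * n + c * n + n * n ≡ 0ℤ × a * c ≡ 0ℤ) ⊎
            (a * n + c * n + + 2 * (n * n) ≡ 0ℤ × a * c ≡ n * n) → RationalSolution a c n
    solve (inj₁ (s , p)) = inj₁ a≡0 , inj₁ (*-cancel-zero n≢0 (linear-combination ρ
      (λ { (a ∷ c ∷ n ∷ []) → n :* c ≈ # 0 ⇐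
        (# 1 ⟨ a :* n :+ c :* n ≈ # 0 ⟩) ∷ ((:- n) ⟨ a ≈ # 0 ⟩) ∷ [] }) (s , a≡0 , tt)))
      where
      a≡0 : a ≡ 0ℤ
      a≡0 = [ id , id ]′ (*-zero {a} (*-cancel-zero n≢0 (linear-combination ρ
        (λ { (a ∷ c ∷ n ∷ []) → n :* (a :* a) ≈ # 0 ⇐
        (a ⟨ a :* n :+ c :* n ≈ # 0 ⟩) ∷ ((:- n) ⟨ a :* c ≈ # 0 ⟩) ∷ [] }) (s , p , tt))))
    solve (inj₂ (inj₁ (s , p))) = [ (λ a≡0 → inj₁ a≡0 , inj₂ (opposite a≡0)) , (λ c≡0 → inj₂ (opposite′ c≡0) , inj₁ c≡0) ]′ (*-zero {a} p)
      where
      opposite : a ≡ 0ℤ → c + n ≡ 0ℤ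
      opposite a≡0 = *-cancel-zero n≢0 (linear-combination ρ
        (λ { (a ∷ c ∷ n ∷ []) → n :* (c :+ n) ≈ # 0 ⇐
        (# 1 ⟨ a :* n :+ c :* n :+ n :* n ≈ # 0 ⟩) ∷ ((:- n) ⟨ a ≈ # 0 ⟩) ∷ [] }) (s , a≡0 , tt))
      opposite′ : c ≡ 0ℤ → a + n ≡ 0ℤ
      opposite′ c≡0 = *-cancel-zero n≢0 (linear-combination ρ
        (λ { (a ∷ c ∷ n ∷ []) → n :* (a :+ n) ≈ # 0 ⇐
        (# 1 ⟨ a :* n :+ c :* n :+ n :* n ≈ # 0 ⟩) ∷ ((:- n) ⟨ c ≈ # 0 ⟩) ∷ [] }) (s , c≡0 , tt))
    solve (inj₂ (inj₂ (s , p))) = inj₂ a+n≡0 , inj₂ (*-cancel-zero n≢0 (linear-combination ρ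
      (λ { (a ∷ c ∷ n ∷ []) → n :* (c :+ n) ≈ # 0 ⇐
        (# 1 ⟨ a :* n :+ c :* n :+ # 2 :* (n :* n) ≈ # 0 ⟩) ∷ ((:- n) ⟨ a :+ n ≈ # 0 ⟩) ∷ [] }) (s , a+n≡0 , tt)))
      where
      a+n≡0 : a + n ≡ 0ℤ
      a+n≡0 = [ id , id ]′ (*-zero {a + n} (*-cancel-zero n≢0 (linear-combination ρ
        (λ { (a ∷ c ∷ n ∷ []) → n :* ((a :+ n) :* (a :+ n)) ≈ # 0 ⇐
        (a ⟨ a :* n :+ c :* n :+ # 2 :* (n :* n) ≈ # 0 ⟩) ∷ ((:- n) ⟨ a :* c ≈ n :* n ⟩) ∷ [] }) (s , p , tt))))

  -- Here the line through the conjugate points is t = a/n.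
  one-rational⇒cusp : ∀ {a c e n d} → n ≢ 0ℤ → e ≢ 0ℤ → let open Pair a 0ℤ n c e n d in
    G₀ ≡ 0ℤ → G₁ ≡ 0ℤ → a ≡ 0ℤ ⊎ a + n ≡ 0ℤ
  one-rational⇒cusp {a} {c} {e} {n} {d} n≢0 e≢0 h₀ h₁ =
    from-line (rational-line P.x₀ P.x₁ P.y₀ P.y₁ P.z d (*-nonzero {n} n≢0 n≢0) h₀ h₁)
    where
    module P = Pair a 0ℤ n c e n d
    ρ : Vec ℤ 5
    ρ = a ∷ c ∷ e ∷ n ∷ d ∷ []
    en≢0 : e * n ≢ 0ℤ
    en≢0 = *-nonzero {e} e≢0 n≢0
    from-line : RationalLine P.x₀ P.x₁ P.y₀ P.y₁ P.z → a ≡ 0ℤ ⊎ a + n ≡ 0ℤ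
    from-line (infinity-x h) = inj₁ (*-cancel-zero e≢0 (linear-combination ρ
      (λ { (a ∷ c ∷ e ∷ n ∷ d ∷ []) → let open E.Pair a (# 0) n c e n d in
        e :* a ≈ # 0 ⇐ (# 1 ⟨ y₁ ≈ # 0 ⟩) ∷ [] }) (h , tt)))
    from-line (infinity-y h) = ⊥-elim (en≢0 (linear-combination ρ
      (λ { (a ∷ c ∷ e ∷ n ∷ d ∷ []) → let open E.Pair a (# 0) n c e n d in
        e :* n ≈ # 0 ⇐ (# 1 ⟨ x₁ ≈ # 0 ⟩) ∷ [] }) (h , tt)))
    from-line (infinity-xy h) = inj₂ (*-cancel-zero e≢0 (linear-combination ρ
      (λ { (a ∷ c ∷ e ∷ n ∷ d ∷ []) → let open E.Pair a (# 0) n c e n d in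
        e :* (a :+ n) ≈ # 0 ⇐ (# 1 ⟨ x₁ :+ y₁ ≈ # 0 ⟩) ∷ [] }) (h , tt)))
    from-line (finite₀ h) = inj₁ ([ id , id ]′ (*-zero {a} (*-cancel-zero en≢0 (linear-combination ρ
      (λ { (a ∷ c ∷ e ∷ n ∷ d ∷ []) → let open E.Pair a (# 0) n c e n d in
        e :* n :* (a :* a) ≈ # 0 ⇐ (# 1 ⟨ x₀ :* y₁ ≈ x₁ :* y₀ ⟩) ∷ [] }) (h , tt)))))
    from-line (finite₁ h) = *-zero {a} (*-cancel-zero en≢0 (linear-combination ρ
      (λ { (a ∷ c ∷ e ∷ n ∷ d ∷ []) → let open E.Pair a (# 0) n c e n d in
        e :* n :* (a :* (a :+ n)) ≈ # 0 ⇐ (# 1 ⟨ (x₀ :+ z) :* y₁ ≈ x₁ :* y₀ ⟩) ∷ [] }) (h , tt)))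
    from-line (finite₂ h) = inj₂ ([ id , id ]′ (*-zero {a + n} (*-cancel-zero en≢0 (linear-combination ρ
      (λ { (a ∷ c ∷ e ∷ n ∷ d ∷ []) → let open E.Pair a (# 0) n c e n d in
        e :* n :* ((a :+ n) :* (a :+ n)) ≈ # 0 ⇐ (# 1 ⟨ (x₀ :+ # 2 :* z) :* y₁ ≈ x₁ :* (y₀ :- z) ⟩) ∷ [] }) (h , tt)))))

  module _ {d : ℤ} (anisotropic : ∀ x y → x * x ≡ d * (y * y) → y ≡ 0ℤ) where

    -- For t = 0 and t = -1 the equation is u² + u = 0 up to sign. Its irrational part gives 2 c + n
    -- = 0, and then its rational part gives c² = d e².
    one-rational⇒⊥ : ∀ {a c e n} → n ≢ 0ℤ → e ≢ 0ℤ → let open Pair a 0ℤ n c e n d in G₀ ≡ 0ℤ → G₁ ≢ 0ℤ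
    one-rational⇒⊥ {a} {c} {e} {n} n≢0 e≢0 h₀ h₁ = [ at-0 , at-−1 ]′ (one-rational⇒cusp {a} {c} {e} {n} {d} n≢0 e≢0 h₀ h₁)
      where
      nnnn≢0 : n * n * (n * n) ≢ 0ℤ
      nnnn≢0 = *-nonzero {n * n} (*-nonzero {n} n≢0 n≢0) (*-nonzero {n} n≢0 n≢0)
      root⇒⊥ : + 2 * c + n ≡ 0ℤ → c * c + d * (e * e) + n * c ≢ 0ℤ
      root⇒⊥ h₁ h₀ = e≢0 (anisotropic c e (linear-combination (c ∷ e ∷ n ∷ d ∷ [])
        (λ { (c ∷ e ∷ n ∷ d ∷ []) → c :* c ≈ d :* (e :* e) ⇐
          (c ⟨ # 2 :* c :+ n ≈ # 0 ⟩) ∷ ((:- # 1) ⟨ c :* c :+ d :* (e :* e) :+ n :* c ≈ # 0 ⟩) ∷ [] }) (h₁ , h₀ , tt)))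
      at-0 : a ≢ 0ℤ
      at-0 refl = root⇒⊥
        (*-cancel-zero (*-nonzero {n * n * (n * n)} nnnn≢0 e≢0) (linear-combination (c ∷ e ∷ n ∷ d ∷ [])
          (λ { (c ∷ e ∷ n ∷ d ∷ []) → let open E.Pair (# 0) (# 0) n c e n d in
            n :* n :* (n :* n) :* e :* (# 2 :* c :+ n) ≈ # 0 ⇐ ((:- # 1) ⟨ G₁ ≈ # 0 ⟩) ∷ [] }) (h₁ , tt)))
        (*-cancel-zero nnnn≢0 (linear-combination (c ∷ e ∷ n ∷ d ∷ [])
          (λ { (c ∷ e ∷ n ∷ d ∷ []) → let open E.Pair (# 0) (# 0) n c e n d in
            n :* n :* (n :* n) :* (c :* c :+ d :* (e :* e) :+ n :* c) ≈ # 0 ⇐ ((:- # 1) ⟨ G₀ ≈ # 0 ⟩) ∷ [] }) (h₀ , tt)))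
      at-−1 : a + n ≢ 0ℤ
      at-−1 eq = at (linear-combination (a ∷ n ∷ []) (λ { (a ∷ n ∷ []) → a ≈ :- n ⇐ (# 1 ⟨ a :+ n ≈ # 0 ⟩) ∷ [] }) (eq , tt))
        where
        at : a ≢ - n
        at refl = root⇒⊥
          (*-cancel-zero (*-nonzero {n * n * (n * n)} nnnn≢0 e≢0) (linear-combination (c ∷ e ∷ n ∷ d ∷ [])
            (λ { (c ∷ e ∷ n ∷ d ∷ []) → let open E.Pair (:- n) (# 0) n c e n d in
              n :* n :* (n :* n) :* e :* (# 2 :* c :+ n) ≈ # 0 ⇐ (# 1 ⟨ G₁ ≈ # 0 ⟩) ∷ [] }) (h₁ , tt)))
          (*-cancel-zero nnnn≢0 (linear-combination (c ∷ e ∷ n ∷ d ∷ [])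
            (λ { (c ∷ e ∷ n ∷ d ∷ []) → let open E.Pair (:- n) (# 0) n c e n d in
              n :* n :* (n :* n) :* (c :* c :+ d :* (e :* e) :+ n :* c) ≈ # 0 ⇐ (# 1 ⟨ G₀ ≈ # 0 ⟩) ∷ [] }) (h₀ , tt)))

    quadratic-points : ∀ {a b c e n} → n ≢ 0ℤ → let open Pair a b n c e n d in G₀ ≡ 0ℤ → G₁ ≡ 0ℤ →
      b ≡ 0ℤ × e ≡ 0ℤ × RationalSolution a c n
    quadratic-points {a} {b} {c} {e} {n} n≢0 h₀ h₁ with b ≟ 0ℤ | e ≟ 0ℤ
    ... | yes refl | yes refl = refl , refl , both-rational {a} {c} {n} {d} n≢0 h₀
    ... | yes refl | no e≢0   = ⊥-elim (one-rational⇒⊥ {a} {c} {e} {n} n≢0 e≢0 h₀ h₁)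
    ... | no b≢0   | yes refl = ⊥-elim (one-rational⇒⊥ {c} {a} {b} {n} n≢0 b≢0
            (trans (proj₁ (G-swap c 0ℤ a b n d)) h₀) (trans (proj₂ (G-swap c 0ℤ a b n d)) h₁))
    ... | no b≢0   | no e≢0   = ⊥-elim (¬configuration (both-irrational⇒configuration anisotropic {a} {b} {n} {c} {e} n≢0 b≢0 e≢0 h₀ h₁))

-- From rational to integral coordinates.

open Naturals using (square-∣⇒∣)
open Integers using (*-nonzero; quadratic-points; RationalSolution; square≡+)
open import Data.Nat.Divisibility using (divides)
open import Data.Rational as ℚ using (ℚ; 0ℚ; 1ℚ)
import Data.Rational.Properties as ℚₚ
open import Data.Rational.Unnormalised as ℚᵘ using (mkℚᵘ; *≡*; _≃_)
import Data.Rational.Unnormalised.Properties as ℚᵘₚ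

fromℤ : ℤ → ℚ
fromℤ i = i ℚ./ 1

toℚᵘ-fromℤ : ∀ i → ℚ.toℚᵘ (fromℤ i) ≃ mkℚᵘ i 0
toℚᵘ-fromℤ i = ℚₚ.toℚᵘ-fromℚᵘ (mkℚᵘ i 0)

fromℤ-+ : ∀ i j → fromℤ (i ℤ.+ j) ≡ fromℤ i ℚ.+ fromℤ j
fromℤ-+ i j = ℚₚ.toℚᵘ-injective (begin
  ℚ.toℚᵘ (fromℤ (i ℤ.+ j))                       ≈⟨ toℚᵘ-fromℤ (i ℤ.+ j) ⟩
  mkℚᵘ (i ℤ.+ j) 0                               ≈⟨ *≡* (cong (ℤ._* ℤ.1ℤ) (sym (cong₂ ℤ._+_ (ℤₚ.*-identityʳ i) (ℤₚ.*-identityʳ j)))) ⟩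
  mkℚᵘ i 0 ℚᵘ.+ mkℚᵘ j 0                         ≈⟨ ℚᵘₚ.+-cong (toℚᵘ-fromℤ i) (toℚᵘ-fromℤ j) ⟨
  ℚ.toℚᵘ (fromℤ i) ℚᵘ.+ ℚ.toℚᵘ (fromℤ j)         ≈⟨ ℚₚ.toℚᵘ-homo-+ (fromℤ i) (fromℤ j) ⟨
  ℚ.toℚᵘ (fromℤ i ℚ.+ fromℤ j)                   ∎)
  where open ℚᵘₚ.≃-Reasoning

fromℤ-* : ∀ i j → fromℤ (i ℤ.* j) ≡ fromℤ i ℚ.* fromℤ j
fromℤ-* i j = ℚₚ.toℚᵘ-injective (begin
  ℚ.toℚᵘ (fromℤ (i ℤ.* j))                       ≈⟨ toℚᵘ-fromℤ (i ℤ.* j) ⟩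
  mkℚᵘ i 0 ℚᵘ.* mkℚᵘ j 0                         ≈⟨ ℚᵘₚ.*-cong (toℚᵘ-fromℤ i) (toℚᵘ-fromℤ j) ⟨
  ℚ.toℚᵘ (fromℤ i) ℚᵘ.* ℚ.toℚᵘ (fromℤ j)         ≈⟨ ℚₚ.toℚᵘ-homo-* (fromℤ i) (fromℤ j) ⟨
  ℚ.toℚᵘ (fromℤ i ℚ.* fromℤ j)                   ∎)
  where open ℚᵘₚ.≃-Reasoning

fromℤ-neg : ∀ i → fromℤ (ℤ.- i) ≡ ℚ.- fromℤ i
fromℤ-neg i = ℚₚ.toℚᵘ-injective (begin
  ℚ.toℚᵘ (fromℤ (ℤ.- i))     ≈⟨ toℚᵘ-fromℤ (ℤ.- i) ⟩
  ℚᵘ.- mkℚᵘ i 0              ≈⟨ ℚᵘₚ.-‿cong (toℚᵘ-fromℤ i) ⟨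
  ℚᵘ.- ℚ.toℚᵘ (fromℤ i)      ≈⟨ ℚₚ.toℚᵘ-homo‿- (fromℤ i) ⟨
  ℚ.toℚᵘ (ℚ.- fromℤ i)       ∎)
  where open ℚᵘₚ.≃-Reasoning

fromℤ-injective : ∀ {i j} → fromℤ i ≡ fromℤ j → i ≡ j
fromℤ-injective {i} {j} eq with ℚᵘₚ.≃-trans (ℚᵘₚ.≃-sym (toℚᵘ-fromℤ i)) (ℚᵘₚ.≃-trans (ℚᵘₚ.≃-reflexive (cong ℚ.toℚᵘ eq)) (toℚᵘ-fromℤ j))
... | *≡* h = trans (sym (ℤₚ.*-identityʳ i)) (trans h (ℤₚ.*-identityʳ j))

fromℤ-denominator : ∀ q → fromℤ (ℚ.↧ q) ℚ.* q ≡ fromℤ (ℚ.↥ q)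
fromℤ-denominator q@record{} = ℚₚ.toℚᵘ-injective (begin
  ℚ.toℚᵘ (fromℤ (ℚ.↧ q) ℚ.* q)               ≈⟨ ℚₚ.toℚᵘ-homo-* (fromℤ (ℚ.↧ q)) q ⟩
  ℚ.toℚᵘ (fromℤ (ℚ.↧ q)) ℚᵘ.* ℚ.toℚᵘ q       ≈⟨ ℚᵘₚ.*-cong (toℚᵘ-fromℤ (ℚ.↧ q)) ℚᵘₚ.≃-refl ⟩
  mkℚᵘ (ℚ.↧ q) 0 ℚᵘ.* ℚ.toℚᵘ q               ≈⟨ *≡* (trans (ℤₚ.*-identityʳ (ℚ.↧ q ℤ.* ℚ.↥ q)) (trans (ℤₚ.*-comm (ℚ.↧ q) (ℚ.↥ q)) (cong (ℚ.↥ q ℤ.*_) (sym (ℤₚ.*-identityˡ (ℚ.↧ q)))))) ⟩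
  mkℚᵘ (ℚ.↥ q) 0                             ≈⟨ toℚᵘ-fromℤ (ℚ.↥ q) ⟨
  ℚ.toℚᵘ (fromℤ (ℚ.↥ q))                     ∎)
  where open ℚᵘₚ.≃-Reasoning

module Qₛ = Solver ℚₚ.+-*-isCommutativeRing fromℤ fromℤ-+ fromℤ-* fromℤ-neg refl refl

-- The bracketing of `F` is repeated over expressions, so that evaluating `Fₑ` in ℚ yields `F`
-- definitionally.
module _ {n} (d : Expr n) where
  Pairₑ = Expr n × Expr n
  infixl 6 _⊞_
  infixl 7 _⊠_
  _⊞_ _⊠_ : Pairₑ → Pairₑ → Pairₑ
  (a , b) ⊞ (c , e) = (a :+ c , b :+ e)
  (a , b) ⊠ (c , e) = (a :* c :+ d :* (b :* e) , a :* e :+ b :* c)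
  ⊟_ : Pairₑ → Pairₑ
  ⊟ (a , b) = (:- a , :- b)
  cstₑ : ℤ → Pairₑ
  cstₑ k = (con k , con ℤ.0ℤ)
  Fₑ : Pairₑ → Pairₑ → Pairₑ
  Fₑ t u =
      t ⊠ (t ⊞ cstₑ (ℤ.+ 1)) ⊠ (u ⊠ u ⊠ u)
    ⊞ (t ⊠ t ⊠ t ⊞ cstₑ (ℤ.+ 2) ⊠ (t ⊠ t) ⊞ ⊟ t ⊞ cstₑ (ℤ.- ℤ.+ 1)) ⊠ (u ⊠ u)
    ⊞ (t ⊠ t ⊠ t ⊞ ⊟ (t ⊠ t) ⊞ cstₑ (ℤ.- ℤ.+ 4) ⊠ t ⊞ cstₑ (ℤ.- ℤ.+ 1)) ⊠ u
    ⊞ ⊟ (t ⊠ (t ⊞ cstₑ (ℤ.+ 1)))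

module Integral = Polynomials ℤ._+_ ℤ._*_ ℤ.-_ ℤ.+_
module Rational = Polynomials ℚ._+_ ℚ._*_ ℚ.-_ (fromℤ ∘ ℤ.+_)
module Syntactic {n} = Polynomials (_:+_ {n}) _:*_ :-_ #_

fromℤ-⟦⟧ : ∀ {n} (x : Expr n) ρ → fromℤ (⟦ x ⟧ ρ) ≡ Qₛ.⟦ x ⟧ (map fromℤ ρ)
fromℤ-⟦⟧ (var i)  ρ = sym (lookup-map i fromℤ ρ)
fromℤ-⟦⟧ (con c)  ρ = refl
fromℤ-⟦⟧ (x :+ y) ρ = trans (fromℤ-+ (⟦ x ⟧ ρ) (⟦ y ⟧ ρ)) (cong₂ ℚ._+_ (fromℤ-⟦⟧ x ρ) (fromℤ-⟦⟧ y ρ))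
fromℤ-⟦⟧ (x :* y) ρ = trans (fromℤ-* (⟦ x ⟧ ρ) (⟦ y ⟧ ρ)) (cong₂ ℚ._*_ (fromℤ-⟦⟧ x ρ) (fromℤ-⟦⟧ y ρ))
fromℤ-⟦⟧ (:- x)   ρ = trans (fromℤ-neg (⟦ x ⟧ ρ)) (cong ℚ.-_ (fromℤ-⟦⟧ x ρ))

-- F(t, u) = G(t + u, t u, 1) identically; G is a cubic form and its arguments are scaled by n²,
-- whence the coefficient n⁶.
F⇒G : ∀ d {n a b c e t₀ t₁ u₀ u₁} → n ℚ.* t₀ ≡ a → n ℚ.* t₁ ≡ b → n ℚ.* u₀ ≡ c → n ℚ.* u₁ ≡ e →
  OnY d (t₀ , t₁) (u₀ , u₁) → let open Rational.Pair a b n c e n (fromℤ d) in G₀ ≡ 0ℚ × G₁ ≡ 0ℚ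
F⇒G d {n} {t₀ = t₀} {t₁} {u₀} {u₁} refl refl refl refl onY =
  Qₛ.linear-combination ρ (λ { (t₀ ∷ t₁ ∷ u₀ ∷ u₁ ∷ n ∷ d ∷ []) →
    Syntactic.Pair.G₀ (n :* t₀) (n :* t₁) n (n :* u₀) (n :* u₁) n d ≈ # 0 ⇐
    ((n :* n :* n :* (n :* n :* n)) ⟨ proj₁ (Fₑ d (t₀ , t₁) (u₀ , u₁)) ≈ # 0 ⟩) ∷ [] }) (cong proj₁ onY , tt) ,
  Qₛ.linear-combination ρ (λ { (t₀ ∷ t₁ ∷ u₀ ∷ u₁ ∷ n ∷ d ∷ []) →
    Syntactic.Pair.G₁ (n :* t₀) (n :* t₁) n (n :* u₀) (n :* u₁) n d ≈ # 0 ⇐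
    ((n :* n :* n :* (n :* n :* n)) ⟨ proj₂ (Fₑ d (t₀ , t₁) (u₀ , u₁)) ≈ # 0 ⟩) ∷ [] }) (cong proj₂ onY , tt)
  where ρ = t₀ ∷ t₁ ∷ u₀ ∷ u₁ ∷ n ∷ fromℤ d ∷ []

F⇒Gℤ : ∀ d {n a b c e t₀ t₁ u₀ u₁} → fromℤ n ℚ.* t₀ ≡ fromℤ a → fromℤ n ℚ.* t₁ ≡ fromℤ b →
  fromℤ n ℚ.* u₀ ≡ fromℤ c → fromℤ n ℚ.* u₁ ≡ fromℤ e →
  OnY d (t₀ , t₁) (u₀ , u₁) → let open Integral.Pair a b n c e n d in G₀ ≡ ℤ.0ℤ × G₁ ≡ ℤ.0ℤ
F⇒Gℤ d {n} {a} {b} {c} {e} ht₀ ht₁ hu₀ hu₁ onY =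
  fromℤ-injective (trans (fromℤ-⟦⟧ (G₀ₑ vars) ρ) (proj₁ G≡0)) ,
  fromℤ-injective (trans (fromℤ-⟦⟧ (G₁ₑ vars) ρ) (proj₂ G≡0))
  where
  ρ : Vec ℤ 6
  ρ = a ∷ b ∷ n ∷ c ∷ e ∷ d ∷ []
  vars : Vec (Expr 6) 6
  vars = Qₛ.variables 6
  G₀ₑ G₁ₑ : Vec (Expr 6) 6 → Expr 6
  G₀ₑ (a ∷ b ∷ n ∷ c ∷ e ∷ d ∷ []) = Syntactic.Pair.G₀ a b n c e n d
  G₁ₑ (a ∷ b ∷ n ∷ c ∷ e ∷ d ∷ []) = Syntactic.Pair.G₁ a b n c e n d
  G≡0 = F⇒G d ht₀ ht₁ hu₀ hu₁ onY

clear-denominator : ∀ {n} p k → n ≡ ℚ.↧ p ℤ.* k → fromℤ n ℚ.* p ≡ fromℤ (ℚ.↥ p ℤ.* k)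
clear-denominator p k refl = trans (cong (ℚ._* p) (fromℤ-* (ℚ.↧ p) k)) (trans
  (Qₛ.linear-combination (fromℤ (ℚ.↧ p) ∷ fromℤ (ℚ.↥ p) ∷ fromℤ k ∷ p ∷ [])
    (λ { (↧p ∷ ↥p ∷ k ∷ p ∷ []) → ↧p :* k :* p ≈ ↥p :* k ⇐ (k ⟨ ↧p :* p ≈ ↥p ⟩) ∷ [] }) (fromℤ-denominator p , tt))
  (sym (fromℤ-* (ℚ.↥ p) k)))

-- For y ≠ 0, y² ∣ x² implies y ∣ x, and the quotient is an integral square root of d.
nonsquare⇒anisotropic : ∀ {d} → NonSquare d → ∀ x y → x ℤ.* x ≡ d ℤ.* (y ℤ.* y) → y ≡ ℤ.0ℤ
nonsquare⇒anisotropic {d} nonsquare x y eq with y ℤ.≟ ℤ.0ℤ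
... | yes y≡0 = y≡0
... | no y≢0  = contradiction d-square λ (k , kk≡d) → nonsquare k kk≡d
  where
  ∣y∣∣∣x∣ : ∃ λ k → ℤ.∣ x ∣ ≡ k ℕ.* ℤ.∣ y ∣
  ∣y∣∣∣x∣ with square-∣⇒∣ {ℤ.∣ y ∣} {ℤ.∣ x ∣} (y≢0 ∘ ℤₚ.∣i∣≡0⇒i≡0) (divides ℤ.∣ d ∣
    (trans (sym (ℤₚ.abs-* x x)) (trans (cong ℤ.∣_∣ eq) (trans (ℤₚ.abs-* d (y ℤ.* y)) (cong (ℤ.∣ d ∣ ℕ.*_) (ℤₚ.abs-* y y))))))
  ... | divides k h = k , h
  d-square : ∃ λ k → k ℤ.* k ≡ d
  d-square = from-quotient ∣y∣∣∣x∣
    where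
    from-quotient : (∃ λ k → ℤ.∣ x ∣ ≡ k ℕ.* ℤ.∣ y ∣) → ∃ λ k → k ℤ.* k ≡ d
    from-quotient (k , h) = ℤ.+ k , ℤₚ.*-cancelʳ-≡ (ℤ.+ k ℤ.* ℤ.+ k) d (y ℤ.* y) {{ℤ.≢-nonZero (*-nonzero {y} y≢0 y≢0)}}
      (trans (sym xx) eq)
      where
      xx : x ℤ.* x ≡ ℤ.+ k ℤ.* ℤ.+ k ℤ.* (y ℤ.* y)
      xx = trans (square≡+ x) (trans (cong (λ m → ℤ.+ (m ℕ.* m)) h)
        (trans (cong ℤ.+_ (ℕₚ.[m*n]*[o*p]≡[m*o]*[n*p] k ℤ.∣ y ∣ k ℤ.∣ y ∣))
        (trans (ℤₚ.pos-* (k ℕ.* k) (ℤ.∣ y ∣ ℕ.* ℤ.∣ y ∣)) (cong₂ ℤ._*_ (ℤₚ.pos-* k k) (sym (square≡+ y))))))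

cancel-fromℤ : ∀ {n p q} → n ≢ ℤ.0ℤ → fromℤ n ℚ.* p ≡ fromℤ n ℚ.* q → p ≡ q
cancel-fromℤ {n} {p} {q} n≢0 eq = trans (sym (undo p)) (trans (cong (ℚ.1/ fromℤ n ℚ.*_) eq) (undo q))
  where
  instance
    fromℤn≢0 : ℚ.NonZero (fromℤ n)
    fromℤn≢0 = ℚ.≢-nonZero (n≢0 ∘ fromℤ-injective)
  undo : ∀ p → ℚ.1/ fromℤ n ℚ.* (fromℤ n ℚ.* p) ≡ p
  undo p = trans (sym (ℚₚ.*-assoc (ℚ.1/ fromℤ n) (fromℤ n) p))
                 (trans (cong (ℚ._* p) (ℚₚ.*-inverseˡ (fromℤ n))) (ℚₚ.*-identityˡ p))

OnY⇒InFour : ∀ d → NonSquare d → ∀ t u → OnY d t u → InFour t u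
OnY⇒InFour d nonsquare (t₀ , t₁) (u₀ , u₁) onY =
  conclude (quadratic-points (nonsquare⇒anisotropic nonsquare) {a} {b} {c} {e} {n} n≢0 (proj₁ G≡0) (proj₂ G≡0))
  where
  p q r s n a b c e : ℤ
  p = ℚ.↧ t₀
  q = ℚ.↧ t₁
  r = ℚ.↧ u₀
  s = ℚ.↧ u₁
  n = p ℤ.* (q ℤ.* (r ℤ.* s))
  a = ℚ.↥ t₀ ℤ.* (q ℤ.* (r ℤ.* s))
  b = ℚ.↥ t₁ ℤ.* (p ℤ.* (r ℤ.* s))
  c = ℚ.↥ u₀ ℤ.* (p ℤ.* (q ℤ.* s))
  e = ℚ.↥ u₁ ℤ.* (p ℤ.* (q ℤ.* r))
  n≢0 : n ≢ ℤ.0ℤ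
  n≢0 = *-nonzero {p} {q ℤ.* (r ℤ.* s)} (λ ()) (*-nonzero {q} {r ℤ.* s} (λ ()) (*-nonzero {r} {s} (λ ()) (λ ())))
  ρ : Vec ℤ 4
  ρ = p ∷ q ∷ r ∷ s ∷ []
  ht₀ : fromℤ n ℚ.* t₀ ≡ fromℤ a
  ht₀ = clear-denominator t₀ (q ℤ.* (r ℤ.* s)) refl
  ht₁ : fromℤ n ℚ.* t₁ ≡ fromℤ b
  ht₁ = clear-denominator t₁ (p ℤ.* (r ℤ.* s)) (linear-combination ρ
    (λ { (p ∷ q ∷ r ∷ s ∷ []) → p :* (q :* (r :* s)) ≈ q :* (p :* (r :* s)) ⇐ [] }) tt)
  hu₀ : fromℤ n ℚ.* u₀ ≡ fromℤ c
  hu₀ = clear-denominator u₀ (p ℤ.* (q ℤ.* s)) (linear-combination ρ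
    (λ { (p ∷ q ∷ r ∷ s ∷ []) → p :* (q :* (r :* s)) ≈ r :* (p :* (q :* s)) ⇐ [] }) tt)
  hu₁ : fromℤ n ℚ.* u₁ ≡ fromℤ e
  hu₁ = clear-denominator u₁ (p ℤ.* (q ℤ.* r)) (linear-combination ρ
    (λ { (p ∷ q ∷ r ∷ s ∷ []) → p :* (q :* (r :* s)) ≈ s :* (p :* (q :* r)) ⇐ [] }) tt)
  G≡0 = F⇒Gℤ d {n} {a} {b} {c} {e} ht₀ ht₁ hu₀ hu₁ onY
  value-0 : ∀ {x k} → fromℤ n ℚ.* x ≡ fromℤ k → k ≡ ℤ.0ℤ → x ≡ 0ℚ
  value-0 h refl = cancel-fromℤ n≢0 (trans h (sym (ℚₚ.*-zeroʳ (fromℤ n))))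
  value-−1 : ∀ {x k} → fromℤ n ℚ.* x ≡ fromℤ k → k ℤ.+ n ≡ ℤ.0ℤ → x ≡ ℚ.- 1ℚ
  value-−1 {k = k} h k+n≡0 = cancel-fromℤ n≢0 (trans h (trans (cong fromℤ k≡) (fromℤ-* n ℤ.-1ℤ)))
    where
    k≡ : k ≡ n ℤ.* ℤ.-1ℤ
    k≡ = opposite k n k+n≡0
      where
      opposite : ∀ k n → k ℤ.+ n ≡ ℤ.0ℤ → k ≡ n ℤ.* ℤ.-1ℤ
      opposite k n h = linear-combination (k ∷ n ∷ [])
        (λ { (k ∷ n ∷ []) → k ≈ n :* con ℤ.-1ℤ ⇐ (# 1 ⟨ k :+ n ≈ # 0 ⟩) ∷ [] }) (h , tt)
  conclude : b ≡ ℤ.0ℤ × e ≡ ℤ.0ℤ × RationalSolution a c n → InFour (t₀ , t₁) (u₀ , u₁)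
  conclude (b≡0 , e≡0 , at , au) = combine (coordinate t₀ t₁ a b ht₀ ht₁ b≡0 at) (coordinate u₀ u₁ c e hu₀ hu₁ e≡0 au)
    where
    coordinate : ∀ x y k l → fromℤ n ℚ.* x ≡ fromℤ k → fromℤ n ℚ.* y ≡ fromℤ l → l ≡ ℤ.0ℤ →
      k ≡ ℤ.0ℤ ⊎ k ℤ.+ n ≡ ℤ.0ℤ → (x , y) ≡ emb 0ℚ ⊎ (x , y) ≡ emb (ℚ.- 1ℚ)
    coordinate x y k l hx hy l≡0 = Sum.map (λ k≡0 → cong₂ _,_ (value-0 hx k≡0) (value-0 hy l≡0))
                                      (λ k+n≡0 → cong₂ _,_ (value-−1 {x} {k} hx k+n≡0) (value-0 hy l≡0))
    combine : ∀ {t u} → t ≡ emb 0ℚ ⊎ t ≡ emb (ℚ.- 1ℚ) → u ≡ emb 0ℚ ⊎ u ≡ emb (ℚ.- 1ℚ) → InFour t u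
    combine (inj₁ refl) (inj₁ refl) = inj₂ (inj₁ refl)
    combine (inj₁ refl) (inj₂ refl) = inj₁ refl
    combine (inj₂ refl) (inj₁ refl) = inj₂ (inj₂ (inj₁ refl))
    combine (inj₂ refl) (inj₂ refl) = inj₂ (inj₂ (inj₂ refl))

InFour⇒OnY : ∀ d t u → InFour t u → OnY d t u
InFour⇒OnY d t u = λ
  { (inj₁ refl)               → vanishes (# 0) (con ℤ.-1ℤ)
  ; (inj₂ (inj₁ refl))        → vanishes (# 0) (# 0)
  ; (inj₂ (inj₂ (inj₁ refl))) → vanishes (con ℤ.-1ℤ) (# 0)
  ; (inj₂ (inj₂ (inj₂ refl))) → vanishes (con ℤ.-1ℤ) (con ℤ.-1ℤ)
  }
  where
  -- The two tests are arguments because they compute only once `a` and `c` are concrete, at the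
  -- four calls; `var zero` stands for d.
  vanishes : (a c : Expr 1) →
    let G = Fₑ (var zero) (a , # 0) (c , # 0) ; ρ = fromℤ d ∷ [] in
    {T (isZero (normalise (proj₁ G :- # 0 :- # 0)))} → {T (isZero (normalise (proj₂ G :- # 0 :- # 0)))} →
    (Qₛ.⟦ proj₁ G ⟧ ρ , Qₛ.⟦ proj₂ G ⟧ ρ) ≡ (0ℚ , 0ℚ)
  vanishes a c {z₀} {z₁} = cong₂ _,_
    (Qₛ.linear-combination (fromℤ d ∷ []) (λ { (d ∷ []) → proj₁ (Fₑ d (a , # 0) (c , # 0)) ≈ # 0 ⇐ [] }) {z₀} tt)
    (Qₛ.linear-combination (fromℤ d ∷ []) (λ { (d ∷ []) → proj₂ (Fₑ d (a , # 0) (c , # 0)) ≈ # 0 ⇐ [] }) {z₁} tt)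

theorem4p10 : (d : ℤ) → NonSquare d → (t u : Quad) → OnY d t u ⇔ InFour t u
theorem4p10 d nonsquare t u = mk⇔ (OnY⇒InFour d nonsquare t u) (InFour⇒OnY d t u)
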